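{- Let $k\ge 1$ and suppose $H_k=2^{2k+1}-2^{k+1}+1$ is prime. Let $m$ be an integer with $m\not\equiv 0\pmod{H_k}$ that is a fourth power modulo $H_k$, and let $E(H_k)$ be the group of $\mathbb{F}_{H_k}$-rational points of the elliptic curve $E:y^2=x^3-mx$. Then \[E(H_k)\cong \mathbb{Z}/2^{k}\mathbb{Z}\oplus \mathbb{Z}/2^{k+1}\mathbb{Z}.\] -}

module Defs where

open import Data.Nat as ℕ using (ℕ; zero; suc; NonZero; _<_; _∸_; _^_)
open import Data.Nat.DivMod using (_mod_)
open import Data.Integer as ℤ using (ℤ; +_; _-_; _*_)
open import Data.Integer.DivMod using (_%ℕ_)
open import Data.Fin using (Fin; toℕ)
open import Data.Product using (_×_; _,_)
open import Relation.Binary.PropositionalEquality using (_≡_)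
open import Relation.Nullary using (¬_)
open import Data.Bool using (Bool; true; false; if_then_else_)
open import Data.Nat using (_≡ᵇ_)

H : ℕ → ℕ
H k = suc (2 ^ (2 ℕ.* k ℕ.+ 1) ∸ 2 ^ (k ℕ.+ 1))

-- Projective points of y^2 = x^3 - m x over F_p, with affine coordinates
-- represented by their canonical representatives in {0,…,p-1}.
data Pt : Set where
  O   : Pt
  aff : ℕ → ℕ → Pt

module Curve (p : ℕ) .{{_ : NonZero p}} (m : ℤ) where

  red : ℤ → ℕ
  red z = z %ℕ p

  -- inverse in F_p (p prime) via Fermat: a⁻¹ = a^(p-2)
  inv : ℕ → ℕ
  inv a = red ((+ a) ℤ.^ (p ∸ 2))

  OnCurve : Pt → Set
  OnCurve O = Data.Unit.⊤
    where import Data.Unit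
  OnCurve (aff x y) =
    (x < p) × (y < p) ×
    (red ((+ y) * (+ y) - ((+ x) * (+ x) * (+ x) - m * (+ x))) ≡ 0)

  -- chord-and-tangent group law on E(F_p), O the point at infinity
  _⊕_ : Pt → Pt → Pt
  O ⊕ Q = Q
  P ⊕ O = P
  aff x₁ y₁ ⊕ aff x₂ y₂ =
    if (x₁ ≡ᵇ x₂) ∧ (red (+ y₁ ℤ.+ + y₂) ≡ᵇ 0)
    then O
    else aff x₃ y₃
    where
      open Data.Bool using (_∧_)
      λ' : ℕ
      λ' = if x₁ ≡ᵇ x₂
           then red ((ℤ.+ 3 * (+ x₁) * (+ x₁) - m) * (+ inv (red (ℤ.+ 2 * + y₁))))
           else red ((+ y₂ - + y₁) * (+ inv (red (+ x₂ - + x₁))))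
      x₃ : ℕ
      x₃ = red ((+ λ') * (+ λ') - + x₁ - + x₂)
      y₃ : ℕ
      y₃ = red ((+ λ') * (+ x₁ - + x₃) - + y₁)

_+ₙ_ : ∀ {n} .{{_ : NonZero n}} → Fin n → Fin n → Fin n
_+ₙ_ {n} a b = (toℕ a ℕ.+ toℕ b) mod n

_+ᵖ_ : ∀ {a b} .{{_ : NonZero a}} .{{_ : NonZero b}} →
       Fin a × Fin b → Fin a × Fin b → Fin a × Fin b
(a₁ , b₁) +ᵖ (a₂ , b₂) = (a₁ +ₙ a₂) , (b₁ +ₙ b₂)

G : ℕ → Set
G k = Fin (2 ^ k) × Fin (2 ^ (k ℕ.+ 1))

addG : ∀ k → G k → G k → G k
addG k = _+ᵖ_ {{m^n≢0 2 k}} {{m^n≢0 2 (k ℕ.+ 1)}}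
  where open import Data.Nat.Properties using (m^n≢0)

{-# OPTIONS --safe #-}
-- Write p = H k = 2a² − 2a + 1 with a = 2ᵏ, so that p = a² + (a − 1)² and i = 2a − 1 is a square
-- root of −1 modulo p.  The group E(F_p) is a module over the Gaussian integers through
-- ι (x , y) = (−x , iy), and α = 1 + ι has kernel {O , T} with T = (0 , 0).
--
-- Order.  Let S(c) = Σₓ χ(x³ − cx), with χ the quadratic character, so that |E(F_p)| = p + 1 + S(m).
-- Jacobsthal's identity S(m)² + S(nm)² = 4p, for n a nonresidue, and the uniqueness of the
-- representation of p as a sum of two squares give S(m) = ±2 (a − 1).  If m = t⁴ then
-- T = α²(it² , (1 − i)t³), hence 8 divides |E(F_p)|; this fixes the sign, and |E(F_p)| = 2²ᵏ⁺¹.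
--
-- Structure.  As long as T lies in the image of αʲ, that image has order |E(F_p)| / 2ʲ, and since
-- E(F_p) is a 2-group every nontrivial image contains T.  So T = α²ᵏ P, which up to a power of ι
-- is 2ᵏ P because α² = 2ι, and (a , b) ↦ a (αP) + b P is the isomorphism.
--
-- Associativity of the chord-and-tangent law is obtained by comparing the functions
-- x² + βx + γ − σy that vanish at P, Q, R and −((P + Q) + R), respectively −(P + (Q + R)).
module Submission where

-- As a module over the Gaussian integers the group turns out to be cyclic, the quotient by (1 +
-- i)²ᵏ⁺¹. The descent along the images of α replaces a structure theorem: α has a kernel of order
-- two, so its images shrink by exactly a factor 2 as long as they contain T, and a preimage of T
-- under α²ᵏ generates. The ideal (1 + i)²ᵏ⁺¹ is spanned over the integers by 2ᵏ (1 + i) and 2ᵏ⁺¹,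
-- so the basis 1 + i, 1 diagonalises it; this is why the isomorphism is built on αP and P and not
-- on ιP and P. Jacobsthal's identity is a second moment. The sum of S(c)² over all c is 2p (p - 1)
-- by near-orthogonality of the shifts of χ; on the other hand S(c)² depends only on c modulo
-- squares, so it takes the values S(m)² and S(nm)², each (p - 1)/2 times, and 0 at c = 0. The two
-- signs of S(m) would give the orders 2a² and 2a² - 4a + 4. Both are multiples of 4, so only
-- divisibility by 8 tells them apart; the fourth root t of m supplies the rational point behind it.

open import Data.Nat using (ℕ; NonZero)
open import Data.Nat.Primality using (Prime)
open import Data.Integer using (ℤ)

-- Finite sums over lists, and counting by double summation.

module FiniteSums where

  open import Data.Bool using (if_then_else_)
  open import Data.Integer as ℤ using (ℤ; +_; _+_; _*_; _≤_)
  import Data.Integer.Properties as ℤₚ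
  open import Data.Integer.Tactic.RingSolver using (solve-∀)
  open import Data.List using (List; []; _∷_; map; length)
  open import Data.List.Membership.Propositional using (_∈_)
  open import Data.List.Membership.Propositional.Properties using (∈-map⁺; ∈-map⁻)
  open import Data.List.Membership.Propositional.Properties.WithK using (unique∧set⇒bag)
  open import Data.List.Relation.Binary.BagAndSetEquality using (∼bag⇒↭)
  open import Data.List.Relation.Binary.Permutation.Propositional using (_↭_; refl; prep; swap; trans)
  open import Data.List.Relation.Unary.All as All using (All)
  import Data.List.Relation.Unary.AllPairs as AllPairs
  open import Data.List.Relation.Unary.Any using (here; there)
  open import Data.List.Relation.Unary.Unique.Propositional using (Unique)
  open import Data.Product using (_,_)
  open import Data.Empty using (⊥-elim)
  open import Function.Bundles using (mk⇔)
  open import Relation.Nullary using (¬_; Dec; yes; no; does)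
  open import Relation.Nullary.Decidable using (decidable-stable)
  open import Relation.Binary.Definitions using (DecidableEquality)
  open import Relation.Binary.PropositionalEquality as ≡ using (_≡_; cong; cong₂; sym; subst; module ≡-Reasoning)

  -- The Iverson bracket, valued in the integers so that cardinalities and character sums can be
  -- added to one another.
  ⟦_⟧ : ∀ {P : Set} → Dec P → ℤ
  ⟦ d ⟧ = if does d then + 1 else + 0

  ⟦⟧-yes : ∀ {P : Set} (d : Dec P) → P → ⟦ d ⟧ ≡ + 1
  ⟦⟧-yes (yes _) p = ≡.refl
  ⟦⟧-yes (no ¬p) p = ⊥-elim (¬p p)

  ⟦⟧-no : ∀ {P : Set} (d : Dec P) → ¬ P → ⟦ d ⟧ ≡ + 0
  ⟦⟧-no (yes p) ¬p = ⊥-elim (¬p p)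
  ⟦⟧-no (no _)  ¬p = ≡.refl

  ⟦⟧-cong : ∀ {P Q : Set} (d : Dec P) (e : Dec Q) → (P → Q) → (Q → P) → ⟦ d ⟧ ≡ ⟦ e ⟧
  ⟦⟧-cong d (yes q) f g = ⟦⟧-yes d (g q)
  ⟦⟧-cong d (no ¬q) f g = ⟦⟧-no d (λ p → ¬q (f p))

  module _ {A : Set} where

    ∑ : List A → (A → ℤ) → ℤ
    ∑ []       f = + 0
    ∑ (x ∷ xs) f = f x + ∑ xs f

    ∑-cong : ∀ xs {f g : A → ℤ} → (∀ x → x ∈ xs → f x ≡ g x) → ∑ xs f ≡ ∑ xs g
    ∑-cong []       e = ≡.refl
    ∑-cong (x ∷ xs) e = cong₂ _+_ (e x (here ≡.refl)) (∑-cong xs (λ y m → e y (there m)))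

    ∑-ext : ∀ xs {f g : A → ℤ} → (∀ x → f x ≡ g x) → ∑ xs f ≡ ∑ xs g
    ∑-ext xs e = ∑-cong xs (λ x _ → e x)

    ∑-+ : ∀ xs (f g : A → ℤ) → ∑ xs (λ x → f x + g x) ≡ ∑ xs f + ∑ xs g
    ∑-+ []       f g = ≡.refl
    ∑-+ (x ∷ xs) f g =
      ≡.trans (cong (λ s → f x + g x + s) (∑-+ xs f g)) (interchange (f x) (g x) (∑ xs f) (∑ xs g))
      where
      interchange : ∀ a b c d → (a + b) + (c + d) ≡ (a + c) + (b + d)
      interchange = solve-∀

    ∑-*ˡ : ∀ xs c (f : A → ℤ) → ∑ xs (λ x → c * f x) ≡ c * ∑ xs f
    ∑-*ˡ []       c f = sym (ℤₚ.*-zeroʳ c)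
    ∑-*ˡ (x ∷ xs) c f = ≡.trans (cong (_+_ (c * f x)) (∑-*ˡ xs c f)) (sym (ℤₚ.*-distribˡ-+ c (f x) (∑ xs f)))

    ∑-*ʳ : ∀ xs c (f : A → ℤ) → ∑ xs (λ x → f x * c) ≡ ∑ xs f * c
    ∑-*ʳ xs c f = ≡.trans (∑-ext xs (λ x → ℤₚ.*-comm (f x) c)) (≡.trans (∑-*ˡ xs c f) (ℤₚ.*-comm c (∑ xs f)))

    ∑-const : ∀ xs c → ∑ xs (λ (_ : A) → c) ≡ + length xs * c
    ∑-const []       c = ≡.refl
    ∑-const (x ∷ xs) c = ≡.trans (cong (_+_ c) (∑-const xs c)) (step c (+ length xs))
      where
      step : ∀ c l → c + l * c ≡ (+ 1 + l) * c
      step = solve-∀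

    ∑-↭ : ∀ {xs ys} (f : A → ℤ) → xs ↭ ys → ∑ xs f ≡ ∑ ys f
    ∑-↭ f refl          = ≡.refl
    ∑-↭ f (prep x p)    = cong (_+_ (f x)) (∑-↭ f p)
    ∑-↭ f (swap {xs} {ys} x y p) = ≡.trans (cong (λ s → f x + (f y + s)) (∑-↭ f p)) (exchange (f x) (f y) (∑ ys f))
      where
      exchange : ∀ a b c → a + (b + c) ≡ b + (a + c)
      exchange = solve-∀
    ∑-↭ f (trans p q)   = ≡.trans (∑-↭ f p) (∑-↭ f q)

    ∑-nonpos : ∀ xs {f : A → ℤ} → (∀ x → x ∈ xs → f x ≤ + 0) → ∑ xs f ≤ + 0
    ∑-nonpos []       h = ℤₚ.≤-refl
    ∑-nonpos (x ∷ xs) h = ℤₚ.+-mono-≤ (h x (here ≡.refl)) (∑-nonpos xs (λ y m → h y (there m)))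

    -- This turns an averaged equality into a pointwise one: a one-sided bound together with a
    -- vanishing total leaves no slack anywhere.
    ∑-nonpos-zero : ∀ xs {f : A → ℤ} → (∀ x → x ∈ xs → f x ≤ + 0) → ∑ xs f ≡ + 0 →
                    ∀ x → x ∈ xs → f x ≡ + 0
    ∑-nonpos-zero (x ∷ xs) {f} h e = go
      where
      tail≤0 : ∑ xs f ≤ + 0
      tail≤0 = ∑-nonpos xs (λ y m → h y (there m))

      head≥0 : + 0 ≤ f x
      head≥0 = ≡.subst₂ _≤_ e (ℤₚ.+-identityʳ (f x)) (ℤₚ.+-monoʳ-≤ (f x) tail≤0)

      head≡0 : f x ≡ + 0
      head≡0 = ℤₚ.≤-antisym (h x (here ≡.refl)) head≥0

      tail≡0 : ∑ xs f ≡ + 0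
      tail≡0 = ≡.trans (sym (ℤₚ.+-identityˡ _)) (≡.trans (cong (_+ ∑ xs f) (sym head≡0)) e)

      go : ∀ y → y ∈ x ∷ xs → f y ≡ + 0
      go y (here ≡.refl) = head≡0
      go y (there m)     = ∑-nonpos-zero xs (λ z k → h z (there k)) tail≡0 y m

    ∑-none : ∀ xs {P : A → Set} (P? : ∀ x → Dec (P x)) (f : A → ℤ) → (∀ x → x ∈ xs → ¬ P x) →
             ∑ xs (λ x → ⟦ P? x ⟧ * f x) ≡ + 0
    ∑-none xs P? f h =
      ≡.trans (∑-cong xs (λ x m → cong (_* f x) (⟦⟧-no (P? x) (h x m))))
              (≡.trans (∑-const xs (+ 0)) (ℤₚ.*-zeroʳ (+ length xs)))

    ∑-single : ∀ {xs} → Unique xs → ∀ {P : A → Set} (P? : ∀ x → Dec (P x)) (f : A → ℤ) {a} →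
               a ∈ xs → P a → (∀ x → x ∈ xs → P x → x ≡ a) → ∑ xs (λ x → ⟦ P? x ⟧ * f x) ≡ f a
    ∑-single {x ∷ xs} (x∉ AllPairs.∷ u) P? f (here ≡.refl) pa only =
      ≡.trans (cong₂ _+_ (≡.trans (cong (_* f x) (⟦⟧-yes (P? x) pa)) (ℤₚ.*-identityˡ (f x)))
                         (∑-none xs P? f (λ y m py → All.lookup x∉ m (sym (only y (there m) py)))))
              (ℤₚ.+-identityʳ (f x))
    ∑-single {x ∷ xs} (x∉ AllPairs.∷ u) P? f {a} (there m) pa only =
      ≡.trans (cong₂ _+_ (cong (_* f x) (⟦⟧-no (P? x) (λ px → All.lookup x∉ m (only x (here ≡.refl) px))))
                         (∑-single u P? f m pa (λ y k → only y (there k))))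
              (ℤₚ.+-identityˡ (f a))

    ∑-count : ∀ {xs} → Unique xs → ∀ {P : A → Set} (P? : ∀ x → Dec (P x)) {a} →
              a ∈ xs → P a → (∀ x → x ∈ xs → P x → x ≡ a) → ∑ xs (λ x → ⟦ P? x ⟧) ≡ + 1
    ∑-count {xs} u P? m pa only =
      ≡.trans (∑-ext xs (λ x → sym (ℤₚ.*-identityʳ ⟦ P? x ⟧))) (∑-single u P? (λ _ → + 1) m pa only)

  ∑-map : ∀ {A B : Set} (h : A → B) xs (f : B → ℤ) → ∑ (map h xs) f ≡ ∑ xs (λ x → f (h x))
  ∑-map h []       f = ≡.refl
  ∑-map h (x ∷ xs) f = cong (_+_ (f (h x))) (∑-map h xs f)

  ∑-swap : ∀ {A B : Set} xs ys (f : A → B → ℤ) →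
           ∑ xs (λ x → ∑ ys (f x)) ≡ ∑ ys (λ y → ∑ xs (λ x → f x y))
  ∑-swap []       ys f = sym (≡.trans (∑-const ys (+ 0)) (ℤₚ.*-zeroʳ (+ length ys)))
  ∑-swap (x ∷ xs) ys f =
    ≡.trans (cong (_+_ (∑ ys (f x))) (∑-swap xs ys f)) (sym (∑-+ ys (f x) (λ y → ∑ xs (λ x → f x y))))

  map-unique : ∀ {A B : Set} (h : A → B) {xs} → (∀ {x y} → x ∈ xs → y ∈ xs → h x ≡ h y → x ≡ y) →
               Unique xs → Unique (map h xs)
  map-unique h inj AllPairs.[] = AllPairs.[]
  map-unique h {x ∷ xs} inj (x∉ AllPairs.∷ u) =
    All.tabulate (λ m e → let y , y∈ , eq = ∈-map⁻ h m in
                          All.lookup x∉ y∈ (inj (here ≡.refl) (there y∈) (≡.trans e eq)))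
    AllPairs.∷ map-unique h (λ a b → inj (there a) (there b)) u

  unique-↭ : ∀ {A : Set} {xs ys : List A} → Unique xs → Unique ys →
             (∀ {x} → x ∈ xs → x ∈ ys) → (∀ {x} → x ∈ ys → x ∈ xs) → xs ↭ ys
  unique-↭ u v f g = ∼bag⇒↭ (unique∧set⇒bag u v (mk⇔ f g))

  map-↭ : ∀ {A : Set} {xs : List A} → Unique xs → (h h⁻¹ : A → A) →
          (∀ {x} → x ∈ xs → h x ∈ xs) → (∀ {x} → x ∈ xs → h⁻¹ x ∈ xs) →
          (∀ {x} → x ∈ xs → h (h⁻¹ x) ≡ x) → (∀ {x} → x ∈ xs → h⁻¹ (h x) ≡ x) → map h xs ↭ xs
  map-↭ {xs = xs} u h h⁻¹ cl cl⁻¹ right left =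
    unique-↭
      (map-unique h (λ x∈ y∈ e → ≡.trans (sym (left x∈)) (≡.trans (cong h⁻¹ e) (left y∈))) u) u
      (λ m → let y , y∈ , eq = ∈-map⁻ h m in subst (_∈ xs) (sym eq) (cl y∈))
      (λ m → subst (_∈ map h xs) (right m) (∈-map⁺ h (cl⁻¹ m)))

  -- Each y ∈ ys is hit at most once by xs, and the total number of hits is length ys.
  unique-full : ∀ {A : Set} → DecidableEquality A → ∀ {xs ys : List A} → Unique xs → Unique ys →
                (∀ {x} → x ∈ xs → x ∈ ys) → length xs ≡ length ys → ∀ {y} → y ∈ ys → y ∈ xs
  unique-full {A} _≟_ {xs} {ys} ux uy sub len {y} y∈ = decidable-stable (y ∈? xs)
    (λ y∉ → contra (≡.trans (cong (ℤ._- + 1) (sym (hits-∉ y y∉))) (deficit≡0 y y∈)))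
    where
    open import Data.List.Membership.DecPropositional _≟_ using (_∈?_)

    hits : A → ℤ
    hits y = ∑ xs (λ x → ⟦ x ≟ y ⟧)

    hits-∈ : ∀ y → y ∈ xs → hits y ≡ + 1
    hits-∈ y m = ∑-count ux (_≟ y) m ≡.refl (λ _ _ e → e)

    hits-∉ : ∀ y → ¬ y ∈ xs → hits y ≡ + 0
    hits-∉ y y∉ = ≡.trans (∑-ext xs (λ x → sym (ℤₚ.*-identityʳ ⟦ x ≟ y ⟧)))
                           (∑-none xs (_≟ y) (λ _ → + 1) (λ { x m ≡.refl → y∉ m }))

    deficit : A → ℤ
    deficit y = hits y ℤ.- + 1

    deficit≤0 : ∀ y → y ∈ ys → deficit y ≤ + 0
    deficit≤0 y _ with y ∈? xs
    ... | yes m rewrite hits-∈ y m = ℤₚ.≤-refl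
    ... | no y∉ rewrite hits-∉ y y∉ = ℤ.-≤+

    total : ∑ ys hits ≡ + length ys
    total = begin
      ∑ ys hits                               ≡⟨ ∑-swap ys xs (λ y x → ⟦ x ≟ y ⟧) ⟩
      ∑ xs (λ x → ∑ ys (λ y → ⟦ x ≟ y ⟧))     ≡⟨ ∑-cong xs (λ x m → ∑-count uy (x ≟_) (sub m) ≡.refl (λ _ _ e → sym e)) ⟩
      ∑ xs (λ _ → + 1)                        ≡⟨ ∑-const xs (+ 1) ⟩
      + length xs * + 1                       ≡⟨ ℤₚ.*-identityʳ (+ length xs) ⟩
      + length xs                             ≡⟨ cong +_ len ⟩
      + length ys                             ∎
      where open ≡-Reasoning

    deficit≡0 : ∀ y → y ∈ ys → deficit y ≡ + 0
    deficit≡0 = ∑-nonpos-zero ys deficit≤0 (begin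
      ∑ ys deficit                       ≡⟨ ∑-+ ys hits (λ _ → ℤ.- + 1) ⟩
      ∑ ys hits + ∑ ys (λ _ → ℤ.- + 1)   ≡⟨ cong₂ _+_ total (∑-const ys (ℤ.- + 1)) ⟩
      + length ys + + length ys * ℤ.- + 1 ≡⟨ cancel (+ length ys) ⟩
      + 0                                ∎)
      where
      open ≡-Reasoning
      cancel : ∀ l → l + l * ℤ.- + 1 ≡ + 0
      cancel = solve-∀

    contra : ¬ (+ 0 ℤ.- + 1 ≡ + 0)
    contra ()

-- The prime field as integers modulo `p`.

module PrimeField (p : ℕ) .{{_ : NonZero p}} (pr : Prime p) where

  open FiniteSums
  open import Data.Nat as ℕ using (zero; suc; s≤s; z≤n)
  import Data.Nat.Properties as ℕₚ
  import Data.Nat.DivMod as ℕ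
  import Data.Nat.Divisibility as ℕ
  import Data.Nat.Coprimality as ℕ
  import Data.Nat.GCD as GCD
  open GCD.Bézout using (+-; -+)
  open import Data.Nat.Primality using (euclidsLemma; prime⇒nonTrivial)
  open import Data.Integer using (ℤ; +_; _+_; _-_; -_; _*_; ∣_∣)
  open import Data.Integer.DivMod using (_%ℕ_; n%ℕd<d; a≡a%ℕn+[a/ℕn]*n)
  import Data.Integer.DivMod as ℤ
  import Data.Integer.Properties as ℤₚ
  open import Data.Integer.Divisibility.Signed as ∣ using (_∣_; divides)
  open import Data.Integer.Tactic.RingSolver using (solve-∀; solve)
  open import Data.List using ([]; _∷_)
  open import Data.List.Relation.Binary.Permutation.Propositional using (refl; trans)
  open import Data.Product using (_,_; ∃)
  open import Data.Sum using (_⊎_; inj₁; inj₂; [_,_]′)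
  open import Data.Empty using (⊥-elim)
  open import Relation.Nullary using (¬_; Dec)
  open import Relation.Nullary.Decidable using (map′)
  open import Relation.Binary.Bundles using (Setoid)
  open import Relation.Binary.PropositionalEquality as ≡ using (_≡_; cong; subst)
  import Relation.Binary.Reasoning.Setoid as SetoidReasoning

  infix 4 _≈_ _≉_ _≈?_
  -- Field elements are integers up to congruence, so polynomial identities can be checked over ℤ. A
  -- record, unlike a synonym for divisibility, lets unification recover `a` and `b`.
  record _≈_ (a b : ℤ) : Set where
    constructor mk≈
    field p∣a-b : + p ∣ (a - b)
  open _≈_ public

  _≉_ : ℤ → ℤ → Set
  a ≉ b = ¬ a ≈ b

  -- Linear combinations of congruences: by (c₁ · h₁ ⊹ … ⊹ cₙ · hₙ) eq proves a ≈ b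
  -- from hᵢ : uᵢ ≈ vᵢ and the identity eq : a − b ≡ c₁ (u₁ − v₁) + … + cₙ (uₙ − vₙ).
  infix 5.5 _·_
  infixl 5 _⊹_

  _·_ : ∀ c {u v} → u ≈ v → + p ∣ c * (u - v)
  c · h = ∣.∣n⇒∣m*n c (p∣a-b h)

  _⊹_ : ∀ {a b} → + p ∣ a → + p ∣ b → + p ∣ a + b
  _⊹_ = ∣.∣m∣n⇒∣m+n

  by : ∀ {z a b} → + p ∣ z → a - b ≡ z → a ≈ b
  by d eq = mk≈ (subst (+ p ∣_) (≡.sym eq) d)

  ≈-reflexive : ∀ {a b} → a ≡ b → a ≈ b
  ≈-reflexive {a} ≡.refl = mk≈ (divides (+ 0) (ℤₚ.+-inverseʳ a))

  ≈-refl : ∀ {a} → a ≈ a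
  ≈-refl = ≈-reflexive ≡.refl

  ≈-sym : ∀ {a b} → a ≈ b → b ≈ a
  ≈-sym {a} {b} h = by (- + 1 · h) (solve (a ∷ b ∷ []))

  ≈-trans : ∀ {a b c} → a ≈ b → b ≈ c → a ≈ c
  ≈-trans {a} {b} {c} h k = by (+ 1 · h ⊹ + 1 · k) (solve (a ∷ b ∷ c ∷ []))

  +-cong : ∀ {a b c d} → a ≈ b → c ≈ d → a + c ≈ b + d
  +-cong {a} {b} {c} {d} h k = by (+ 1 · h ⊹ + 1 · k) (solve (a ∷ b ∷ c ∷ d ∷ []))

  *-cong : ∀ {a b c d} → a ≈ b → c ≈ d → a * c ≈ b * d
  *-cong {a} {b} {c} {d} h k = by (c · h ⊹ b · k) (solve (a ∷ b ∷ c ∷ d ∷ []))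

  neg-cong : ∀ {a b} → a ≈ b → - a ≈ - b
  neg-cong {a} {b} h = by (- + 1 · h) (solve (a ∷ b ∷ []))

  ∸-cong : ∀ {a b c d} → a ≈ b → c ≈ d → a - c ≈ b - d
  ∸-cong h k = +-cong h (neg-cong k)

  ≈-setoid : Setoid _ _
  ≈-setoid = record
    { Carrier = ℤ ; _≈_ = _≈_
    ; isEquivalence = record { refl = ≈-refl ; sym = ≈-sym ; trans = ≈-trans } }

  module ≈-Reasoning = SetoidReasoning ≈-setoid

  ∣⇒≈0 : ∀ {a} → + p ∣ a → a ≈ + 0
  ∣⇒≈0 {a} d = by d (solve (a ∷ []))

  ≈0⇒∣ : ∀ {a} → a ≈ + 0 → + p ∣ a
  ≈0⇒∣ {a} (mk≈ d) = subst (+ p ∣_) (ℤₚ.+-identityʳ a) d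

  2≤p : 2 ℕ.≤ p
  2≤p = ℕ.nonTrivial⇒n>1 p {{prime⇒nonTrivial pr}}

  abstract
    _≈?_ : ∀ a b → Dec (a ≈ b)
    a ≈? b = map′ mk≈ p∣a-b (+ p ∣.∣? (a - b))

  -- The distance between two canonical representatives is less than `p`, and its only multiple of
  -- `p` in that range is 0.
  abs<p : ∀ {a b} → a ℕ.< p → b ℕ.< p → + a ≈ + b → a ≡ b
  abs<p {a} {b} a<p b<p (mk≈ d) =
    ℤₚ.+-injective (ℤₚ.i-j≡0⇒i≡j (+ a) (+ b) (ℤₚ.∣i∣≡0⇒i≡0 (small (∣.∣⇒∣ᵤ d))))
    where
    bound : ∣ + a - + b ∣ ℕ.< p
    bound rewrite ℤₚ.m-n≡m⊖n a b = ℕₚ.≤-<-trans (ℤₚ.∣m⊝n∣≤m⊔n a b) (ℕₚ.⊔-lub a<p b<p)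

    small : p ℕ.∣ ∣ + a - + b ∣ → ∣ + a - + b ∣ ≡ 0
    small d with ∣ + a - + b ∣ | bound
    ... | zero  | _ = ≡.refl
    ... | suc n | q = ⊥-elim (ℕₚ.<⇒≱ q (ℕ.∣⇒≤ d))

  red : ℤ → ℕ
  red z = z %ℕ p

  red≈ : ∀ z → + red z ≈ z
  red≈ z = mk≈ (divides (- (z ℤ./ℕ p))
    (≡.trans (cong (_-_ (+ red z)) (a≡a%ℕn+[a/ℕn]*n z p)) (cancel (+ red z) (z ℤ./ℕ p) (+ p))))
    where
    cancel : ∀ r q n → r - (r + q * n) ≡ - q * n
    cancel = solve-∀

  red<p : ∀ z → red z ℕ.< p
  red<p z = n%ℕd<d z p

  red-cong : ∀ {a b} → a ≈ b → red a ≡ red b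
  red-cong {a} {b} h = abs<p (red<p a) (red<p b) (≈-trans (red≈ a) (≈-trans h (≈-sym (red≈ b))))

  0<p : 0 ℕ.< p
  0<p = ℕₚ.<-trans (s≤s z≤n) 2≤p

  ≈⇒red≡ : ∀ {z a} → a ℕ.< p → z ≈ + a → red z ≡ a
  ≈⇒red≡ {z} a<p h = abs<p (red<p z) a<p (≈-trans (red≈ z) h)

  red≡0⇒≈0 : ∀ {z} → red z ≡ 0 → z ≈ + 0
  red≡0⇒≈0 {z} e = ≈-trans (≈-sym (red≈ z)) (≈-reflexive (cong +_ e))

  domain : ∀ a b → a * b ≈ + 0 → a ≈ + 0 ⊎ b ≈ + 0
  domain a b h with euclidsLemma ∣ a ∣ ∣ b ∣ pr
                      (subst (p ℕ.∣_) (ℤₚ.abs-* a b) (∣.∣⇒∣ᵤ (≈0⇒∣ h)))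
  ... | inj₁ d = inj₁ (∣⇒≈0 (∣.∣ᵤ⇒∣ d))
  ... | inj₂ d = inj₂ (∣⇒≈0 (∣.∣ᵤ⇒∣ d))

  *-≉0 : ∀ {a b} → a ≉ + 0 → b ≉ + 0 → a * b ≉ + 0
  *-≉0 {a} {b} na nb h = [ na , nb ]′ (domain a b h)

  *-cancelˡ : ∀ {c a b} → c ≉ + 0 → c * a ≈ c * b → a ≈ b
  *-cancelˡ {c} {a} {b} nc h with domain c (a - b) (by (+ 1 · h) (solve (a ∷ b ∷ c ∷ [])))
  ... | inj₁ z = ⊥-elim (nc z)
  ... | inj₂ z = by (+ 1 · z) (solve (a ∷ b ∷ []))

  square≈0 : ∀ {a} → a * a ≈ + 0 → a ≈ + 0
  square≈0 {a} h = [ (λ z → z) , (λ z → z) ]′ (domain a a h)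

  1≉0 : + 1 ≉ + 0
  1≉0 h = case (abs<p 2≤p 0<p h)
    where
    case : ¬ (1 ≡ 0)
    case ()

  √-1≉0 : ∀ i → i * i ≈ - + 1 → i ≉ + 0
  √-1≉0 i i² z = 1≉0 (by (+ 1 · i² ⊹ - i · z) (solve (i ∷ [])))

  -- Needed ahead of Fermat's theorem, whose proof uses that multiplication by `a` is invertible;
  -- the power `a ^ (p ∸ 2)` can be recognised as an inverse only afterwards.
  bézout-inverse : ∀ a → a ≉ + 0 → ∃ λ b → a * b ≈ + 1
  bézout-inverse a na = go (red a) ≡.refl
    where
    go : ∀ r → red a ≡ r → ∃ λ b → a * b ≈ + 1
    go zero    e = ⊥-elim (na (red≡0⇒≈0 e))
    go (suc r) e = conclude (ℕ.coprime-Bézout (ℕ.prime⇒coprime pr (subst (ℕ._< p) e (red<p a))))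
      where
      a≈ : a ≈ + suc r
      a≈ = ≈-trans (≈-sym (red≈ a)) (≈-reflexive (cong +_ e))

      p≈0 : + p ≈ + 0
      p≈0 = ∣⇒≈0 (divides (+ 1) (≡.sym (ℤₚ.*-identityˡ (+ p))))

      lift : ∀ u v s t → 1 ℕ.+ u ℕ.* v ≡ s ℕ.* t → + 1 + + u * + v ≈ + s * + t
      lift u v s t eq = ≈-reflexive (≡.trans (cong (_+_ (+ 1)) (≡.sym (ℤₚ.pos-* u v)))
                                             (≡.trans (cong +_ eq) (ℤₚ.pos-* s t)))

      identity⁺ : ∀ {a r P} x y → a ≈ r → P ≈ + 0 → + 1 + x * P ≈ y * r → a * y ≈ + 1
      identity⁺ {a} {r} {P} x y h k e =
        by (y · h ⊹ - + 1 · e ⊹ x · k) (solve (a ∷ r ∷ P ∷ x ∷ y ∷ []))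

      identity⁻ : ∀ {a r P} x y → a ≈ r → P ≈ + 0 → + 1 + y * r ≈ x * P → a * - y ≈ + 1
      identity⁻ {a} {r} {P} x y h k e =
        by (- y · h ⊹ - + 1 · e ⊹ - x · k) (solve (a ∷ r ∷ P ∷ x ∷ y ∷ []))

      conclude : GCD.Bézout.Identity 1 p (suc r) → ∃ λ b → a * b ≈ + 1
      conclude (+- x y eq) = - + y , identity⁻ (+ x) (+ y) a≈ p≈0 (lift y (suc r) x p eq)
      conclude (-+ x y eq) = + y , identity⁺ (+ x) (+ y) a≈ p≈0 (lift x p y (suc r) eq)

-- Fermat's little theorem and sums over the whole field.

module FieldSums (p : ℕ) .{{_ : NonZero p}} (pr : Prime p) where

  open FiniteSums
  open PrimeField p pr
  open import Data.Nat as ℕ using (zero; suc; s≤s; _∸_)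
  import Data.Nat.Properties as ℕₚ
  open import Data.Integer using (ℤ; +_; _+_; _-_; -_; _*_; _^_; _≤_)
  import Data.Integer.Properties as ℤₚ
  open import Data.Integer.Tactic.RingSolver using (solve-∀; solve)
  open import Data.List using (List; []; _∷_; map; length; upTo)
  import Data.List.Properties as Listₚ
  open import Data.List.Membership.Propositional using (_∈_)
  open import Data.List.Membership.Propositional.Properties using (∈-upTo⁺; ∈-upTo⁻; ∈-map⁺; ∈-map⁻)
  open import Data.List.Relation.Binary.Permutation.Propositional using (_↭_; refl; prep; swap; trans)
  open import Data.List.Relation.Unary.Any using (here; there)
  import Data.List.Relation.Unary.Unique.Propositional.Properties as Unique
  open import Data.Product using (_,_)
  open import Data.Empty using (⊥-elim)
  open import Relation.Binary.PropositionalEquality as ≡ using (_≡_; cong; subst)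

  ∏ : List ℕ → ℤ
  ∏ []       = + 1
  ∏ (x ∷ xs) = + x * ∏ xs

  ∏-↭ : ∀ {xs ys} → xs ↭ ys → ∏ xs ≡ ∏ ys
  ∏-↭ refl          = ≡.refl
  ∏-↭ (prep x q)    = cong (_*_ (+ x)) (∏-↭ q)
  ∏-↭ (swap {xs} {ys} x y q) = ≡.trans (cong (λ s → + x * (+ y * s)) (∏-↭ q)) (exchange (+ x) (+ y) (∏ ys))
    where
    exchange : ∀ a b c → a * (b * c) ≡ b * (a * c)
    exchange = solve-∀
  ∏-↭ (trans q r)   = ≡.trans (∏-↭ q) (∏-↭ r)

  ∏-scale : ∀ a xs → ∏ (map (λ x → red (a * + x)) xs) ≈ a ^ length xs * ∏ xs
  ∏-scale a []       = ≈-refl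
  ∏-scale a (x ∷ xs) =
    ≈-trans (*-cong (red≈ (a * + x)) (∏-scale a xs)) (≈-reflexive (rearrange a (+ x) (a ^ length xs) (∏ xs)))
    where
    rearrange : ∀ a x e q → (a * x) * (e * q) ≡ (a * e) * (x * q)
    rearrange = solve-∀

  ∏-≉0 : ∀ xs → (∀ {x} → x ∈ xs → + x ≉ + 0) → ∏ xs ≉ + 0
  ∏-≉0 []       h = 1≉0
  ∏-≉0 (x ∷ xs) h = *-≉0 (h (here ≡.refl)) (∏-≉0 xs (λ m → h (there m)))

  units : List ℕ
  units = map suc (upTo (p ∸ 1))

  p≡1+p∸1 : p ≡ suc (p ∸ 1)
  p≡1+p∸1 = ≡.sym (ℕₚ.m+[n∸m]≡n 0<p)

  units-<p : ∀ {x} → x ∈ units → x ℕ.< p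
  units-<p {x} m with y , y∈ , e ← ∈-map⁻ suc m =
    subst (ℕ._< p) (≡.sym e) (subst (suc y ℕ.<_) (≡.sym p≡1+p∸1) (s≤s (∈-upTo⁻ y∈)))

  units-≉0 : ∀ {x} → x ∈ units → + x ≉ + 0
  units-≉0 {x} m h with y , y∈ , e ← ∈-map⁻ suc m =
    ℕₚ.1+n≢0 (≡.trans (≡.sym e) (abs<p (units-<p m) 0<p h))

  ∈-units : ∀ {z} → z ≉ + 0 → red z ∈ units
  ∈-units {z} nz = go (red z) ≡.refl
    where
    go : ∀ r → red z ≡ r → r ∈ units
    go zero    e = ⊥-elim (nz (red≡0⇒≈0 e))
    go (suc r) e = ∈-map⁺ suc (∈-upTo⁺ (ℕₚ.≤-pred (subst (suc r ℕ.<_) p≡1+p∸1 (subst (ℕ._< p) e (red<p z)))))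

  red-scale : ∀ {a b x} → a * b ≈ + 1 → x ∈ units → red (a * + red (b * + x)) ≡ x
  red-scale {a} {b} {x} ab m = ≈⇒red≡ (units-<p m) (cancel (+ x) (red≈ (b * + x)))
    where
    cancel : ∀ x {r} → r ≈ b * x → a * r ≈ x
    cancel x {r} h = by (a · h ⊹ x · ab) (solve (a ∷ b ∷ x ∷ r ∷ []))

  *-unit : ∀ {a b} → a * b ≈ + 1 → a ≉ + 0
  *-unit {a} {b} h z = 1≉0 (by (- + 1 · h ⊹ b · z) (solve (a ∷ b ∷ [])))

  -- Multiplication by `a` permutes the units, so their product, itself a unit, is unchanged when
  -- multiplied by `a ^ (p ∸ 1)`.
  fermat : ∀ a → a ≉ + 0 → a ^ (p ∸ 1) ≈ + 1
  fermat a na with b , ab ← bézout-inverse a na =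
    *-cancelˡ (∏-≉0 units units-≉0) (begin
      ∏ units * a ^ (p ∸ 1)                    ≡⟨ ℤₚ.*-comm (∏ units) (a ^ (p ∸ 1)) ⟩
      a ^ (p ∸ 1) * ∏ units                    ≡⟨ cong (λ l → a ^ l * ∏ units) (≡.trans (Listₚ.length-map suc (upTo (p ∸ 1))) (Listₚ.length-upTo (p ∸ 1))) ⟨
      a ^ length units * ∏ units               ≈⟨ ∏-scale a units ⟨
      ∏ (map (λ x → red (a * + x)) units)      ≡⟨ ∏-↭ perm ⟩
      ∏ units                                  ≡⟨ ℤₚ.*-identityʳ (∏ units) ⟨
      ∏ units * + 1                            ∎)
    where
    open ≈-Reasoning
    ba : b * a ≈ + 1
    ba = ≈-trans (≈-reflexive (ℤₚ.*-comm b a)) ab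
    perm : map (λ x → red (a * + x)) units ↭ units
    perm = map-↭ (Unique.map⁺ ℕₚ.suc-injective (Unique.upTo⁺ (p ∸ 1)))
      (λ x → red (a * + x)) (λ x → red (b * + x))
      (λ m → ∈-units (*-≉0 na (units-≉0 m)))
      (λ m → ∈-units (*-≉0 (*-unit {b} {a} ba) (units-≉0 m)))
      (red-scale {a} {b} ab) (red-scale {b} {a} ba)

  infix 8 _⁻¹
  _⁻¹ : ℤ → ℤ
  a ⁻¹ = a ^ (p ∸ 2)

  inverseʳ : ∀ {a} → a ≉ + 0 → a * a ⁻¹ ≈ + 1
  -- As `2 ≤ p`, the exponent `p ∸ 1` is `suc (p ∸ 2)`, and the power then unfolds to `a * a ⁻¹`.
  inverseʳ {a} na = subst (λ e → a ^ e ≈ + 1) (ℕₚ.+-∸-assoc 1 2≤p) (fermat a na)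

  Respects : (ℤ → ℤ) → Set
  Respects f = ∀ {a b} → a ≈ b → f a ≡ f b

  ∑ₚ : (ℤ → ℤ) → ℤ
  ∑ₚ f = ∑ (upTo p) (λ x → f (+ x))

  ∑ₚ-ext : ∀ {f g} → (∀ x → f x ≡ g x) → ∑ₚ f ≡ ∑ₚ g
  ∑ₚ-ext e = ∑-ext (upTo p) (λ x → e (+ x))

  ∑ₚ-const : ∀ c → ∑ₚ (λ _ → c) ≡ + p * c
  ∑ₚ-const c = ≡.trans (∑-const (upTo p) c) (cong (λ l → + l * c) (Listₚ.length-upTo p))

  ∑ₚ-+ : ∀ f g → ∑ₚ (λ x → f x + g x) ≡ ∑ₚ f + ∑ₚ g
  ∑ₚ-+ f g = ∑-+ (upTo p) _ _

  ∑ₚ-*ˡ : ∀ c f → ∑ₚ (λ x → c * f x) ≡ c * ∑ₚ f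
  ∑ₚ-*ˡ c f = ∑-*ˡ (upTo p) c _

  ∑ₚ-*ʳ : ∀ c f → ∑ₚ (λ x → f x * c) ≡ ∑ₚ f * c
  ∑ₚ-*ʳ c f = ∑-*ʳ (upTo p) c _

  ∑ₚ-swap : ∀ (f : ℤ → ℤ → ℤ) → ∑ₚ (λ x → ∑ₚ (f x)) ≡ ∑ₚ (λ y → ∑ₚ (λ x → f x y))
  ∑ₚ-swap f = ∑-swap (upTo p) (upTo p) (λ x y → f (+ x) (+ y))

  -- Both maps need to be mutually inverse only up to congruence: after reduction they permute the
  -- representatives `0, …, p − 1`, and `f` does not see the reduction.
  ∑ₚ-reindex : ∀ (g g⁻¹ : ℤ → ℤ) → (∀ {a b} → a ≈ b → g a ≈ g b) → (∀ {a b} → a ≈ b → g⁻¹ a ≈ g⁻¹ b) →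
               (∀ a → g (g⁻¹ a) ≈ a) → (∀ a → g⁻¹ (g a) ≈ a) →
               ∀ {f} → Respects f → ∑ₚ (λ x → f (g x)) ≡ ∑ₚ f
  ∑ₚ-reindex g g⁻¹ g-cong g⁻¹-cong right left {f} resp = begin
    ∑ (upTo p) (λ x → f (g (+ x)))              ≡⟨ ∑-ext (upTo p) (λ x → resp (≈-sym (red≈ (g (+ x))))) ⟩
    ∑ (upTo p) (λ x → f (+ red (g (+ x))))      ≡⟨ ∑-map (λ x → red (g (+ x))) (upTo p) (λ x → f (+ x)) ⟨
    ∑ (map (λ x → red (g (+ x))) (upTo p)) (λ x → f (+ x))  ≡⟨ ∑-↭ (λ x → f (+ x)) perm ⟩
    ∑ (upTo p) (λ x → f (+ x))                  ∎
    where
    open ≡.≡-Reasoning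
    perm : map (λ x → red (g (+ x))) (upTo p) ↭ upTo p
    perm = map-↭ (Unique.upTo⁺ p) (λ x → red (g (+ x))) (λ x → red (g⁻¹ (+ x)))
      (λ {x} _ → ∈-upTo⁺ (red<p (g (+ x)))) (λ {x} _ → ∈-upTo⁺ (red<p (g⁻¹ (+ x))))
      (λ {x} m → ≈⇒red≡ (∈-upTo⁻ m) (≈-trans (g-cong (red≈ (g⁻¹ (+ x)))) (right (+ x))))
      (λ {x} m → ≈⇒red≡ (∈-upTo⁻ m) (≈-trans (g⁻¹-cong (red≈ (g (+ x)))) (left (+ x))))

  ∑ₚ-shift : ∀ c {f} → Respects f → ∑ₚ (λ x → f (x + c)) ≡ ∑ₚ f
  ∑ₚ-shift c = ∑ₚ-reindex (_+ c) (_- c) (λ h → +-cong h ≈-refl) (λ h → +-cong h ≈-refl)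
    (λ a → ≈-reflexive (inv₁ a c)) (λ a → ≈-reflexive (inv₂ a c))
    where
    inv₁ : ∀ a c → a - c + c ≡ a
    inv₁ = solve-∀
    inv₂ : ∀ a c → a + c - c ≡ a
    inv₂ = solve-∀

  ∑ₚ-scale : ∀ {c} → c ≉ + 0 → ∀ {f} → Respects f → ∑ₚ (λ x → f (c * x)) ≡ ∑ₚ f
  ∑ₚ-scale {c} nc = ∑ₚ-reindex (c *_) (c ⁻¹ *_) (*-cong (≈-refl {c})) (*-cong (≈-refl {c ⁻¹}))
    (inv₁ (c ⁻¹) (inverseʳ nc)) (inv₂ (c ⁻¹) (inverseʳ nc))
    where
    inv₁ : ∀ d → c * d ≈ + 1 → ∀ a → c * (d * a) ≈ a
    inv₁ d h a = by (a · h) (solve (a ∷ c ∷ d ∷ []))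
    inv₂ : ∀ d → c * d ≈ + 1 → ∀ a → d * (c * a) ≈ a
    inv₂ d h a = by (a · h) (solve (a ∷ c ∷ d ∷ []))

  ∑ₚ-single : ∀ {f} → Respects f → ∀ a → ∑ₚ (λ x → ⟦ x ≈? a ⟧ * f x) ≡ f a
  ∑ₚ-single {f} resp a = ≡.trans
    (∑-single (Unique.upTo⁺ p) (λ x → + x ≈? a) (λ x → f (+ x)) (∈-upTo⁺ (red<p a)) (red≈ a)
      (λ x m h → ≡.sym (≈⇒red≡ (∈-upTo⁻ m) (≈-sym h))))
    (resp (red≈ a))

  ∑ₚ-count : ∀ a → ∑ₚ (λ x → ⟦ x ≈? a ⟧) ≡ + 1
  ∑ₚ-count a = ≡.trans (∑ₚ-ext (λ x → ≡.sym (ℤₚ.*-identityʳ ⟦ x ≈? a ⟧))) (∑ₚ-single (λ _ → ≡.refl) a)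

  ∑ₚ-nonpos-zero : ∀ {f} → Respects f → (∀ x → f x ≤ + 0) → ∑ₚ f ≡ + 0 → ∀ x → f x ≡ + 0
  ∑ₚ-nonpos-zero resp h e x =
    ≡.trans (resp (≈-sym (red≈ x))) (∑-nonpos-zero (upTo p) (λ y _ → h (+ y)) e (red x) (∈-upTo⁺ (red<p x)))

-- The quadratic character.

module QuadraticCharacter (p : ℕ) .{{_ : NonZero p}} (pr : Prime p) where

  open FiniteSums
  open PrimeField p pr
  open FieldSums p pr
  open import Data.Nat using (zero)
  import Data.Nat.Properties as ℕₚ
  open import Data.Integer as ℤ using (ℤ; +_; _+_; _-_; -_; _*_; _≤_)
  import Data.Integer.Properties as ℤₚ
  open import Data.Integer.Tactic.RingSolver using (solve-∀; solve)
  open import Data.List using ([]; _∷_; upTo)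
  open import Data.List.Membership.Propositional using (_∈_; find; lose)
  open import Data.List.Membership.Propositional.Properties using (∈-upTo⁺)
  open import Data.List.Relation.Unary.Any as Any using (Any)
  open import Data.Product using (_,_; ∃)
  open import Data.Sum using (_⊎_; inj₁; inj₂; [_,_]′)
  open import Data.Empty using (⊥; ⊥-elim)
  open import Relation.Nullary using (¬_; Dec; yes; no)
  open import Relation.Binary.PropositionalEquality as ≡ using (_≡_; cong; cong₂)

  module Character (2≉0 : + 2 ≉ + 0) where

    r : ℤ → ℤ
    r a = ∑ₚ (λ y → ⟦ y * y ≈? a ⟧)

    abstract
      -- The character is defined by counting square roots and not by Euler's criterion. Point
      -- counts then become character sums at once, and the sum of all values is found by double
      -- counting.
      χ : ℤ → ℤ
      χ a = r a - + 1

      χ-def : ∀ a → χ a ≡ r a - + 1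
      χ-def a = ≡.refl

      χ-cong : Respects χ
      χ-cong {a} {b} h = cong (_- + 1) (∑ₚ-ext (λ y →
        ⟦⟧-cong (y * y ≈? a) (y * y ≈? b) (λ k → ≈-trans k h) (λ k → ≈-trans k (≈-sym h))))

    χ-via-r : ∀ {a n} → r a ≡ n → χ a ≡ n - + 1
    χ-via-r {a} e = ≡.trans (χ-def a) (cong (_- + 1) e)

    data Class (a : ℤ) : Set where
      zero       : a ≈ + 0 → Class a
      square     : ∀ b → b ≉ + 0 → b * b ≈ a → Class a
      nonresidue : (∀ b → b * b ≉ a) → Class a

    class : ∀ a → Class a
    class a with a ≈? + 0
    ... | yes h = zero h
    ... | no na with Any.any? (λ y → + y * + y ≈? a) (upTo p)
    ...   | yes m with y , _ , h ← find m =
              square (+ y) (λ z → na (≈-trans (≈-sym h) (*-cong z z))) h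
    ...   | no ¬m = nonresidue (λ b h →
              ¬m (lose (∈-upTo⁺ (red<p b)) (≈-trans (*-cong (red≈ b) (red≈ b)) h)))

    negate-≉ : ∀ {b} → b ≉ + 0 → b ≉ - b
    negate-≉ {b} nb h = *-≉0 2≉0 nb (by (+ 1 · h) (solve (b ∷ [])))

    roots : ∀ y b → y * y ≈ b * b → y ≈ b ⊎ y ≈ - b
    roots y b h = [ (λ z → inj₁ (root⁺ z)) , (λ z → inj₂ (root⁻ z)) ]′ (domain (y - b) (y + b) factored)
      where
      factored : (y - b) * (y + b) ≈ + 0
      factored = by (+ 1 · h) (solve (y ∷ b ∷ []))
      root⁺ : y - b ≈ + 0 → y ≈ b
      root⁺ z = by (+ 1 · z) (solve (y ∷ b ∷ []))
      root⁻ : y + b ≈ + 0 → y ≈ - b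
      root⁻ z = by (+ 1 · z) (solve (y ∷ b ∷ []))

    -- The roots `b` and `− b` differ because `2 b ≉ 0`, so the two brackets on the right never
    -- overlap.
    square-roots : ∀ {b} → b ≉ + 0 → ∀ y → ⟦ y * y ≈? b * b ⟧ ≡ ⟦ y ≈? b ⟧ + ⟦ y ≈? - b ⟧
    square-roots {b} nb y with y * y ≈? b * b | y ≈? b | y ≈? - b
    ... | yes _ | yes h | yes k = ⊥-elim (negate-≉ nb (≈-trans (≈-sym h) k))
    ... | yes _ | yes _ | no _  = ≡.refl
    ... | yes _ | no _  | yes _ = ≡.refl
    ... | yes h | no k  | no l  = ⊥-elim ([ k , l ]′ (roots y b h))
    ... | no h  | yes k | _     = ⊥-elim (h (*-cong k k))
    ... | no h  | no _  | yes k = ⊥-elim (h (≈-trans (*-cong k k) (≈-reflexive (negate² b))))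
      where
      negate² : ∀ b → - b * - b ≡ b * b
      negate² = solve-∀
    ... | no _  | no _  | no _  = ≡.refl

    χ-zero : ∀ {a} → a ≈ + 0 → χ a ≡ + 0
    χ-zero {a} h = χ-via-r (≡.trans
      (∑ₚ-ext (λ y → ⟦⟧-cong (y * y ≈? a) (y ≈? + 0)
        (λ k → square≈0 (≈-trans k h)) (λ k → ≈-trans (*-cong k k) (≈-sym h))))
      (∑ₚ-count (+ 0)))

    χ-square : ∀ {a} b → b ≉ + 0 → b * b ≈ a → χ a ≡ + 1
    χ-square {a} b nb h = ≡.trans (≡.sym (χ-cong h)) (χ-via-r (begin
      r (b * b)                                            ≡⟨ ∑ₚ-ext (square-roots nb) ⟩
      ∑ₚ (λ y → ⟦ y ≈? b ⟧ + ⟦ y ≈? - b ⟧)                 ≡⟨ ∑ₚ-+ (λ y → ⟦ y ≈? b ⟧) (λ y → ⟦ y ≈? - b ⟧) ⟩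
      ∑ₚ (λ y → ⟦ y ≈? b ⟧) + ∑ₚ (λ y → ⟦ y ≈? - b ⟧)      ≡⟨ cong₂ _+_ (∑ₚ-count b) (∑ₚ-count (- b)) ⟩
      + 2                                                  ∎))
      where open ≡.≡-Reasoning

    χ-nonresidue : ∀ {a} → (∀ b → b * b ≉ a) → χ a ≡ - + 1
    χ-nonresidue {a} h = χ-via-r (≡.trans
      (∑ₚ-ext (λ y → ⟦⟧-no (y * y ≈? a) (h y)))
      (≡.trans (∑ₚ-const (+ 0)) (ℤₚ.*-zeroʳ (+ p))))

    χ-unit² : ∀ {a} → a ≉ + 0 → χ a * χ a ≡ + 1
    χ-unit² {a} na = go (class a)
      where
      go : Class a → χ a * χ a ≡ + 1
      go (zero h)        = ⊥-elim (na h)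
      go (square b nb h) = let e = χ-square b nb h in cong₂ _*_ e e
      go (nonresidue h)  = let e = χ-nonresidue h in cong₂ _*_ e e

    χ² : ∀ a → χ a * χ a ≡ + 1 - ⟦ a ≈? + 0 ⟧
    χ² a = go (a ≈? + 0)
      where
      go : (d : Dec (a ≈ + 0)) → χ a * χ a ≡ + 1 - ⟦ d ⟧
      go (yes h) = let e = χ-zero h in cong₂ _*_ e e
      go (no na) = χ-unit² na

    -- Every `y` is a square root of exactly one `a`, so the values of `r` add up to `p`.
    ∑χ : ∑ₚ χ ≡ + 0
    ∑χ = begin
      ∑ₚ χ                            ≡⟨ ∑ₚ-ext χ-def ⟩
      ∑ₚ (λ a → r a - + 1)            ≡⟨ ∑ₚ-+ r (λ _ → - + 1) ⟩
      ∑ₚ r + ∑ₚ (λ _ → - + 1)         ≡⟨ cong₂ _+_ ∑r (∑ₚ-const (- + 1)) ⟩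
      + p * + 1 + + p * - + 1         ≡⟨ cancel (+ p) ⟩
      + 0                             ∎
      where
      open ≡.≡-Reasoning
      cancel : ∀ q → q * + 1 + q * - + 1 ≡ + 0
      cancel = solve-∀
      ∑r : ∑ₚ r ≡ + p * + 1
      ∑r = begin
        ∑ₚ r                                        ≡⟨ ∑ₚ-swap (λ a y → ⟦ y * y ≈? a ⟧) ⟩
        ∑ₚ (λ y → ∑ₚ (λ a → ⟦ y * y ≈? a ⟧))        ≡⟨ ∑ₚ-ext (λ y → ∑ₚ-ext (λ a → ⟦⟧-cong (y * y ≈? a) (a ≈? y * y) ≈-sym ≈-sym)) ⟩
        ∑ₚ (λ y → ∑ₚ (λ a → ⟦ a ≈? y * y ⟧))        ≡⟨ ∑ₚ-ext (λ y → ∑ₚ-count (y * y)) ⟩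
        ∑ₚ (λ _ → + 1)                              ≡⟨ ∑ₚ-const (+ 1) ⟩
        + p * + 1                                   ∎

    ∑χ² : ∑ₚ (λ a → χ a * χ a) ≡ + p - + 1
    ∑χ² = begin
      ∑ₚ (λ a → χ a * χ a)                           ≡⟨ ∑ₚ-ext χ² ⟩
      ∑ₚ (λ a → + 1 - ⟦ a ≈? + 0 ⟧)                  ≡⟨ ∑ₚ-ext (λ a → rewrite-neg ⟦ a ≈? + 0 ⟧) ⟩
      ∑ₚ (λ a → + 1 + - + 1 * ⟦ a ≈? + 0 ⟧)          ≡⟨ ∑ₚ-+ (λ _ → + 1) (λ a → - + 1 * ⟦ a ≈? + 0 ⟧) ⟩
      ∑ₚ (λ _ → + 1) + ∑ₚ (λ a → - + 1 * ⟦ a ≈? + 0 ⟧)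
                                                     ≡⟨ cong₂ _+_ (∑ₚ-const (+ 1)) (∑ₚ-*ˡ (- + 1) (λ a → ⟦ a ≈? + 0 ⟧)) ⟩
      + p * + 1 + - + 1 * ∑ₚ (λ a → ⟦ a ≈? + 0 ⟧)    ≡⟨ cong₂ _+_ (ℤₚ.*-identityʳ (+ p)) (cong (_*_ (- + 1)) (∑ₚ-count (+ 0))) ⟩
      + p - + 1                                      ∎
      where
      open ≡.≡-Reasoning
      rewrite-neg : ∀ a → + 1 - a ≡ + 1 + - + 1 * a
      rewrite-neg = solve-∀

    -- Writing `b y` for `y` matches the square roots of `b² a` with those of `a`.
    χ-square-* : ∀ {b} → b ≉ + 0 → ∀ a → χ (b * b * a) ≡ χ a
    χ-square-* {b} nb a = ≡.trans (χ-def (b * b * a)) (≡.trans (cong (_- + 1) (begin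
      ∑ₚ (λ y → ⟦ y * y ≈? b * b * a ⟧)                 ≡⟨ ∑ₚ-scale nb (λ {x} {y} h → ⟦⟧-cong (x * x ≈? b * b * a) (y * y ≈? b * b * a)
                                                            (≈-trans (*-cong (≈-sym h) (≈-sym h))) (≈-trans (*-cong h h))) ⟨
      ∑ₚ (λ y → ⟦ (b * y) * (b * y) ≈? b * b * a ⟧)     ≡⟨ ∑ₚ-ext (λ y → ⟦⟧-cong ((b * y) * (b * y) ≈? b * b * a) (y * y ≈? a)
                                                            (λ h → *-cancelˡ (*-≉0 nb nb) (by (+ 1 · h) (solve (a ∷ b ∷ y ∷ []))))
                                                            (λ h → by (b * b · h) (solve (a ∷ b ∷ y ∷ [])))) ⟩
      ∑ₚ (λ y → ⟦ y * y ≈? a ⟧)                         ∎)) (≡.sym (χ-def a)))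
      where open ≡.≡-Reasoning

    nonresidue-≉0 : ∀ {n} → (∀ b → b * b ≉ n) → n ≉ + 0
    nonresidue-≉0 h z = h (+ 0) (≈-sym z)

    -- χ(a) + χ(na) is never positive, and it sums to zero over the field.
    χ-nonresidue-* : ∀ {n} → (∀ b → b * b ≉ n) → ∀ a → χ (n * a) ≡ - χ a
    χ-nonresidue-* {n} hn a =
      ≡.trans (isolate (χ (n * a)) (χ a)) (≡.trans (cong (λ z → z - χ a) (vanish a)) (ℤₚ.+-identityˡ (- χ a)))
      where
      isolate : ∀ u v → u ≡ (v + u) - v
      isolate = solve-∀

      nn : n ≉ + 0
      nn = nonresidue-≉0 hn

      h : ℤ → ℤ
      h a = χ a + χ (n * a)

      h-cong : Respects h
      h-cong e = cong₂ _+_ (χ-cong e) (χ-cong (*-cong (≈-refl {n}) e))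

      ≤0 : ∀ {x v} → x ≡ v → v ≤ + 0 → x ≤ + 0
      ≤0 e l = ℤₚ.≤-trans (ℤₚ.≤-reflexive e) l

      h≤0 : ∀ a → h a ≤ + 0
      h≤0 a = go (class a)
        where
        go′ : χ a ≡ - + 1 → Class (n * a) → h a ≤ + 0
        go′ e (zero z)        = ≤0 (cong₂ _+_ e (χ-zero z)) ℤ.-≤+
        go′ e (square b nb k) = ≤0 (cong₂ _+_ e (χ-square b nb k)) ℤₚ.≤-refl
        go′ e (nonresidue k)  = ≤0 (cong₂ _+_ e (χ-nonresidue k)) ℤ.-≤+

        go : Class a → h a ≤ + 0
        go (zero z) = ≤0 (cong₂ _+_ (χ-zero z) (χ-zero (na≈0 z))) ℤₚ.≤-refl
          where
          na≈0 : a ≈ + 0 → n * a ≈ + 0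
          na≈0 z = by (n · z) (solve (n ∷ a ∷ []))
        go (square b nb e) = ≤0 (cong₂ _+_ (χ-square b nb e)
            (≡.trans (χ-cong (na≈ e)) (≡.trans (χ-square-* nb n) (χ-nonresidue hn)))) ℤₚ.≤-refl
          where
          na≈ : b * b ≈ a → n * a ≈ b * b * n
          na≈ e = by (- n · e) (solve (n ∷ a ∷ b ∷ []))
        go (nonresidue e) = go′ (χ-nonresidue e) (class (n * a))

      ∑h : ∑ₚ h ≡ + 0
      ∑h = ≡.trans (∑ₚ-+ χ (λ a → χ (n * a))) (cong₂ _+_ ∑χ (≡.trans (∑ₚ-scale nn χ-cong) ∑χ))

      vanish : ∀ a → h a ≡ + 0
      vanish = ∑ₚ-nonpos-zero h-cong h≤0 ∑h

    χ-* : ∀ a b → χ (a * b) ≡ χ a * χ b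
    χ-* a b = go (class a)
      where
      open ≡.≡-Reasoning
      go : Class a → χ (a * b) ≡ χ a * χ b
      go (zero z) = ≡.trans (χ-zero (ab≈0 z)) (≡.sym (cong (_* χ b) (χ-zero z)))
        where
        ab≈0 : a ≈ + 0 → a * b ≈ + 0
        ab≈0 z = by (b · z) (solve (a ∷ b ∷ []))
      go (square c nc e) = begin
        χ (a * b)        ≡⟨ χ-cong (*-cong (≈-sym e) (≈-refl {b})) ⟩
        χ (c * c * b)    ≡⟨ χ-square-* nc b ⟩
        χ b              ≡⟨ ℤₚ.*-identityˡ (χ b) ⟨
        + 1 * χ b        ≡⟨ cong (_* χ b) (χ-square c nc e) ⟨
        χ a * χ b        ∎
      go (nonresidue e) = begin
        χ (a * b)        ≡⟨ χ-nonresidue-* e b ⟩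
        - χ b            ≡⟨ ℤₚ.-1*i≡-i (χ b) ⟨
        - + 1 * χ b      ≡⟨ cong (_* χ b) (χ-nonresidue e) ⟨
        χ a * χ b        ∎

    -- Without a nonresidue `χ` would equal its own square everywhere; comparing `∑χ²` with `∑χ`
    -- would then force `p = 1`.
    nonresidue-exists : ∃ λ n → ∀ b → b * b ≉ n
    nonresidue-exists = go (Any.any? (λ x → χ (+ x) ℤ.≟ - + 1) (upTo p))
      where
      root-free : ∀ {a} → χ a ≡ - + 1 → ∀ b → b * b ≉ a
      root-free {a} e b h = clash (b ≈? + 0)
        where
        -1≢0 : ¬ (- + 1 ≡ + 0)
        -1≢0 ()
        -1≢1 : ¬ (- + 1 ≡ + 1)
        -1≢1 ()
        clash : Dec (b ≈ + 0) → ⊥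
        clash (yes z) = -1≢0 (≡.trans (≡.sym e) (χ-zero {a} (≈-trans (≈-sym h) (*-cong z z))))
        clash (no nb) = -1≢1 (≡.trans (≡.sym e) (χ-square b nb h))

      go : Dec (Any (λ x → χ (+ x) ≡ - + 1) (upTo p)) → ∃ λ n → ∀ b → b * b ≉ n
      go (yes m) = let x , _ , e = find m in + x , root-free {+ x} e
      go (no ¬m) = ⊥-elim (ℕₚ.<⇒≢ 2≤p (≡.sym (ℤₚ.+-injective (ℤₚ.i-j≡0⇒i≡j (+ p) (+ 1) p≡1))))
        where
        residue : ∀ x → x ∈ upTo p → χ (+ x) * χ (+ x) ≡ χ (+ x)
        residue x m = case (class (+ x))
          where
          case : Class (+ x) → χ (+ x) * χ (+ x) ≡ χ (+ x)
          case (zero z)        = let e = χ-zero z in ≡.trans (cong₂ _*_ e e) (≡.sym e)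
          case (square b nb k) = let e = χ-square b nb k in ≡.trans (cong₂ _*_ e e) (≡.sym e)
          case (nonresidue k)  = ⊥-elim (¬m (lose m (χ-nonresidue k)))
        p≡1 : + p - + 1 ≡ + 0
        p≡1 = ≡.trans (≡.sym ∑χ²) (≡.trans (∑-cong (upTo p) residue) ∑χ)

-- Jacobsthal sums and their second moment.

module JacobsthalSums (p : ℕ) .{{_ : NonZero p}} (pr : Prime p) where

  open FiniteSums
  open PrimeField p pr
  open FieldSums p pr
  open QuadraticCharacter p pr
  import Data.Nat.Properties as ℕₚ
  open import Data.Integer using (ℤ; +_; _+_; _-_; -_; _*_)
  import Data.Integer.Properties as ℤₚ
  open import Data.Integer.Tactic.RingSolver using (solve-∀; solve)
  open import Data.List using ([]; _∷_)
  open import Data.Product using (_,_)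
  open import Data.Sum using ([_,_]′)
  open import Data.Empty using (⊥-elim)
  open import Relation.Nullary using (¬_; Dec; yes; no)
  open import Relation.Binary.PropositionalEquality as ≡ using (_≡_; cong; cong₂)

  module Jacobsthal (2≉0 : + 2 ≉ + 0) (i : ℤ) (i² : i * i ≈ - + 1) where

    open Character 2≉0
    open ≡.≡-Reasoning

    -- The autocorrelation of `χ` at shift `γ`. Its value is `p − 1` at shift 0 and a constant `J`
    -- at every other shift.
    W : ℤ → ℤ
    W γ = ∑ₚ (λ c → χ c * χ (c + γ))

    J : ℤ
    J = W (+ 1)

    p-1≢0 : ¬ (+ p - + 1 ≡ + 0)
    p-1≢0 e = ℕₚ.<⇒≢ 2≤p (≡.sym (ℤₚ.+-injective (ℤₚ.i-j≡0⇒i≡j (+ p) (+ 1) e)))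

    W-zero : ∀ {γ} → γ ≈ + 0 → W γ ≡ + p - + 1
    W-zero {γ} h = ≡.trans (∑ₚ-ext (λ c → cong (_*_ (χ c)) (χ-cong (drop c)))) ∑χ²
      where
      drop : ∀ c → c + γ ≈ c
      drop c = by (+ 1 · h) (solve (c ∷ γ ∷ []))

    -- The substitution `c ↦ γ c` pulls `χ(γ)² = 1` out of each term.
    W-unit : ∀ {γ} → γ ≉ + 0 → W γ ≡ J
    W-unit {γ} nγ = begin
      ∑ₚ (λ c → χ c * χ (c + γ))               ≡⟨ ∑ₚ-scale nγ (λ h → cong₂ _*_ (χ-cong h) (χ-cong (+-cong h ≈-refl))) ⟨
      ∑ₚ (λ c → χ (γ * c) * χ (γ * c + γ))     ≡⟨ ∑ₚ-ext step ⟩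
      ∑ₚ (λ c → χ c * χ (c + + 1))             ∎
      where
      factor : ∀ γ c → γ * c + γ ≡ γ * (c + + 1)
      factor = solve-∀
      collect : ∀ g a b → (g * a) * (g * b) ≡ (g * g) * (a * b)
      collect = solve-∀
      step : ∀ c → χ (γ * c) * χ (γ * c + γ) ≡ χ c * χ (c + + 1)
      step c = begin
        χ (γ * c) * χ (γ * c + γ)                ≡⟨ cong₂ _*_ (χ-* γ c) (≡.trans (cong χ (factor γ c)) (χ-* γ (c + + 1))) ⟩
        (χ γ * χ c) * (χ γ * χ (c + + 1))        ≡⟨ collect (χ γ) (χ c) (χ (c + + 1)) ⟩
        (χ γ * χ γ) * (χ c * χ (c + + 1))        ≡⟨ cong (_* (χ c * χ (c + + 1))) (χ-unit² nγ) ⟩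
        + 1 * (χ c * χ (c + + 1))                ≡⟨ ℤₚ.*-identityˡ _ ⟩
        χ c * χ (c + + 1)                        ∎

    W-formula : ∀ γ → W γ ≡ J + ⟦ γ ≈? + 0 ⟧ * (+ p - + 1 - J)
    W-formula γ = go (γ ≈? + 0)
      where
      at-zero : ∀ q j → q ≡ j + + 1 * (q - j)
      at-zero = solve-∀
      at-unit : ∀ q j → j ≡ j + + 0 * (q - j)
      at-unit = solve-∀
      go : (d : Dec (γ ≈ + 0)) → W γ ≡ J + ⟦ d ⟧ * (+ p - + 1 - J)
      go (yes h) = ≡.trans (W-zero h) (at-zero (+ p - + 1) J)
      go (no n)  = ≡.trans (W-unit n) (at-unit (+ p - + 1) J)

    ∑W : ∑ₚ W ≡ + 0
    ∑W = begin
      ∑ₚ W                                                 ≡⟨ ∑ₚ-swap (λ γ c → χ c * χ (c + γ)) ⟩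
      ∑ₚ (λ c → ∑ₚ (λ γ → χ c * χ (c + γ)))                ≡⟨ ∑ₚ-ext (λ c → ∑ₚ-*ˡ (χ c) (λ γ → χ (c + γ))) ⟩
      ∑ₚ (λ c → χ c * ∑ₚ (λ γ → χ (c + γ)))                ≡⟨ ∑ₚ-ext (λ c → cong (_*_ (χ c)) (shifted c)) ⟩
      ∑ₚ (λ c → χ c * + 0)                                 ≡⟨ ∑ₚ-ext (λ c → ℤₚ.*-zeroʳ (χ c)) ⟩
      ∑ₚ (λ _ → + 0)                                       ≡⟨ ∑ₚ-const (+ 0) ⟩
      + p * + 0                                            ≡⟨ ℤₚ.*-zeroʳ (+ p) ⟩
      + 0                                                  ∎
      where
      shifted : ∀ c → ∑ₚ (λ γ → χ (c + γ)) ≡ + 0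
      shifted c = ≡.trans (∑ₚ-ext (λ γ → cong χ (ℤₚ.+-comm c γ))) (≡.trans (∑ₚ-shift c χ-cong) ∑χ)

    -- Summed over all shifts, the autocorrelation vanishes because each inner sum is `∑χ`; by
    -- values it is `(p − 1) + (p − 1) J`.
    J≡-1 : J ≡ - + 1
    J≡-1 = [ (λ e → ⊥-elim (p-1≢0 e)) , ℤₚ.i-j≡0⇒i≡j J (- + 1) ]′
             (ℤₚ.i*j≡0⇒i≡0∨j≡0 (+ p - + 1) (≡.trans (≡.sym total) ∑W))
      where
      regroup : ∀ q j → q * j + + 1 * (q - + 1 - j) ≡ (q - + 1) * (j - - + 1)
      regroup = solve-∀
      total : ∑ₚ W ≡ (+ p - + 1) * (J - - + 1)
      total = begin
        ∑ₚ W                                                         ≡⟨ ∑ₚ-ext W-formula ⟩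
        ∑ₚ (λ γ → J + ⟦ γ ≈? + 0 ⟧ * (+ p - + 1 - J))                ≡⟨ ∑ₚ-+ (λ _ → J) (λ γ → ⟦ γ ≈? + 0 ⟧ * (+ p - + 1 - J)) ⟩
        ∑ₚ (λ _ → J) + ∑ₚ (λ γ → ⟦ γ ≈? + 0 ⟧ * (+ p - + 1 - J))     ≡⟨ cong₂ _+_ (∑ₚ-const J) (≡.trans (∑ₚ-*ʳ (+ p - + 1 - J) (λ γ → ⟦ γ ≈? + 0 ⟧)) (cong (_* (+ p - + 1 - J)) (∑ₚ-count (+ 0)))) ⟩
        + p * J + + 1 * (+ p - + 1 - J)                              ≡⟨ regroup (+ p) J ⟩
        (+ p - + 1) * (J - - + 1)                                    ∎

    -- The reflection `c ↦ α − c` reduces this to `W (β − α)`. Up to the constant `−1`, distinct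
    -- translates are orthogonal.
    correlation : ∀ α β → ∑ₚ (λ c → χ (α - c) * χ (β - c)) ≡ - + 1 + ⟦ β ≈? α ⟧ * + p
    correlation α β = begin
      ∑ₚ (λ c → χ (α - c) * χ (β - c))                     ≡⟨ ∑ₚ-ext (λ c → cong (_*_ (χ (α - c))) (cong χ (rewrite-β α β c))) ⟩
      ∑ₚ (λ c → χ (α - c) * χ ((α - c) + (β - α)))         ≡⟨ ∑ₚ-reindex (λ a → α - a) (λ a → α - a) reflect-cong reflect-cong reflect² reflect²
                                                               (λ h → cong₂ _*_ (χ-cong h) (χ-cong (+-cong h ≈-refl))) ⟩
      W (β - α)                                            ≡⟨ W-formula (β - α) ⟩
      J + ⟦ β - α ≈? + 0 ⟧ * (+ p - + 1 - J)               ≡⟨ cong₂ (λ j d → j + d * (+ p - + 1 - j)) J≡-1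
                                                               (⟦⟧-cong (β - α ≈? + 0) (β ≈? α) to from) ⟩
      - + 1 + ⟦ β ≈? α ⟧ * (+ p - + 1 - - + 1)             ≡⟨ tidy ⟦ β ≈? α ⟧ (+ p) ⟩
      - + 1 + ⟦ β ≈? α ⟧ * + p                             ∎
      where
      rewrite-β : ∀ α β c → β - c ≡ (α - c) + (β - α)
      rewrite-β = solve-∀
      tidy : ∀ d q → - + 1 + d * (q - + 1 - - + 1) ≡ - + 1 + d * q
      tidy = solve-∀
      reflect-cong : ∀ {a b} → a ≈ b → α - a ≈ α - b
      reflect-cong h = ∸-cong (≈-refl {α}) h
      reflect² : ∀ a → α - (α - a) ≈ a
      reflect² a = ≈-reflexive (involutive α a)
        where
        involutive : ∀ α a → α - (α - a) ≡ a
        involutive = solve-∀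
      to : β - α ≈ + 0 → β ≈ α
      to h = by (+ 1 · h) (solve (α ∷ β ∷ []))
      from : β ≈ α → β - α ≈ + 0
      from h = by (+ 1 · h) (solve (α ∷ β ∷ []))

    S : ℤ → ℤ
    S c = ∑ₚ (λ x → χ (x * (x * x - c)))

    term-cong : ∀ c → Respects (λ x → χ (x * (x * x - c)))
    term-cong c h = χ-cong (*-cong h (∸-cong (*-cong h h) (≈-refl {c})))

    S-cong : Respects S
    S-cong {a} {b} h = ∑ₚ-ext (λ x → χ-cong (*-cong (≈-refl {x}) (∸-cong (≈-refl {x * x}) h)))

    S-expand : ∀ c → S c ≡ ∑ₚ (λ x → χ x * χ (x * x - c))
    S-expand c = ∑ₚ-ext (λ x → χ-* x (x * x - c))

    i≉0 : i ≉ + 0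
    i≉0 = √-1≉0 i i²

    χ-neg : ∀ a → χ (- a) ≡ χ a
    χ-neg a = ≡.trans (χ-cong -a≈) (χ-square-* i≉0 a)
      where
      -a≈ : - a ≈ i * i * a
      -a≈ = by (- a · i²) (solve (a ∷ i ∷ []))

    -- The solutions `y = x` and `y = − x` contribute equally because `−1 = i²` is a square; for
    -- `x ≈ 0` the outer factor kills both sides.
    fibre : ∀ x → χ x * ∑ₚ (λ y → ⟦ y * y ≈? x * x ⟧ * χ y) ≡ + 2 * (χ x * χ x)
    fibre x = go (x ≈? + 0)
      where
      go : Dec (x ≈ + 0) → χ x * ∑ₚ (λ y → ⟦ y * y ≈? x * x ⟧ * χ y) ≡ + 2 * (χ x * χ x)
      go (yes z) = ≡.trans (cong (_* ∑ₚ (λ y → ⟦ y * y ≈? x * x ⟧ * χ y)) (χ-zero z))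
                           (≡.sym (cong (_*_ (+ 2)) (cong₂ _*_ (χ-zero z) (χ-zero z))))
      go (no nx) = ≡.trans (cong (_*_ (χ x)) (begin
        ∑ₚ (λ y → ⟦ y * y ≈? x * x ⟧ * χ y)
          ≡⟨ ∑ₚ-ext (λ y → ≡.trans (cong (_* χ y) (square-roots nx y)) (ℤₚ.*-distribʳ-+ (χ y) ⟦ y ≈? x ⟧ ⟦ y ≈? - x ⟧)) ⟩
        ∑ₚ (λ y → ⟦ y ≈? x ⟧ * χ y + ⟦ y ≈? - x ⟧ * χ y)
          ≡⟨ ∑ₚ-+ (λ y → ⟦ y ≈? x ⟧ * χ y) (λ y → ⟦ y ≈? - x ⟧ * χ y) ⟩
        ∑ₚ (λ y → ⟦ y ≈? x ⟧ * χ y) + ∑ₚ (λ y → ⟦ y ≈? - x ⟧ * χ y)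
          ≡⟨ cong₂ _+_ (∑ₚ-single χ-cong x) (≡.trans (∑ₚ-single χ-cong (- x)) (χ-neg x)) ⟩
        χ x + χ x ∎)) (double (χ x))
        where
        double : ∀ a → a * (a + a) ≡ + 2 * (a * a)
        double = solve-∀

    -- After expanding the square, the sum over `c` is moved innermost, where `correlation`
    -- evaluates it. Its constant `−1` disappears against `∑χ`, and only the pairs with `y² = x²`
    -- remain.
    ∑S² : ∑ₚ (λ c → S c * S c) ≡ + p * (+ 2 * (+ p - + 1))
    ∑S² = begin
      ∑ₚ (λ c → S c * S c)
        ≡⟨ ∑ₚ-ext (λ c → ≡.trans (cong₂ _*_ (S-expand c) (S-expand c)) (product c)) ⟩
      ∑ₚ (λ c → ∑ₚ (λ x → ∑ₚ (λ y → t x c * t y c)))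
        ≡⟨ ∑ₚ-swap (λ c x → ∑ₚ (λ y → t x c * t y c)) ⟩
      ∑ₚ (λ x → ∑ₚ (λ c → ∑ₚ (λ y → t x c * t y c)))
        ≡⟨ ∑ₚ-ext (λ x → ∑ₚ-swap (λ c y → t x c * t y c)) ⟩
      ∑ₚ (λ x → ∑ₚ (λ y → ∑ₚ (λ c → t x c * t y c)))
        ≡⟨ ∑ₚ-ext (λ x → ∑ₚ-ext (λ y → pair x y)) ⟩
      ∑ₚ (λ x → ∑ₚ (λ y → χ x * (- + 1 * χ y + + p * (⟦ y * y ≈? x * x ⟧ * χ y))))
        ≡⟨ ∑ₚ-ext inner ⟩
      ∑ₚ (λ x → + p * (+ 2 * (χ x * χ x)))
        ≡⟨ ∑ₚ-*ˡ (+ p) (λ x → + 2 * (χ x * χ x)) ⟩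
      + p * ∑ₚ (λ x → + 2 * (χ x * χ x))
        ≡⟨ cong (_*_ (+ p)) (≡.trans (∑ₚ-*ˡ (+ 2) (λ x → χ x * χ x)) (cong (_*_ (+ 2)) ∑χ²)) ⟩
      + p * (+ 2 * (+ p - + 1)) ∎
      where
      t : ℤ → ℤ → ℤ
      t x c = χ x * χ (x * x - c)

      product : ∀ c → ∑ₚ (λ x → t x c) * ∑ₚ (λ x → t x c) ≡ ∑ₚ (λ x → ∑ₚ (λ y → t x c * t y c))
      product c = ≡.trans (≡.sym (∑ₚ-*ʳ (∑ₚ (λ x → t x c)) (λ x → t x c)))
                          (∑ₚ-ext (λ x → ≡.sym (∑ₚ-*ˡ (t x c) (λ y → t y c))))

      regroup : ∀ a b c d → (a * b) * (c * d) ≡ (a * c) * (b * d)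
      regroup = solve-∀
      spread : ∀ a b d q → (a * b) * (- + 1 + d * q) ≡ a * (- + 1 * b + q * (d * b))
      spread = solve-∀

      pair : ∀ x y → ∑ₚ (λ c → t x c * t y c) ≡ χ x * (- + 1 * χ y + + p * (⟦ y * y ≈? x * x ⟧ * χ y))
      pair x y = begin
        ∑ₚ (λ c → t x c * t y c)
          ≡⟨ ∑ₚ-ext (λ c → regroup (χ x) (χ (x * x - c)) (χ y) (χ (y * y - c))) ⟩
        ∑ₚ (λ c → (χ x * χ y) * (χ (x * x - c) * χ (y * y - c)))
          ≡⟨ ∑ₚ-*ˡ (χ x * χ y) (λ c → χ (x * x - c) * χ (y * y - c)) ⟩
        (χ x * χ y) * ∑ₚ (λ c → χ (x * x - c) * χ (y * y - c))
          ≡⟨ cong (_*_ (χ x * χ y)) (correlation (x * x) (y * y)) ⟩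
        (χ x * χ y) * (- + 1 + ⟦ y * y ≈? x * x ⟧ * + p)
          ≡⟨ spread (χ x) (χ y) ⟦ y * y ≈? x * x ⟧ (+ p) ⟩
        χ x * (- + 1 * χ y + + p * (⟦ y * y ≈? x * x ⟧ * χ y)) ∎

      gather : ∀ a q f → a * (- + 1 * + 0 + q * f) ≡ q * (a * f)
      gather = solve-∀

      inner : ∀ x → ∑ₚ (λ y → χ x * (- + 1 * χ y + + p * (⟦ y * y ≈? x * x ⟧ * χ y))) ≡ + p * (+ 2 * (χ x * χ x))
      inner x = begin
        ∑ₚ (λ y → χ x * (- + 1 * χ y + + p * (⟦ y * y ≈? x * x ⟧ * χ y)))
          ≡⟨ ∑ₚ-*ˡ (χ x) (λ y → - + 1 * χ y + + p * (⟦ y * y ≈? x * x ⟧ * χ y)) ⟩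
        χ x * ∑ₚ (λ y → - + 1 * χ y + + p * (⟦ y * y ≈? x * x ⟧ * χ y))
          ≡⟨ cong (_*_ (χ x)) (≡.trans (∑ₚ-+ (λ y → - + 1 * χ y) (λ y → + p * (⟦ y * y ≈? x * x ⟧ * χ y)))
               (cong₂ _+_ (≡.trans (∑ₚ-*ˡ (- + 1) χ) (cong (_*_ (- + 1)) ∑χ))
                          (∑ₚ-*ˡ (+ p) (λ y → ⟦ y * y ≈? x * x ⟧ * χ y)))) ⟩
        χ x * (- + 1 * + 0 + + p * ∑ₚ (λ y → ⟦ y * y ≈? x * x ⟧ * χ y))
          ≡⟨ gather (χ x) (+ p) (∑ₚ (λ y → ⟦ y * y ≈? x * x ⟧ * χ y)) ⟩
        + p * (χ x * ∑ₚ (λ y → ⟦ y * y ≈? x * x ⟧ * χ y))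
          ≡⟨ cong (_*_ (+ p)) (fibre x) ⟩
        + p * (+ 2 * (χ x * χ x)) ∎

    -- The substitution `x ↦ b x`; on curves, `b² c` is the quadratic twist of `c` by `b`.
    S-twist : ∀ {b} → b ≉ + 0 → ∀ c → S (b * b * c) ≡ χ b * S c
    S-twist {b} nb c = begin
      ∑ₚ (λ x → χ (x * (x * x - b * b * c)))                   ≡⟨ ∑ₚ-scale nb (term-cong (b * b * c)) ⟨
      ∑ₚ (λ x → χ (b * x * (b * x * (b * x) - b * b * c)))     ≡⟨ ∑ₚ-ext (λ x → ≡.trans (cong χ (factor b x c))
                                                                   (≡.trans (χ-square-* nb (b * (x * (x * x - c)))) (χ-* b (x * (x * x - c))))) ⟩
      ∑ₚ (λ x → χ b * χ (x * (x * x - c)))                     ≡⟨ ∑ₚ-*ˡ (χ b) (λ x → χ (x * (x * x - c))) ⟩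
      χ b * S c                                                ∎
      where
      factor : ∀ b x c → b * x * (b * x * (b * x) - b * b * c) ≡ b * b * (b * (x * (x * x - c)))
      factor = solve-∀

    S²-twist : ∀ {b} → b ≉ + 0 → ∀ {c d} → d ≈ b * b * c → S d * S d ≡ S c * S c
    S²-twist {b} nb {c} {d} h = begin
      S d * S d                        ≡⟨ cong₂ _*_ e e ⟩
      (χ b * S c) * (χ b * S c)        ≡⟨ regroup (χ b) (S c) ⟩
      (χ b * χ b) * (S c * S c)        ≡⟨ cong (_* (S c * S c)) (χ-unit² nb) ⟩
      + 1 * (S c * S c)                ≡⟨ ℤₚ.*-identityˡ (S c * S c) ⟩
      S c * S c                        ∎
      where
      e : S d ≡ χ b * S c
      e = ≡.trans (S-cong h) (S-twist nb c)
      regroup : ∀ a b → (a * b) * (a * b) ≡ (a * a) * (b * b)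
      regroup = solve-∀

    S-zero : ∀ {c} → c ≈ + 0 → S c ≡ + 0
    S-zero {c} h = ≡.trans (∑ₚ-ext (λ x → go x (x ≈? + 0))) ∑χ
      where
      cube : ∀ x → x * (x * x - c) ≈ x * x * x
      cube x = by (- x · h) (solve (x ∷ c ∷ []))
      cube≈0 : ∀ x → x ≈ + 0 → x * x * x ≈ + 0
      cube≈0 x z = by (x * x · z) (solve (x ∷ []))
      go : ∀ x → Dec (x ≈ + 0) → χ (x * (x * x - c)) ≡ χ x
      go x (yes z) = ≡.trans (χ-cong (cube x)) (≡.trans (χ-zero (cube≈0 x z)) (≡.sym (χ-zero z)))
      go x (no nx) = ≡.trans (χ-cong (cube x)) (χ-square-* nx x)

    -- On nonzero `c`, `(χ(c)² + χ(m c)) / 2` is the indicator of the square class of `m`, and the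
    -- expression with a minus sign that of the class of `n m`; at `c = 0` both vanish. Everything
    -- is doubled to stay within the integers.
    S²-class : ∀ {m n} → m ≉ + 0 → (∀ b → b * b ≉ n) → ∀ c →
               + 2 * (S c * S c) ≡ (χ c * χ c + χ (m * c)) * (S m * S m)
                                 + (χ c * χ c - χ (m * c)) * (S (n * m) * S (n * m))
    S²-class {m} {n} nm hn c = go (class (m * c))
      where
      A B : ℤ
      A = S m * S m
      B = S (n * m) * S (n * m)

      nn : n ≉ + 0
      nn = nonresidue-≉0 hn

      at-zero : ∀ a b → + 2 * (+ 0 * + 0) ≡ (+ 0 * + 0 + + 0) * a + (+ 0 * + 0 - + 0) * b
      at-zero = solve-∀
      at-square : ∀ a b → + 2 * a ≡ (+ 1 + + 1) * a + (+ 1 - + 1) * b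
      at-square = solve-∀
      at-nonresidue : ∀ a b → + 2 * b ≡ (+ 1 + - + 1) * a + (+ 1 - - + 1) * b
      at-nonresidue = solve-∀

      assemble : ∀ {s u v} → S c * S c ≡ s → χ c * χ c ≡ u → χ (m * c) ≡ v →
                 + 2 * s ≡ (u + v) * A + (u - v) * B →
                 + 2 * (S c * S c) ≡ (χ c * χ c + χ (m * c)) * A + (χ c * χ c - χ (m * c)) * B
      assemble e f g k = ≡.trans (cong (_*_ (+ 2)) e)
        (≡.trans k (≡.sym (cong₂ (λ u v → (u + v) * A + (u - v) * B) f g)))

      quotient : ∀ d e b → d * e ≈ + 1 → b * b ≈ d * c → c ≈ (e * b) * (e * b) * d
      quotient d e b de h =
        by ((- c * (d * e + + 1)) · de ⊹ (- d * e * e) · h) (solve (b ∷ c ∷ d ∷ e ∷ []))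

      unit : ∀ d e {b} → d * e ≈ + 1 → b ≉ + 0 → e * b ≉ + 0
      unit d e de nb = *-≉0 (*-unit {e} {d} (≈-trans (≈-reflexive (ℤₚ.*-comm e d)) de)) nb

      c≉0 : m * c ≉ + 0 → c ≉ + 0
      c≉0 nz z = nz (by (m · z) (solve (m ∷ c ∷ [])))

      go : Class (m * c) → + 2 * (S c * S c) ≡ (χ c * χ c + χ (m * c)) * A + (χ c * χ c - χ (m * c)) * B
      go (zero z) = assemble (cong₂ _*_ (S-zero c≈0) (S-zero c≈0)) (cong₂ _*_ (χ-zero c≈0) (χ-zero c≈0)) (χ-zero z)
                             (at-zero A B)
        where
        c≈0 : c ≈ + 0
        c≈0 = [ (λ k → ⊥-elim (nm k)) , (λ k → k) ]′ (domain m c z)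
      go (square b nb h) = assemble (S²-twist (unit m (m ⁻¹) inv nb) (quotient m (m ⁻¹) b inv h))
          (χ-unit² (c≉0 (λ z → *-≉0 nb nb (≈-trans h z)))) (χ-square b nb h) (at-square A B)
        where
        inv : m * m ⁻¹ ≈ + 1
        inv = inverseʳ nm
      -- Both `n` and `m c` are nonresidues, so their product has character 1, and only the `square`
      -- case for it survives.
      go (nonresidue h) = go′ (class (n * m * c))
        where
        χ≡1 : χ (n * m * c) ≡ + 1
        χ≡1 = ≡.trans (cong χ (ℤₚ.*-assoc n m c))
                (≡.trans (χ-nonresidue-* hn (m * c)) (cong -_ (χ-nonresidue h)))
        inv : n * m * (n * m) ⁻¹ ≈ + 1
        inv = inverseʳ (*-≉0 nn nm)
        0≢1 : ¬ (+ 0 ≡ + 1)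
        0≢1 ()
        -1≢1 : ¬ (- + 1 ≡ + 1)
        -1≢1 ()
        go′ : Class (n * m * c) → + 2 * (S c * S c) ≡ (χ c * χ c + χ (m * c)) * A + (χ c * χ c - χ (m * c)) * B
        go′ (zero z)        = ⊥-elim (0≢1 (≡.trans (≡.sym (χ-zero z)) χ≡1))
        go′ (nonresidue k)  = ⊥-elim (-1≢1 (≡.trans (≡.sym (χ-nonresidue k)) χ≡1))
        go′ (square b nb k) = assemble (S²-twist (unit (n * m) ((n * m) ⁻¹) inv nb) (quotient (n * m) ((n * m) ⁻¹) b inv k))
          (χ-unit² (c≉0 (nonresidue-≉0 h))) (χ-nonresidue h) (at-nonresidue A B)

    -- Summing `S²-class` over `c`, the terms with `χ(m c)` cancel and `(p − 1)(A + B)` is left.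
    -- Comparison with `∑S²` and division by `p − 1` finish.
    jacobsthal : ∀ {m n} → m ≉ + 0 → (∀ b → b * b ≉ n) → S m * S m + S (n * m) * S (n * m) ≡ + 4 * + p
    jacobsthal {m} {n} nm hn = [ (λ e → ⊥-elim (p-1≢0 e)) , ℤₚ.i-j≡0⇒i≡j (A + B) (+ 4 * + p) ]′
        (ℤₚ.i*j≡0⇒i≡0∨j≡0 (+ p - + 1) (≡.trans (isolate (+ p) (A + B))
          (ℤₚ.i≡j⇒i-j≡0 (≡.trans (≡.sym rhs) lhs))))
      where
      A B : ℤ
      A = S m * S m
      B = S (n * m) * S (n * m)

      isolate : ∀ q s → (q - + 1) * (s - + 4 * q) ≡ (q - + 1) * s - + 2 * (q * (+ 2 * (q - + 1)))
      isolate = solve-∀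

      lhs : ∑ₚ (λ c → + 2 * (S c * S c)) ≡ + 2 * (+ p * (+ 2 * (+ p - + 1)))
      lhs = ≡.trans (∑ₚ-*ˡ (+ 2) (λ c → S c * S c)) (cong (_*_ (+ 2)) ∑S²)

      regroup : ∀ u v a b → (u + v) * a + (u - v) * b ≡ u * (a + b) + v * (a - b)
      regroup = solve-∀
      simplify : ∀ q a b → (q - + 1) * (a + b) + + 0 * (a - b) ≡ (q - + 1) * (a + b)
      simplify = solve-∀

      rhs : ∑ₚ (λ c → + 2 * (S c * S c)) ≡ (+ p - + 1) * (A + B)
      rhs = begin
        ∑ₚ (λ c → + 2 * (S c * S c))
          ≡⟨ ∑ₚ-ext (λ c → ≡.trans (S²-class nm hn c) (regroup (χ c * χ c) (χ (m * c)) A B)) ⟩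
        ∑ₚ (λ c → χ c * χ c * (A + B) + χ (m * c) * (A - B))
          ≡⟨ ∑ₚ-+ (λ c → χ c * χ c * (A + B)) (λ c → χ (m * c) * (A - B)) ⟩
        ∑ₚ (λ c → χ c * χ c * (A + B)) + ∑ₚ (λ c → χ (m * c) * (A - B))
          ≡⟨ cong₂ _+_ (∑ₚ-*ʳ (A + B) (λ c → χ c * χ c)) (∑ₚ-*ʳ (A - B) (λ c → χ (m * c))) ⟩
        ∑ₚ (λ c → χ c * χ c) * (A + B) + ∑ₚ (λ c → χ (m * c)) * (A - B)
          ≡⟨ cong₂ (λ u v → u * (A + B) + v * (A - B)) ∑χ² (≡.trans (∑ₚ-scale nm χ-cong) ∑χ) ⟩
        (+ p - + 1) * (A + B) + + 0 * (A - B)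
          ≡⟨ simplify (+ p) A B ⟩
        (+ p - + 1) * (A + B) ∎

-- Chords and tangents as polynomial congruences.

module Lines (p : ℕ) .{{_ : NonZero p}} (pr : Prime p) (m : ℤ) where

  open PrimeField p pr
  open import Data.Integer using (+_; _+_; _-_; -_; _*_)
  open import Data.Integer.Tactic.RingSolver using (solve; solve-∀)
  open import Data.List using ([]; _∷_)
  open import Data.Product using (_×_; _,_)
  open import Data.Sum using (_⊎_; inj₁; inj₂; [_,_]′)
  open import Relation.Binary.PropositionalEquality using (_≡_)
  open import Data.Empty using (⊥-elim)

  On : ℤ → ℤ → Set
  On x y = y * y ≈ x * x * x - m * x

  -- The two equations hold for chords and for tangents alike, and determine l unless
  -- the points (x₁ , y₁) and (x₂ , y₂) are opposite.
  record IsSlope (x₁ y₁ x₂ y₂ l : ℤ) : Set where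
    constructor mkSlope
    field
      chord   : (x₂ - x₁) * l ≈ y₂ - y₁
      tangent : (y₁ + y₂) * l ≈ x₁ * x₁ + x₁ * x₂ + x₂ * x₂ - m
  open IsSlope public

  -- The point `(x₃ , y₃)` is the sum, so it is its mirror image `(x₃ , − y₃)` that lies on the line
  -- of slope `l`.
  record Line (x₁ y₁ x₂ y₂ l x₃ y₃ : ℤ) : Set where
    constructor mkLine
    field
      slope : IsSlope x₁ y₁ x₂ y₂ l
      x-eq  : x₃ ≈ l * l - x₁ - x₂
      y-eq  : y₃ ≈ l * (x₁ - x₃) - y₁
  open Line public

  Opposite : ℤ → ℤ → ℤ → ℤ → Set
  Opposite x₁ y₁ x₂ y₂ = x₁ ≈ x₂ × y₁ + y₂ ≈ + 0

  slope-unique : ∀ {x₁ y₁ x₂ y₂ l l′} → IsSlope x₁ y₁ x₂ y₂ l → IsSlope x₁ y₁ x₂ y₂ l′ →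
                 l ≈ l′ ⊎ Opposite x₁ y₁ x₂ y₂
  slope-unique {x₁} {y₁} {x₂} {y₂} {l} {l′} s s′ =
    [ (λ z → [ (λ w → inj₂ (same-x z , w)) , (λ w → inj₁ (same-l w)) ]′ (domain (y₁ + y₂) (l - l′) t))
    , (λ z → inj₁ (same-l z)) ]′ (domain (x₂ - x₁) (l - l′) c)
    where
    c : (x₂ - x₁) * (l - l′) ≈ + 0
    c = by (+ 1 · chord s ⊹ - + 1 · chord s′) (solve (x₁ ∷ y₁ ∷ x₂ ∷ y₂ ∷ l ∷ l′ ∷ []))
    t : (y₁ + y₂) * (l - l′) ≈ + 0
    t = by (+ 1 · tangent s ⊹ - + 1 · tangent s′) (solve (x₁ ∷ y₁ ∷ x₂ ∷ y₂ ∷ l ∷ l′ ∷ m ∷ []))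
    same-x : x₂ - x₁ ≈ + 0 → x₁ ≈ x₂
    same-x z = by (- + 1 · z) (solve (x₁ ∷ x₂ ∷ []))
    same-l : l - l′ ≈ + 0 → l ≈ l′
    same-l z = by (+ 1 · z) (solve (l ∷ l′ ∷ []))

  -- Subtracting the curve equations gives `(y₂ − y₁)(y₁ + y₂) = (x₂ − x₁)(x₁² + x₁x₂ + x₂² −
  -- m)`; the `tangent` equation is this with `x₂ − x₁` cancelled.
  chord-slope : ∀ {x₁ y₁ x₂ y₂ l} → On x₁ y₁ → On x₂ y₂ → x₂ - x₁ ≉ + 0 →
                (x₂ - x₁) * l ≈ y₂ - y₁ → IsSlope x₁ y₁ x₂ y₂ l
  chord-slope {x₁} {y₁} {x₂} {y₂} {l} o₁ o₂ nz c = mkSlope c (*-cancelˡ nz scaled)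
    where
    scaled : (x₂ - x₁) * ((y₁ + y₂) * l) ≈ (x₂ - x₁) * (x₁ * x₁ + x₁ * x₂ + x₂ * x₂ - m)
    scaled = by (y₁ + y₂ · c ⊹ + 1 · o₂ ⊹ - + 1 · o₁) (solve (x₁ ∷ y₁ ∷ x₂ ∷ y₂ ∷ l ∷ m ∷ []))

  tangent-slope : ∀ {x y l} → + 2 * y * l ≈ + 3 * x * x - m → IsSlope x y x y l
  tangent-slope {x} {y} {l} t = mkSlope (by (+ 0 · t) (solve (x ∷ y ∷ l ∷ m ∷ []))) (by (+ 1 · t) (solve (x ∷ y ∷ l ∷ m ∷ [])))

  slope-sym : ∀ {x₁ y₁ x₂ y₂ l} → IsSlope x₁ y₁ x₂ y₂ l → IsSlope x₂ y₂ x₁ y₁ l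
  slope-sym {x₁} {y₁} {x₂} {y₂} {l} s = mkSlope
    (by (- + 1 · chord s) (solve (x₁ ∷ y₁ ∷ x₂ ∷ y₂ ∷ l ∷ [])))
    (by (+ 1 · tangent s) (solve (x₁ ∷ y₁ ∷ x₂ ∷ y₂ ∷ l ∷ m ∷ [])))

  line-sym : ∀ {x₁ y₁ x₂ y₂ l x₃ y₃} → Line x₁ y₁ x₂ y₂ l x₃ y₃ → Line x₂ y₂ x₁ y₁ l x₃ y₃
  line-sym {x₁} {y₁} {x₂} {y₂} {l} {x₃} {y₃} L = mkLine (slope-sym (slope L))
    (by (+ 1 · x-eq L) (solve (x₁ ∷ x₂ ∷ l ∷ x₃ ∷ [])))
    (by (+ 1 · y-eq L ⊹ - + 1 · chord (slope L)) (solve (x₁ ∷ y₁ ∷ x₂ ∷ y₂ ∷ l ∷ x₃ ∷ y₃ ∷ [])))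

  -- Second elementary symmetric function of the abscissae on y = l (x − x₁) + y₁.
  e₂ : ∀ {x₁ y₁ x₂ y₂ l x₃ y₃} → Line x₁ y₁ x₂ y₂ l x₃ y₃ →
       x₁ * x₂ + (x₁ + x₂) * x₃ ≈ - m - + 2 * l * (y₁ - l * x₁)
  e₂ {x₁} {y₁} {x₂} {y₂} {l} {x₃} L =
    by (x₁ + x₂ · x-eq L ⊹ l · chord (slope L) ⊹ + 1 · tangent (slope L)) (solve (x₁ ∷ y₁ ∷ x₂ ∷ y₂ ∷ l ∷ x₃ ∷ m ∷ []))

  -- By `x-eq` and `e₂`, the cubic `x³ − m x − (l (x − x₁) + y₁)²` agrees with
  -- `(x − x₁)(x − x₂)(x − x₃)` up to its constant term, and the curve equation at `x₁` settles that
  -- one.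
  line-on : ∀ {x₁ y₁ x₂ y₂ l x₃ y₃} → On x₁ y₁ → Line x₁ y₁ x₂ y₂ l x₃ y₃ → On x₃ y₃
  line-on {x₁} {y₁} {x₂} {y₂} {l} {x₃} {y₃} o L = ≈-trans (*-cong (y-eq L) (y-eq L)) on′
    where
    on′ : (l * (x₁ - x₃) - y₁) * (l * (x₁ - x₃) - y₁) ≈ x₃ * x₃ * x₃ - m * x₃
    on′ = by (+ 1 · o ⊹ x₃ - x₁ · e₂ L ⊹ (x₁ - x₃) * (x₁ + x₃) · x-eq L) (solve (x₁ ∷ y₁ ∷ x₂ ∷ l ∷ x₃ ∷ m ∷ []))

  -- For the lines through P₁, P₂, −S and S, P₄, −U, the quotient of the product of their
  -- equations by x − x₃ is (x − x₁)(x − x₂) − σ (y − y₁ − l (x − x₁)) with σ = l + k,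
  -- a function vanishing at P₁, P₂, P₄ and −U.
  module Pencil {x₁ y₁ x₂ y₂ l x₃ y₃ x₄ y₄ k x₅ y₅}
                (L : Line x₁ y₁ x₂ y₂ l x₃ y₃) (K : Line x₃ y₃ x₄ y₄ k x₅ y₅) where

    -- The same function also reads `(x − x₄)(x − x₅) − σ (y − y₄ − k (x −
    -- x₄))`. Here the coefficients of `x` in the two forms are compared, in `constant-term` the constants; vanishing at `P₄` and `−U`
    -- is then visible.
    abscissa : x₅ ≈ x₁ + x₂ - x₄ + (l + k) * (k - l)
    abscissa = by (+ 1 · x-eq K ⊹ - + 1 · x-eq L) (solve (x₁ ∷ x₂ ∷ x₃ ∷ x₄ ∷ x₅ ∷ l ∷ k ∷ []))

    constant-term : x₁ * x₂ + (l + k) * (y₁ - l * x₁) ≈ x₄ * x₅ + (l + k) * (y₄ - k * x₄)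
    constant-term =
      by (+ 1 · e₂ L ⊹ - + 1 · e₂ K ⊹ l + k · chord (slope K) ⊹ x₃ · x-eq K ⊹ - x₃ · x-eq L ⊹ k - l · y-eq L)
         (solve (x₁ ∷ y₁ ∷ x₂ ∷ x₃ ∷ y₃ ∷ x₄ ∷ y₄ ∷ x₅ ∷ l ∷ k ∷ m ∷ []))

    at-P₄ : (x₄ - x₁) * (x₄ - x₂) ≈ (l + k) * (y₄ - y₁ - l * (x₄ - x₁))
    at-P₄ = by (x₄ · abscissa ⊹ + 1 · constant-term)
               (solve (x₁ ∷ y₁ ∷ x₂ ∷ x₄ ∷ y₄ ∷ x₅ ∷ l ∷ k ∷ []))

    at-−U : (x₅ - x₁) * (x₅ - x₂) ≈ (l + k) * (- y₅ - y₁ - l * (x₅ - x₁))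
    at-−U = by (x₅ · abscissa ⊹ + 1 · constant-term ⊹ l + k · y-eq K ⊹ - (l + k) · chord (slope K))
               (solve (x₁ ∷ y₁ ∷ x₂ ∷ x₃ ∷ y₃ ∷ x₄ ∷ y₄ ∷ x₅ ∷ y₅ ∷ l ∷ k ∷ []))

  module Associativity {x₁ y₁ x₂ y₂ x₄ y₄ l x₃ y₃ k x₅ y₅ l′ x₃′ y₃′ k′ x₅′ y₅′}
      (L : Line x₁ y₁ x₂ y₂ l x₃ y₃) (K : Line x₃ y₃ x₄ y₄ k x₅ y₅)
      (L′ : Line x₂ y₂ x₄ y₄ l′ x₃′ y₃′) (K′ : Line x₃′ y₃′ x₁ y₁ k′ x₅′ y₅′)
      (x₄≉x₁ : x₄ - x₁ ≉ + 0) (x₄≉x₂ : x₄ - x₂ ≉ + 0) where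

    private
      module F = Pencil L K
      module F′ = Pencil L′ K′
      σ σ′ D : ℤ
      σ = l + k
      σ′ = l′ + k′
      D = y₄ - y₁ - l * (x₄ - x₁)

    -- The functions attached to (P₁ ⊕ P₂) ⊕ P₄ and to P₁ ⊕ (P₂ ⊕ P₄) coincide as soon as
    -- the second one vanishes on the divisor P₁ + P₂, which is the following condition.
    Key : Set
    Key = (l′ + k′) * (l′ - l) ≈ x₄ - x₁

    -- In `F′` the point `P₁` takes the place of `P₄`. Inserting `y₁ − y₂ = l (x₁ − x₂)` into the
    -- vanishing there leaves a common factor `x₁ − x₂`.
    key-distinct : x₁ - x₂ ≉ + 0 → Key
    key-distinct nz = *-cancelˡ nz scaled
      where
      scaled : (x₁ - x₂) * ((l′ + k′) * (l′ - l)) ≈ (x₁ - x₂) * (x₄ - x₁)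
      scaled = by (+ 1 · F′.at-P₄ ⊹ l′ + k′ · chord (slope L))
                  (solve (x₁ ∷ y₁ ∷ x₂ ∷ y₂ ∷ x₄ ∷ l ∷ l′ ∷ k′ ∷ []))

    -- When `P₁ = P₂`, vanishing at `P₁` says nothing beyond vanishing at `P₂`, and double vanishing
    -- has to be shown instead. It comes from the tangent slope `l`, after multiplication by the
    -- nonzero `x₃′ − x₁`.
    key-double : x₁ ≈ x₂ → y₁ ≈ y₂ → x₃′ - x₁ ≉ + 0 → Key
    key-double ex ey nz = *-cancelˡ nz scaled
      where
      t : + 2 * y₂ * l ≈ + 3 * x₂ * x₂ - m
      t = by (+ 1 · tangent (slope L) ⊹ - l · ey ⊹ x₁ + + 2 * x₂ · ex) (solve (x₁ ∷ y₁ ∷ x₂ ∷ y₂ ∷ l ∷ m ∷ []))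
      c : (x₂ - x₃′) * k′ ≈ y₂ - y₃′
      c = by (+ 1 · chord (slope K′) ⊹ - k′ · ex ⊹ + 1 · ey) (solve (x₁ ∷ y₁ ∷ x₂ ∷ y₂ ∷ x₃′ ∷ y₃′ ∷ k′ ∷ []))
      scaled₂ : (x₃′ - x₂) * ((l′ + k′) * (l′ - l)) ≈ (x₃′ - x₂) * (x₄ - x₂)
      scaled₂ = by (+ 1 · t ⊹ l′ - l · y-eq L′ ⊹ - (l′ - l) · c ⊹ - + 1 · e₂ L′ ⊹ + 2 * x₂ · x-eq L′)
                   (solve (x₂ ∷ y₂ ∷ x₃′ ∷ y₃′ ∷ x₄ ∷ l ∷ l′ ∷ k′ ∷ m ∷ []))
      scaled : (x₃′ - x₁) * ((l′ + k′) * (l′ - l)) ≈ (x₃′ - x₁) * (x₄ - x₁)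
      scaled = by (+ 1 · scaled₂ ⊹ x₄ + x₃′ - x₁ - x₂ - (l′ + k′) * (l′ - l) · ex)
                  (solve (x₁ ∷ x₂ ∷ x₃′ ∷ x₄ ∷ l ∷ l′ ∷ k′ ∷ []))

    module _ (key : Key) where

      private
        -- The condition `key` rewrites the second function in terms of the chord `P₁P₂`, so that it
        -- differs from the first in `σ′` alone; this is its vanishing at `P₄`.
        at-P₄′ : (x₄ - x₁) * (x₄ - x₂) ≈ (l′ + k′) * (y₄ - y₁ - l * (x₄ - x₁))
        at-P₄′ = by (- (x₄ - x₂) · key ⊹ l′ + k′ · chord (slope L) ⊹ l′ + k′ · chord (slope L′))
                    (solve (x₁ ∷ y₁ ∷ x₂ ∷ y₂ ∷ x₄ ∷ y₄ ∷ l ∷ l′ ∷ k′ ∷ []))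

        product≉0 : (x₄ - x₁) * (x₄ - x₂) ≉ + 0
        product≉0 = *-≉0 x₄≉x₁ x₄≉x₂

        -- By `F.at-P₄` the nonzero product `(x₄ − x₁)(x₄ − x₂)` equals `σ D`, so both factors are
        -- invertible.
        D≉0 : D ≉ + 0
        D≉0 z = product≉0 (≈-trans F.at-P₄ (by (σ · z) (identity σ D)))
          where
          identity : ∀ s d → s * d - + 0 ≡ s * (d - + 0)
          identity = solve-∀

        σ≉0 : σ ≉ + 0
        σ≉0 z = product≉0 (≈-trans F.at-P₄ (by (D · z) (identity σ D)))
          where
          identity : ∀ s d → s * d - + 0 ≡ d * (s - + 0)
          identity = solve-∀

        σ≈σ′ : l + k ≈ l′ + k′
        σ≈σ′ = *-cancelˡ D≉0 (commuted σ σ′ D (≈-trans (≈-sym F.at-P₄) at-P₄′))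
          where
          commuted : ∀ s s′ d → s * d ≈ s′ * d → d * s ≈ d * s′
          commuted s s′ d h = by (+ 1 · h) (solve (s ∷ s′ ∷ d ∷ []))

      x₅≈x₅′ : x₅ ≈ x₅′
      x₅≈x₅′ = by (+ 1 · F.abscissa ⊹ - + 1 · F′.abscissa ⊹ l + k + (l′ + k′) - + 2 * l · σ≈σ′ ⊹ + 2 · key)
                  (solve (x₁ ∷ x₂ ∷ x₄ ∷ x₅ ∷ x₅′ ∷ l ∷ k ∷ l′ ∷ k′ ∷ []))

      -- At a given abscissa the common function is linear in `y` with coefficient `−σ ≉ 0`, hence
      -- has a single zero.
      y₅≈y₅′ : y₅ ≈ y₅′
      y₅≈y₅′ = *-cancelˡ σ≉0 scaled
        where
        at-−U′ : (x₅ - x₂) * (x₅ - x₄) ≈ (l′ + k′) * (- y₅′ - y₂ - l′ * (x₅ - x₂))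
        at-−U′ = by (+ 1 · F′.at-−U ⊹ x₅ + x₅′ - x₂ - x₄ + (l′ + k′) * l′ · x₅≈x₅′)
                    (solve (x₂ ∷ y₂ ∷ x₄ ∷ x₅ ∷ x₅′ ∷ y₅′ ∷ l′ ∷ k′ ∷ []))
        scaled : (l + k) * y₅ ≈ (l + k) * y₅′
        scaled = by (+ 1 · F.at-−U ⊹ - + 1 · at-−U′ ⊹ x₅ - x₂ · key ⊹ - (l′ + k′) · chord (slope L)
                     ⊹ - (y₅′ + y₁ + l * (x₅ - x₁)) · σ≈σ′)
                    (solve (x₁ ∷ y₁ ∷ x₂ ∷ y₂ ∷ x₄ ∷ x₅ ∷ y₅ ∷ y₅′ ∷ l ∷ k ∷ l′ ∷ k′ ∷ []))

  line-cong : ∀ {x₁ y₁ x₂ y₂ l x₃ y₃ x₁′ y₁′ x₂′ y₂′ l′ x₃′ y₃′} →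
              x₁ ≈ x₁′ → y₁ ≈ y₁′ → x₂ ≈ x₂′ → y₂ ≈ y₂′ → l ≈ l′ → x₃ ≈ x₃′ → y₃ ≈ y₃′ →
              Line x₁ y₁ x₂ y₂ l x₃ y₃ → Line x₁′ y₁′ x₂′ y₂′ l′ x₃′ y₃′
  line-cong a b c d e f g L = mkLine
    (mkSlope (transport (*-cong (∸-cong c a) e) (∸-cong d b) (chord (slope L)))
             (transport (*-cong (+-cong b d) e)
                        (∸-cong (+-cong (+-cong (*-cong a a) (*-cong a c)) (*-cong c c)) (≈-refl {m})) (tangent (slope L))))
    (transport f (∸-cong (∸-cong (*-cong e e) a) c) (x-eq L))
    (transport g (∸-cong (*-cong e (∸-cong a f)) b) (y-eq L))
    where
    transport : ∀ {u u′ v v′} → u ≈ u′ → v ≈ v′ → u ≈ v → u′ ≈ v′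
    transport h k q = ≈-trans (≈-sym h) (≈-trans q k)

  -- Reflection in the x-axis carries the line through `P₁`, `P₂`, `−P₃` to one through `P₃`, `−P₂`,
  -- `−P₁`, which computes `P₃ ⊕ (−P₂) = P₁`.
  line-cancel : ∀ {x₁ y₁ x₂ y₂ l x₃ y₃} → Line x₁ y₁ x₂ y₂ l x₃ y₃ → Line x₃ y₃ x₂ (- y₂) (- l) x₁ y₁
  line-cancel {x₁} {y₁} {x₂} {y₂} {l} {x₃} {y₃} L = mkLine
    (mkSlope (by (+ 1 · y-eq L ⊹ - + 1 · chord (slope L)) (solve (x₁ ∷ y₁ ∷ x₂ ∷ y₂ ∷ l ∷ x₃ ∷ y₃ ∷ [])))
             (by (- l · y-eq L ⊹ - l · chord (slope L) ⊹ + 1 · e₂ L ⊹ - (x₂ + x₃) · x-eq L)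
                 (solve (x₁ ∷ y₁ ∷ x₂ ∷ y₂ ∷ l ∷ x₃ ∷ y₃ ∷ m ∷ []))))
    (by (+ 1 · x-eq L) (solve (x₁ ∷ x₂ ∷ l ∷ x₃ ∷ [])))
    (by (+ 1 · y-eq L) (solve (x₁ ∷ y₁ ∷ l ∷ x₃ ∷ y₃ ∷ [])))

  module Nonsingular (2≉0 : + 2 ≉ + 0) (m≉0 : m ≉ + 0) where

    -- From `x³ = m x` and `3 x² = m` follows `2 x³ = 0`, hence `x = 0` and then `m = 0`.
    nonsingular : ∀ {x y} → On x y → y ≈ + 0 → + 3 * x * x - m ≉ + 0
    nonsingular {x} {y} o y≈0 t = m≉0 m≈0
      where
      cube : + 2 * (x * x * x) ≈ + 0
      cube = by (x · t ⊹ + 1 · o ⊹ - y · y≈0) (solve (x ∷ y ∷ m ∷ []))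
      x≈0 : x ≈ + 0
      x≈0 = [ (λ z → ⊥-elim (2≉0 z)) , (λ z → [ square≈0 {x} , (λ w → w) ]′ (domain (x * x) x z)) ]′
              (domain (+ 2) (x * x * x) cube)
      m≈0 : m ≈ + 0
      m≈0 = by (- + 1 · t ⊹ + 3 * x · x≈0) (solve (x ∷ m ∷ []))

    -- If `P₁ ⊕ P₂` were `P₂`, the two equations of the reflected slope would read `2 y₂ = 0` and
    -- `3 x₂² = m`, making `P₂` singular.
    line-cancel-¬opposite : ∀ {x₁ y₁ x₂ y₂ l x₃ y₃} → On x₂ y₂ → Line x₁ y₁ x₂ y₂ l x₃ y₃ →
                            x₃ ≈ x₂ → y₃ - y₂ ≉ + 0
    line-cancel-¬opposite {x₁} {y₁} {x₂} {y₂} {l} {x₃} {y₃} o L h₁ h₂ = nonsingular {x₂} {y₂} o y₂≈0 t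
      where
      s : IsSlope x₃ y₃ x₂ (- y₂) (- l)
      s = slope (line-cancel L)
      2y₂≈0 : + 2 * y₂ ≈ + 0
      2y₂≈0 = by (+ 1 · chord s ⊹ - l · h₁ ⊹ - + 1 · h₂) (solve (x₂ ∷ y₂ ∷ l ∷ x₃ ∷ y₃ ∷ []))
      y₂≈0 : y₂ ≈ + 0
      y₂≈0 = [ (λ z → ⊥-elim (2≉0 z)) , (λ z → z) ]′ (domain (+ 2) y₂ 2y₂≈0)
      t : + 3 * x₂ * x₂ - m ≈ + 0
      t = by (- + 1 · tangent s ⊹ - l · h₂ ⊹ - (x₃ + + 2 * x₂) · h₁) (solve (x₂ ∷ y₂ ∷ l ∷ x₃ ∷ y₃ ∷ m ∷ []))

  module ComplexMultiplication (i : ℤ) (i² : i * i ≈ - + 1) where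

    -- Abscissae are multiplied by `−1` and ordinates by `i`, so slopes are multiplied by
    -- `i / (−1) = −i`.
    line-ι : ∀ {x₁ y₁ x₂ y₂ l x₃ y₃} → Line x₁ y₁ x₂ y₂ l x₃ y₃ →
             Line (- x₁) (i * y₁) (- x₂) (i * y₂) (- i * l) (- x₃) (i * y₃)
    line-ι {x₁} {y₁} {x₂} {y₂} {l} {x₃} {y₃} L = mkLine
      (mkSlope (by (i · chord (slope L)) (solve (x₁ ∷ y₁ ∷ x₂ ∷ y₂ ∷ l ∷ i ∷ [])))
               (by (+ 1 · tangent (slope L) ⊹ - ((y₁ + y₂) * l) · i²) (solve (x₁ ∷ y₁ ∷ x₂ ∷ y₂ ∷ l ∷ m ∷ i ∷ []))))
      (by (- + 1 · x-eq L ⊹ - (l * l) · i²) (solve (x₁ ∷ x₂ ∷ l ∷ x₃ ∷ i ∷ [])))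
      (by (i · y-eq L) (solve (x₁ ∷ y₁ ∷ l ∷ x₃ ∷ y₃ ∷ i ∷ [])))

    on-ι : ∀ x y → On x y → On (- x) (i * y)
    on-ι x y o = by (- + 1 · o ⊹ y * y · i²) (solve (x ∷ y ∷ m ∷ i ∷ []))

-- The chord-and-tangent formulas as a relation.

module Addition (p : ℕ) .{{_ : NonZero p}} (pr : Prime p) (m : ℤ) where

  open import Defs
  open PrimeField p pr
  open FieldSums p pr using (inverseʳ)
  open Lines p pr m
  open Curve p m hiding (red)
  open import Data.Nat as ℕ using (_<_; _≡ᵇ_)
  import Data.Nat.Properties as ℕₚ
  open import Data.Bool using (Bool; true; false; if_then_else_; _∧_; T)
  open import Data.Integer using (+_; _+_; _-_; -_; _*_)
  open import Data.Integer.Tactic.RingSolver using (solve; solve-∀)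
  open import Data.List using ([]; _∷_)
  open import Data.Product using (_×_; _,_; proj₁; proj₂)
  open import Data.Sum using (_⊎_; inj₁; inj₂; [_,_]′)
  open import Data.Unit using (tt)
  open import Data.Empty using (⊥-elim)
  open import Relation.Nullary using (¬_; yes; no)
  open import Relation.Binary.Definitions using (DecidableEquality)
  open import Relation.Binary.PropositionalEquality as ≡ using (_≡_; refl; cong; cong₂; sym; trans; subst)

  aff-injective : ∀ {x y x′ y′} → aff x y ≡ aff x′ y′ → x ≡ x′ × y ≡ y′
  aff-injective refl = refl , refl

  O≢aff : ∀ {x y} → ¬ (O ≡ aff x y)
  O≢aff ()

  infix 4 _≟ᴾ_
  _≟ᴾ_ : DecidableEquality Pt
  O       ≟ᴾ O         = yes refl
  O       ≟ᴾ aff _ _   = no λ ()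
  aff _ _ ≟ᴾ O         = no λ ()
  aff x y ≟ᴾ aff x′ y′ with x ℕ.≟ x′ | y ℕ.≟ y′
  ... | yes refl | yes refl = yes refl
  ... | no  ne   | _        = no (λ e → ne (proj₁ (aff-injective e)))
  ... | yes _    | no ne    = no (λ e → ne (proj₂ (aff-injective e)))

  record Affine (x y : ℕ) : Set where
    constructor affine
    field
      x<p : x < p
      y<p : y < p
      on  : On (+ x) (+ y)
  open Affine public

  OnCurve⇒Affine : ∀ {x y} → OnCurve (aff x y) → Affine x y
  OnCurve⇒Affine {x} {y} (x<p , y<p , e) = affine x<p y<p (unfold (+ x) (+ y) (red≡0⇒≈0 e))
    where
    unfold : ∀ x y → y * y - (x * x * x - m * x) ≈ + 0 → On x y
    unfold x y h = by (+ 1 · h) (solve (x ∷ y ∷ m ∷ []))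

  Affine⇒OnCurve : ∀ {x y} → Affine x y → OnCurve (aff x y)
  Affine⇒OnCurve {x} {y} (affine x<p y<p o) = x<p , y<p , ≈⇒red≡ 0<p (fold (+ x) (+ y) o)
    where
    fold : ∀ x y → On x y → y * y - (x * x * x - m * x) ≈ + 0
    fold x y h = by (+ 1 · h) (solve (x ∷ y ∷ m ∷ []))

  -- The graph of affine addition, free of Boolean tests and inverses. Since it is functional, an
  -- equation between points is proved by two derivations with the same summands.
  data Sum (x₁ y₁ x₂ y₂ : ℕ) : Pt → Set where
    opposite : Opposite (+ x₁) (+ y₁) (+ x₂) (+ y₂) → Sum x₁ y₁ x₂ y₂ O
    line     : ∀ {l x₃ y₃} → ¬ Opposite (+ x₁) (+ y₁) (+ x₂) (+ y₂) →
               Line (+ x₁) (+ y₁) (+ x₂) (+ y₂) l (+ x₃) (+ y₃) → x₃ < p → y₃ < p →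
               Sum x₁ y₁ x₂ y₂ (aff x₃ y₃)

  Sum-unique : ∀ {x₁ y₁ x₂ y₂ P Q} → Sum x₁ y₁ x₂ y₂ P → Sum x₁ y₁ x₂ y₂ Q → P ≡ Q
  Sum-unique (opposite _) (opposite _)    = refl
  Sum-unique (opposite o) (line n _ _ _)  = ⊥-elim (n o)
  Sum-unique (line n _ _ _) (opposite o)  = ⊥-elim (n o)
  Sum-unique {x₁} {y₁} {x₂} (line {l} {x₃} {y₃} n L x₃< y₃<) (line {l′} {x₃′} {y₃′} _ L′ x₃′< y₃′<) =
    cong₂ aff (abs<p x₃< x₃′< x≈) (abs<p y₃< y₃′< y≈)
    where
    l≈ : l ≈ l′
    l≈ = [ (λ z → z) , (λ o → ⊥-elim (n o)) ]′ (slope-unique (slope L) (slope L′))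
    x≈ : + x₃ ≈ + x₃′
    x≈ = ≈-trans (x-eq L) (≈-trans (∸-cong (∸-cong (*-cong l≈ l≈) (≈-refl {+ x₁})) (≈-refl {+ x₂})) (≈-sym (x-eq L′)))
    y≈ : + y₃ ≈ + y₃′
    y≈ = ≈-trans (y-eq L) (≈-trans (∸-cong (*-cong l≈ (∸-cong (≈-refl {+ x₁}) x≈)) (≈-refl {+ y₁})) (≈-sym (y-eq L′)))

  same-abscissa : ∀ x y x′ y′ → On x y → On x′ y′ → x ≈ x′ → y ≈ y′ ⊎ y + y′ ≈ + 0
  same-abscissa x y x′ y′ o o′ h = [ (λ z → inj₁ (equal z)) , inj₂ ]′ (domain (y - y′) (y + y′) factored)
    where
    factored : (y - y′) * (y + y′) ≈ + 0
    factored = by (+ 1 · o ⊹ - + 1 · o′ ⊹ x * x + x * x′ + x′ * x′ - m · h) (solve (x ∷ y ∷ x′ ∷ y′ ∷ m ∷ []))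
    equal : y - y′ ≈ + 0 → y ≈ y′
    equal z = by (+ 1 · z) (solve (y ∷ y′ ∷ []))

  ≡ᵇ-false : ∀ {a b} → (a ≡ᵇ b) ≡ false → ¬ (a ≡ b)
  ≡ᵇ-false {a} {b} e h = subst T e (ℕₚ.≡⇒≡ᵇ a b h)

  ≡ᵇ-true : ∀ {a b} → (a ≡ᵇ b) ≡ true → a ≡ b
  ≡ᵇ-true {a} {b} e = ℕₚ.≡ᵇ⇒≡ a b (subst T (sym e) tt)

  module _ (2≉0 : + 2 ≉ + 0) where

    -- Here the tests and inverses in the definition of `_⊕_` are resolved. Equal abscissae with
    -- `y₁ + y₂ ≉ 0` mean equal points with `2 y ≉ 0`, so the tangent quotient makes sense.
    ⊕-Sum : ∀ {x₁ y₁ x₂ y₂} → Affine x₁ y₁ → Affine x₂ y₂ → Sum x₁ y₁ x₂ y₂ (aff x₁ y₁ ⊕ aff x₂ y₂)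
    ⊕-Sum {x₁} {y₁} {x₂} {y₂} A₁ A₂ = go (x₁ ≡ᵇ x₂) (red (+ y₁ + + y₂) ≡ᵇ 0) refl refl
      where
      -- These repeat the local definitions of `_⊕_` with the test on abscissae as an argument, so
      -- that `go` can split on it and the result still matches by computation.
      l : Bool → ℕ
      l b = if b
            then red ((+ 3 * (+ x₁) * (+ x₁) - m) * (+ inv (red (+ 2 * + y₁))))
            else red ((+ y₂ - + y₁) * (+ inv (red (+ x₂ - + x₁))))

      x₃ y₃ : Bool → ℕ
      x₃ b = red ((+ l b) * (+ l b) - + x₁ - + x₂)
      y₃ b = red ((+ l b) * (+ x₁ - + x₃ b) - + y₁)

      inv-red : ∀ z → z ≉ + 0 → z * + inv (red z) ≈ + 1
      inv-red z nz = ≈-trans (*-cong (≈-sym (red≈ z)) (red≈ _)) (inverseʳ (λ h → nz (≈-trans (≈-sym (red≈ z)) h)))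

      solves : ∀ a b c d → d ≈ b * c → a * c ≈ + 1 → a * d ≈ b
      solves a b c d h k = by (a · h ⊹ b · k) (solve (a ∷ b ∷ c ∷ d ∷ []))

      conclude : ∀ b → ¬ Opposite (+ x₁) (+ y₁) (+ x₂) (+ y₂) → IsSlope (+ x₁) (+ y₁) (+ x₂) (+ y₂) (+ l b) →
                 Sum x₁ y₁ x₂ y₂ (aff (x₃ b) (y₃ b))
      conclude b n s = line n
        (mkLine s (red≈ ((+ l b) * (+ l b) - + x₁ - + x₂)) (red≈ ((+ l b) * (+ x₁ - + x₃ b) - + y₁)))
        (red<p ((+ l b) * (+ l b) - + x₁ - + x₂)) (red<p ((+ l b) * (+ x₁ - + x₃ b) - + y₁))

      go : ∀ b c → (x₁ ≡ᵇ x₂) ≡ b → (red (+ y₁ + + y₂) ≡ᵇ 0) ≡ c →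
           Sum x₁ y₁ x₂ y₂ (if b ∧ c then O else aff (x₃ b) (y₃ b))
      go true true e₁ e₂ = opposite (≈-reflexive (cong +_ (≡ᵇ-true e₁)) , red≡0⇒≈0 (≡ᵇ-true e₂))
      go true false e₁ e₂ = conclude true (λ o → nz (proj₂ o)) s
        where
        nz : + y₁ + + y₂ ≉ + 0
        nz z = ≡ᵇ-false e₂ (≈⇒red≡ 0<p z)
        x≡ : x₁ ≡ x₂
        x≡ = ≡ᵇ-true e₁
        y≡ : y₁ ≡ y₂
        y≡ = [ abs<p (y<p A₁) (y<p A₂) , (λ z → ⊥-elim (nz z)) ]′
               (same-abscissa (+ x₁) (+ y₁) (+ x₂) (+ y₂) (on A₁) (on A₂) (≈-reflexive (cong +_ x≡)))
        2y≉0 : + 2 * + y₁ ≉ + 0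
        2y≉0 z = nz (≈-trans (≈-reflexive (trans (cong (λ y → + y₁ + + y) (sym y≡)) (double (+ y₁)))) z)
          where
          double : ∀ y → y + y ≡ + 2 * y
          double = solve-∀
        s : IsSlope (+ x₁) (+ y₁) (+ x₂) (+ y₂) (+ l true)
        s = ≡.subst₂ (λ x y → IsSlope (+ x₁) (+ y₁) (+ x) (+ y) (+ l true)) x≡ y≡
              (tangent-slope {+ x₁} {+ y₁} (solves (+ 2 * + y₁) (+ 3 * + x₁ * + x₁ - m) (+ inv (red (+ 2 * + y₁))) (+ l true)
                (red≈ _) (inv-red (+ 2 * + y₁) 2y≉0)))
      go false c e₁ e₂ = conclude false (λ o → x≢ (abs<p (x<p A₁) (x<p A₂) (proj₁ o))) s
        where
        x≢ : ¬ (x₁ ≡ x₂)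
        x≢ = ≡ᵇ-false e₁
        x≉ : + x₂ - + x₁ ≉ + 0
        x≉ z = x≢ (abs<p (x<p A₁) (x<p A₂) (equal (+ x₁) (+ x₂) z))
          where
          equal : ∀ a b → b - a ≈ + 0 → a ≈ b
          equal a b z = by (- + 1 · z) (solve (a ∷ b ∷ []))
        s : IsSlope (+ x₁) (+ y₁) (+ x₂) (+ y₂) (+ l false)
        s = chord-slope (on A₁) (on A₂) x≉
              (solves (+ x₂ - + x₁) (+ y₂ - + y₁) (+ inv (red (+ x₂ - + x₁))) (+ l false)
                (red≈ _) (inv-red (+ x₂ - + x₁) x≉))

-- The group axioms and complex multiplication by `ι`.

module GroupLaws (p : ℕ) .{{_ : NonZero p}} (pr : Prime p) (m : ℤ) where

  open import Defs
  open PrimeField p pr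
  open Lines p pr m
  open Addition p pr m
  open Curve p m hiding (red)
  open import Data.Integer using (+_; _+_; _-_; -_; _*_)
  import Data.Integer.Properties as ℤₚ
  open import Data.Integer.Tactic.RingSolver using (solve)
  open import Data.List using ([]; _∷_)
  open import Data.Product using (_,_; proj₁; proj₂)
  open import Data.Sum using ([_,_]′)
  open import Data.Unit using (tt)
  open import Data.Empty using (⊥-elim)
  open import Relation.Nullary using (¬_; Dec; yes; no)
  open import Relation.Binary.PropositionalEquality as ≡ using (_≡_; refl; cong; cong₂; sym; trans)

  module GroupLaw (2≉0 : + 2 ≉ + 0) (m≉0 : m ≉ + 0) (i : ℤ) (i² : i * i ≈ - + 1) where

    open Nonsingular 2≉0 m≉0
    open ComplexMultiplication i i²

    neg : Pt → Pt
    neg O         = O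
    neg (aff x y) = aff x (red (- + y))

    ι : Pt → Pt
    ι O         = O
    ι (aff x y) = aff (red (- + x)) (red (i * + y))

    affine-neg : ∀ {x y} → Affine x y → Affine x (red (- + y))
    affine-neg {x} {y} (affine x<p _ o) = affine x<p (red<p (- + y)) (reflect (+ x) (+ y) o (red≈ (- + y)))
      where
      reflect : ∀ x y {y′} → On x y → y′ ≈ - y → On x y′
      reflect x y {y′} o h = by (+ 1 · o ⊹ y′ - y · h) (solve (x ∷ y ∷ y′ ∷ m ∷ []))

    on-cong : ∀ x y {x′ y′} → x′ ≈ x → y′ ≈ y → On x y → On x′ y′
    on-cong x y h k o = ≈-trans (*-cong k k)
      (≈-trans o (≈-sym (∸-cong (*-cong (*-cong h h) h) (*-cong (≈-refl {m}) h))))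

    affine-ι : ∀ {x y} → Affine x y → Affine (red (- + x)) (red (i * + y))
    affine-ι {x} {y} (affine _ _ o) = affine (red<p (- + x)) (red<p (i * + y))
      (on-cong (- + x) (i * + y) (red≈ (- + x)) (red≈ (i * + y)) (on-ι (+ x) (+ y) o))

    neg-on : ∀ P → OnCurve P → OnCurve (neg P)
    neg-on O         c = tt
    neg-on (aff x y) c = Affine⇒OnCurve (affine-neg (OnCurve⇒Affine c))

    ι-on : ∀ P → OnCurve P → OnCurve (ι P)
    ι-on O         c = tt
    ι-on (aff x y) c = Affine⇒OnCurve (affine-ι (OnCurve⇒Affine c))

    neg-neg : ∀ P → OnCurve P → neg (neg P) ≡ P
    neg-neg O         c = refl
    neg-neg (aff x y) c = cong (aff x) (≈⇒red≡ (y<p (OnCurve⇒Affine c))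
      (≈-trans (neg-cong (red≈ (- + y))) (≈-reflexive (ℤₚ.neg-involutive (+ y)))))

    ι-ι : ∀ P → OnCurve P → ι (ι P) ≡ neg P
    ι-ι O         c = refl
    ι-ι (aff x y) c = cong₂ aff
      (≈⇒red≡ (x<p (OnCurve⇒Affine c)) (≈-trans (neg-cong (red≈ (- + x))) (≈-reflexive (ℤₚ.neg-involutive (+ x)))))
      (red-cong (square (+ y) (red≈ (i * + y))))
      where
      square : ∀ y {z} → z ≈ i * y → i * z ≈ - y
      square y {z} h = by (i · h ⊹ y · i²) (solve (y ∷ z ∷ i ∷ []))

    opposite⇒neg : ∀ {x₁ y₁ x₂ y₂} → Affine x₁ y₁ → Affine x₂ y₂ → Opposite (+ x₁) (+ y₁) (+ x₂) (+ y₂) →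
                   aff x₂ y₂ ≡ neg (aff x₁ y₁)
    opposite⇒neg {x₁} {y₁} {x₂} {y₂} A₁ A₂ (h , k) =
      cong₂ aff (abs<p (x<p A₂) (x<p A₁) (≈-sym h)) (sym (≈⇒red≡ (y<p A₂) (solve-y (+ y₁) (+ y₂) k)))
      where
      solve-y : ∀ y₁ y₂ → y₁ + y₂ ≈ + 0 → - y₁ ≈ y₂
      solve-y y₁ y₂ k = by (- + 1 · k) (solve (y₁ ∷ y₂ ∷ []))

    sum : ∀ {x₁ y₁ x₂ y₂} → Affine x₁ y₁ → Affine x₂ y₂ → Sum x₁ y₁ x₂ y₂ (aff x₁ y₁ ⊕ aff x₂ y₂)
    sum = ⊕-Sum 2≉0

    ⊕-identityʳ : ∀ P → P ⊕ O ≡ P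
    ⊕-identityʳ O         = refl
    ⊕-identityʳ (aff x y) = refl

    ⊕-on : ∀ P Q → OnCurve P → OnCurve Q → OnCurve (P ⊕ Q)
    ⊕-on O           Q           a b = b
    ⊕-on (aff x₁ y₁) O           a b = a
    ⊕-on (aff x₁ y₁) (aff x₂ y₂) a b = go (sum A (OnCurve⇒Affine b))
      where
      A = OnCurve⇒Affine a
      go : ∀ {R} → Sum x₁ y₁ x₂ y₂ R → OnCurve R
      go (opposite _)      = tt
      go (line n L x< y<) = Affine⇒OnCurve (affine x< y< (line-on (on A) L))

    Sum-sym : ∀ {x₁ y₁ x₂ y₂ R} → Sum x₁ y₁ x₂ y₂ R → Sum x₂ y₂ x₁ y₁ R
    Sum-sym {x₁} {y₁} {x₂} {y₂} = go
      where
      swap : Opposite (+ x₁) (+ y₁) (+ x₂) (+ y₂) → Opposite (+ x₂) (+ y₂) (+ x₁) (+ y₁)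
      swap (h , k) = ≈-sym h , ≈-trans (≈-reflexive (ℤₚ.+-comm (+ y₂) (+ y₁))) k
      swap′ : Opposite (+ x₂) (+ y₂) (+ x₁) (+ y₁) → Opposite (+ x₁) (+ y₁) (+ x₂) (+ y₂)
      swap′ (h , k) = ≈-sym h , ≈-trans (≈-reflexive (ℤₚ.+-comm (+ y₁) (+ y₂))) k
      go : ∀ {R} → Sum x₁ y₁ x₂ y₂ R → Sum x₂ y₂ x₁ y₁ R
      go (opposite o)     = opposite (swap o)
      go (line n L x< y<) = line (λ o → n (swap′ o)) (line-sym L) x< y<

    ⊕-comm : ∀ P Q → OnCurve P → OnCurve Q → P ⊕ Q ≡ Q ⊕ P
    ⊕-comm O           Q           a b = sym (⊕-identityʳ Q)
    ⊕-comm (aff x₁ y₁) O           a b = refl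
    ⊕-comm (aff x₁ y₁) (aff x₂ y₂) a b =
      Sum-unique (Sum-sym (sum A B)) (sum B A) 
      where
      A = OnCurve⇒Affine a
      B = OnCurve⇒Affine b

    ⊕-inverseʳ : ∀ P → OnCurve P → P ⊕ neg P ≡ O
    ⊕-inverseʳ O         a = refl
    ⊕-inverseʳ (aff x y) a = Sum-unique (sum A (affine-neg A)) (opposite (≈-refl , cancel (+ y) (red≈ (- + y))))
      where
      A = OnCurve⇒Affine a
      cancel : ∀ y {z} → z ≈ - y → y + z ≈ + 0
      cancel y {z} h = by (+ 1 · h) (solve (y ∷ z ∷ []))

    ⊕-inverseˡ : ∀ P → OnCurve P → neg P ⊕ P ≡ O
    ⊕-inverseˡ P a = trans (⊕-comm (neg P) P (neg-on P a) a) (⊕-inverseʳ P a)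

    -- By `line-ι` the line of a sum is carried to the line of the images; being opposite is
    -- preserved in both directions because `i` is a unit.
    ι-⊕ : ∀ P Q → OnCurve P → OnCurve Q → ι (P ⊕ Q) ≡ ι P ⊕ ι Q
    ι-⊕ O           Q           a b = refl
    ι-⊕ (aff x₁ y₁) O           a b = refl
    ι-⊕ (aff x₁ y₁) (aff x₂ y₂) a b = Sum-unique (go (sum A B)) (sum (affine-ι A) (affine-ι B))
      where
      A = OnCurve⇒Affine a
      B = OnCurve⇒Affine b
      x₁′ = red (- + x₁)
      y₁′ = red (i * + y₁)
      x₂′ = red (- + x₂)
      y₂′ = red (i * + y₂)

      i≉0 : i ≉ + 0
      i≉0 = √-1≉0 i i²

      reflect-x : ∀ x x′ → - x ≈ - x′ → x ≈ x′
      reflect-x x x′ h = by (- + 1 · h) (solve (x ∷ x′ ∷ []))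

      scale-y : ∀ y y′ z z′ → z ≈ i * y → z′ ≈ i * y′ → z + z′ ≈ i * (y + y′)
      scale-y y y′ z z′ h k = by (+ 1 · h ⊹ + 1 · k) (solve (y ∷ y′ ∷ z ∷ z′ ∷ i ∷ []))

      y-sum : + y₁′ + + y₂′ ≈ i * (+ y₁ + + y₂)
      y-sum = scale-y (+ y₁) (+ y₂) (+ y₁′) (+ y₂′) (red≈ (i * + y₁)) (red≈ (i * + y₂))

      map-opposite : Opposite (+ x₁) (+ y₁) (+ x₂) (+ y₂) → Opposite (+ x₁′) (+ y₁′) (+ x₂′) (+ y₂′)
      map-opposite (h , k) =
        ≈-trans (red≈ (- + x₁)) (≈-trans (neg-cong h) (≈-sym (red≈ (- + x₂)))) ,
        ≈-trans y-sum (≈-trans (*-cong (≈-refl {i}) k) (≈-reflexive (ℤₚ.*-zeroʳ i)))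

      unmap-opposite : Opposite (+ x₁′) (+ y₁′) (+ x₂′) (+ y₂′) → Opposite (+ x₁) (+ y₁) (+ x₂) (+ y₂)
      unmap-opposite (h , k) =
        reflect-x (+ x₁) (+ x₂) (≈-trans (≈-sym (red≈ (- + x₁))) (≈-trans h (red≈ (- + x₂)))) ,
        [ (λ z → ⊥-elim (i≉0 z)) , (λ z → z) ]′ (domain i (+ y₁ + + y₂) (≈-trans (≈-sym y-sum) k))

      go : ∀ {R} → Sum x₁ y₁ x₂ y₂ R → Sum x₁′ y₁′ x₂′ y₂′ (ι R)
      go (opposite o) = opposite (map-opposite o)
      go (line {l} {x₃} {y₃} n L x< y<) = line (λ o → n (unmap-opposite o))
        (line-cong (≈-sym (red≈ (- + x₁))) (≈-sym (red≈ (i * + y₁))) (≈-sym (red≈ (- + x₂))) (≈-sym (red≈ (i * + y₂)))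
                   (≈-refl {(- i) * l}) (≈-sym (red≈ (- + x₃))) (≈-sym (red≈ (i * + y₃))) (line-ι L))
        (red<p (- + x₃)) (red<p (i * + y₃))

    -- Negation is `ι` applied twice, so additivity is inherited without another case analysis.
    neg-⊕ : ∀ P Q → OnCurve P → OnCurve Q → neg (P ⊕ Q) ≡ neg P ⊕ neg Q
    neg-⊕ P Q a b = begin
      neg (P ⊕ Q)            ≡⟨ ι-ι (P ⊕ Q) (⊕-on P Q a b) ⟨
      ι (ι (P ⊕ Q))          ≡⟨ cong ι (ι-⊕ P Q a b) ⟩
      ι (ι P ⊕ ι Q)          ≡⟨ ι-⊕ (ι P) (ι Q) (ι-on P a) (ι-on Q b) ⟩
      ι (ι P) ⊕ ι (ι Q)      ≡⟨ cong₂ _⊕_ (ι-ι P a) (ι-ι Q b) ⟩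
      neg P ⊕ neg Q          ∎
      where open ≡.≡-Reasoning

    -- This fragment of associativity has a direct proof by reflecting the line, and it is the tool
    -- for the degenerate cases of the full law.
    ⊕-cancelʳ : ∀ P Q → OnCurve P → OnCurve Q → (P ⊕ Q) ⊕ neg Q ≡ P
    ⊕-cancelʳ O           Q           a b = ⊕-inverseʳ Q b
    ⊕-cancelʳ (aff x₁ y₁) O           a b = refl
    ⊕-cancelʳ (aff x₁ y₁) (aff x₂ y₂) a b = go (sum A B) refl
      where
      A = OnCurve⇒Affine a
      B = OnCurve⇒Affine b
      y₂′ = red (- + y₂)
      go : ∀ {R} → Sum x₁ y₁ x₂ y₂ R → aff x₁ y₁ ⊕ aff x₂ y₂ ≡ R → R ⊕ neg (aff x₂ y₂) ≡ aff x₁ y₁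
      go (opposite o) _ = trans (cong neg (opposite⇒neg A B o)) (neg-neg (aff x₁ y₁) a)
      go (line {l} {x₃} {y₃} n L x< y<) e = Sum-unique (sum C (affine-neg B))
        (line ¬opp (line-cong ≈-refl ≈-refl ≈-refl (≈-sym (red≈ (- + y₂))) ≈-refl ≈-refl ≈-refl (line-cancel L))
          (x<p A) (y<p A))
        where
        C : Affine x₃ y₃
        C = affine x< y< (line-on (on A) L)
        shift : ∀ y₃ y₂ z → z ≈ - y₂ → y₃ + z ≈ + 0 → y₃ - y₂ ≈ + 0
        shift y₃ y₂ z h k = by (+ 1 · k ⊹ - + 1 · h) (solve (y₃ ∷ y₂ ∷ z ∷ []))
        ¬opp : ¬ Opposite (+ x₃) (+ y₃) (+ x₂) (+ y₂′)
        ¬opp (h , k) = line-cancel-¬opposite (on B) L h (shift (+ y₃) (+ y₂) (+ y₂′) (red≈ (- + y₂)) k)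

    record AffineSum (x₁ y₁ x₂ y₂ : ℕ) : Set where
      constructor affineSum
      field
        {l}     : ℤ
        {x₃ y₃} : ℕ
        value   : aff x₁ y₁ ⊕ aff x₂ y₂ ≡ aff x₃ y₃
        through : Line (+ x₁) (+ y₁) (+ x₂) (+ y₂) l (+ x₃) (+ y₃)
        result  : Affine x₃ y₃

    affine-sum : ∀ {x₁ y₁ x₂ y₂} → Affine x₁ y₁ → Affine x₂ y₂ → ¬ (aff x₂ y₂ ≡ neg (aff x₁ y₁)) →
                 AffineSum x₁ y₁ x₂ y₂
    affine-sum {x₁} {y₁} {x₂} {y₂} A B n = go (sum A B) refl
      where
      go : ∀ {R} → Sum x₁ y₁ x₂ y₂ R → aff x₁ y₁ ⊕ aff x₂ y₂ ≡ R → AffineSum x₁ y₁ x₂ y₂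
      go (opposite o) e     = ⊥-elim (n (opposite⇒neg A B o))
      go (line _ L x< y<) e = affineSum e L (affine x< y< (line-on (on A) L))

    distinct-abscissae : ∀ {x₁ y₁ x₂ y₂} → Affine x₁ y₁ → Affine x₂ y₂ → ¬ (aff x₂ y₂ ≡ aff x₁ y₁) →
                         ¬ (aff x₂ y₂ ≡ neg (aff x₁ y₁)) → + x₂ - + x₁ ≉ + 0
    distinct-abscissae {x₁} {y₁} {x₂} {y₂} A B n n′ z =
      [ (λ h → n (cong₂ aff x≡ (sym (abs<p (y<p A) (y<p B) h))))
      , (λ h → n′ (opposite⇒neg A B (≈-reflexive (cong +_ (sym x≡)) , h))) ]′
      (same-abscissa (+ x₁) (+ y₁) (+ x₂) (+ y₂) (on A) (on B) (≈-reflexive (cong +_ (sym x≡))))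
      where
      equal : ∀ a b → b - a ≈ + 0 → b ≈ a
      equal a b z = by (+ 1 · z) (solve (a ∷ b ∷ []))
      x≡ : x₂ ≡ x₁
      x≡ = abs<p (x<p B) (x<p A) (equal (+ x₁) (+ x₂) z)

    neg-swap : ∀ P Q → OnCurve Q → P ≡ neg Q → Q ≡ neg P
    neg-swap P Q b e = trans (sym (neg-neg Q b)) (cong neg (sym e))

    ⊕-assoc-generic : ∀ {x₁ y₁ x₂ y₂ x₄ y₄} → Affine x₁ y₁ → Affine x₂ y₂ → Affine x₄ y₄ →
      let P = aff x₁ y₁ ; Q = aff x₂ y₂ ; R = aff x₄ y₄ in
      ¬ (Q ≡ neg P) → ¬ (R ≡ neg Q) → ¬ (R ≡ neg P) → ¬ (R ≡ neg (P ⊕ Q)) → ¬ (P ≡ neg (Q ⊕ R)) →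
      ¬ (R ≡ P) → ¬ (R ≡ Q) → (P ⊕ Q) ⊕ R ≡ P ⊕ (Q ⊕ R)
    ⊕-assoc-generic {x₁} {y₁} {x₂} {y₂} {x₄} {y₄} A B C q≢-p r≢-q r≢-p r≢-pq p≢-qr r≢p r≢q =
      go₁ (affine-sum A B q≢-p) (affine-sum B C r≢-q)
      where
      P = aff x₁ y₁
      Q = aff x₂ y₂
      R = aff x₄ y₄
      a = Affine⇒OnCurve A
      b = Affine⇒OnCurve B
      c = Affine⇒OnCurve C

      -- Cancelling `Q` would leave `R = O`. This is one half of the difference of abscissae that
      -- `key-double` asks for.
      qr≢p : P ≡ Q → ¬ (Q ⊕ R ≡ P)
      qr≢p e f = O≢aff (begin
        O                   ≡⟨ ⊕-inverseʳ P a ⟨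
        P ⊕ neg P           ≡⟨ cong (_⊕ neg P) f ⟨
        (Q ⊕ R) ⊕ neg P     ≡⟨ cong (_⊕ neg P) (⊕-comm Q R b c) ⟩
        (R ⊕ Q) ⊕ neg P     ≡⟨ cong (λ X → (R ⊕ Q) ⊕ neg X) e ⟩
        (R ⊕ Q) ⊕ neg Q     ≡⟨ ⊕-cancelʳ R Q c b ⟩
        R                   ∎)
        where open ≡.≡-Reasoning

      go₁ : AffineSum x₁ y₁ x₂ y₂ → AffineSum x₂ y₂ x₄ y₄ → (P ⊕ Q) ⊕ R ≡ P ⊕ (Q ⊕ R)
      go₁ (affineSum {l} {x₃} {y₃} s L S) (affineSum {l′} {x₃′} {y₃′} t L′ T) =
        go₂ (affine-sum S C (λ e → r≢-pq (trans e (cong neg (sym s)))))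
            (affine-sum T A (λ e → p≢-qr (trans e (cong neg (sym t)))))
        where
        go₂ : AffineSum x₃ y₃ x₄ y₄ → AffineSum x₃′ y₃′ x₁ y₁ → (P ⊕ Q) ⊕ R ≡ P ⊕ (Q ⊕ R)
        go₂ (affineSum {k} {x₅} {y₅} u K U) (affineSum {k′} {x₅′} {y₅′} v K′ V) = begin
          (P ⊕ Q) ⊕ R          ≡⟨ cong (_⊕ R) s ⟩
          aff x₃ y₃ ⊕ R        ≡⟨ u ⟩
          aff x₅ y₅            ≡⟨ cong₂ aff (abs<p (x<p U) (x<p V) (𝔸.x₅≈x₅′ key)) (abs<p (y<p U) (y<p V) (𝔸.y₅≈y₅′ key)) ⟩
          aff x₅′ y₅′          ≡⟨ v ⟨
          aff x₃′ y₃′ ⊕ P      ≡⟨ ⊕-comm (aff x₃′ y₃′) P (Affine⇒OnCurve T) a ⟩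
          P ⊕ aff x₃′ y₃′      ≡⟨ cong (P ⊕_) t ⟨
          P ⊕ (Q ⊕ R)          ∎
          where
          open ≡.≡-Reasoning
          module 𝔸 = Associativity L K L′ K′ (distinct-abscissae A C r≢p r≢-p) (distinct-abscissae B C r≢q r≢-q)

          key : 𝔸.Key
          key = case (P ≟ᴾ Q)
            where
            case : Dec (P ≡ Q) → 𝔸.Key
            case (yes e) = 𝔸.key-double (≈-reflexive (cong +_ (proj₁ (aff-injective e))))
              (≈-reflexive (cong +_ (proj₂ (aff-injective e))))
              (distinct-abscissae A T (λ f → qr≢p e (trans t f))
                (λ f → p≢-qr (trans (neg-swap (aff x₃′ y₃′) P a f) (cong neg (sym t)))))
            case (no n)  = 𝔸.key-distinct (distinct-abscissae B A n (λ e → q≢-p (neg-swap P Q b e)))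

    -- When a sum degenerates to `O`, cancellation and commutativity suffice; `R = P` needs
    -- commutativity alone. All else is generic, possibly after reversing the triple.
    ⊕-assoc : ∀ P Q R → OnCurve P → OnCurve Q → OnCurve R → (P ⊕ Q) ⊕ R ≡ P ⊕ (Q ⊕ R)
    ⊕-assoc O           Q           R           a b c = refl
    ⊕-assoc (aff x₁ y₁) O           R           a b c = refl
    ⊕-assoc (aff x₁ y₁) (aff x₂ y₂) O           a b c = ⊕-identityʳ (aff x₁ y₁ ⊕ aff x₂ y₂)
    ⊕-assoc (aff x₁ y₁) (aff x₂ y₂) (aff x₄ y₄) a b c =
      go (Q ≟ᴾ neg P) (R ≟ᴾ neg Q) (R ≟ᴾ neg P) (R ≟ᴾ neg (P ⊕ Q)) (P ≟ᴾ neg (Q ⊕ R)) (R ≟ᴾ P) (R ≟ᴾ Q)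
      where
      open ≡.≡-Reasoning
      P = aff x₁ y₁
      Q = aff x₂ y₂
      R = aff x₄ y₄
      A = OnCurve⇒Affine a
      B = OnCurve⇒Affine b
      C = OnCurve⇒Affine c

      cancel-neg : ∀ X Y Z → OnCurve X → OnCurve Y → OnCurve Z → Y ≡ neg Z → (X ⊕ Y) ⊕ Z ≡ X
      cancel-neg X Y Z x y z e = trans (cong ((X ⊕ Y) ⊕_) (neg-swap Y Z z e)) (⊕-cancelʳ X Y x y)

      neg-sum : ∀ X Y Z → OnCurve X → OnCurve Y → OnCurve Z → Z ≡ neg (X ⊕ Y) → Y ⊕ Z ≡ neg X
      neg-sum X Y Z x y z e = begin
        Y ⊕ Z                          ≡⟨ ⊕-comm Y Z y z ⟩
        Z ⊕ Y                          ≡⟨ cong₂ _⊕_ e (sym (neg-neg Y y)) ⟩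
        neg (X ⊕ Y) ⊕ neg (neg Y)      ≡⟨ neg-⊕ (X ⊕ Y) (neg Y) (⊕-on X Y x y) (neg-on Y y) ⟨
        neg ((X ⊕ Y) ⊕ neg Y)          ≡⟨ cong neg (⊕-cancelʳ X Y x y) ⟩
        neg X                          ∎

      reverse : ∀ X Y Z → OnCurve X → OnCurve Y → OnCurve Z → (Z ⊕ Y) ⊕ X ≡ Z ⊕ (Y ⊕ X) → (X ⊕ Y) ⊕ Z ≡ X ⊕ (Y ⊕ Z)
      reverse X Y Z x y z e = begin
        (X ⊕ Y) ⊕ Z      ≡⟨ ⊕-comm (X ⊕ Y) Z (⊕-on X Y x y) z ⟩
        Z ⊕ (X ⊕ Y)      ≡⟨ cong (Z ⊕_) (⊕-comm X Y x y) ⟩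
        Z ⊕ (Y ⊕ X)      ≡⟨ e ⟨
        (Z ⊕ Y) ⊕ X      ≡⟨ ⊕-comm (Z ⊕ Y) X (⊕-on Z Y z y) x ⟩
        X ⊕ (Z ⊕ Y)      ≡⟨ cong (X ⊕_) (⊕-comm Z Y z y) ⟩
        X ⊕ (Y ⊕ Z)      ∎

      first-opposite : ∀ X Y Z → OnCurve X → OnCurve Y → OnCurve Z → Y ≡ neg X → (X ⊕ Y) ⊕ Z ≡ X ⊕ (Y ⊕ Z)
      first-opposite X Y Z x y z e = begin
        (X ⊕ Y) ⊕ Z      ≡⟨ cong (λ W → (X ⊕ W) ⊕ Z) e ⟩
        (X ⊕ neg X) ⊕ Z  ≡⟨ cong (_⊕ Z) (⊕-inverseʳ X x) ⟩
        Z                ≡⟨ cancel-neg Z Y X z y x e ⟨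
        (Z ⊕ Y) ⊕ X      ≡⟨ ⊕-comm (Z ⊕ Y) X (⊕-on Z Y z y) x ⟩
        X ⊕ (Z ⊕ Y)      ≡⟨ cong (X ⊕_) (⊕-comm Z Y z y) ⟩
        X ⊕ (Y ⊕ Z)      ∎

      outer-opposite : R ≡ neg P → (P ⊕ Q) ⊕ R ≡ P ⊕ (Q ⊕ R)
      outer-opposite e = begin
        (P ⊕ Q) ⊕ R      ≡⟨ cong₂ _⊕_ (⊕-comm P Q a b) e ⟩
        (Q ⊕ P) ⊕ neg P  ≡⟨ ⊕-cancelʳ Q P b a ⟩
        Q                ≡⟨ cancel-neg Q R P b c a e ⟨
        (Q ⊕ R) ⊕ P      ≡⟨ ⊕-comm (Q ⊕ R) P (⊕-on Q R b c) a ⟩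
        P ⊕ (Q ⊕ R)      ∎

      sum-opposite : ∀ X Y Z → OnCurve X → OnCurve Y → OnCurve Z → Z ≡ neg (X ⊕ Y) → (X ⊕ Y) ⊕ Z ≡ X ⊕ (Y ⊕ Z)
      sum-opposite X Y Z x y z e = begin
        (X ⊕ Y) ⊕ Z              ≡⟨ cong ((X ⊕ Y) ⊕_) e ⟩
        (X ⊕ Y) ⊕ neg (X ⊕ Y)    ≡⟨ ⊕-inverseʳ (X ⊕ Y) (⊕-on X Y x y) ⟩
        O                        ≡⟨ ⊕-inverseʳ X x ⟨
        X ⊕ neg X                ≡⟨ cong (X ⊕_) (neg-sum X Y Z x y z e) ⟨
        X ⊕ (Y ⊕ Z)              ∎

      palindrome : ∀ X Y → OnCurve X → OnCurve Y → (X ⊕ Y) ⊕ X ≡ X ⊕ (Y ⊕ X)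
      palindrome X Y x y = trans (⊕-comm (X ⊕ Y) X (⊕-on X Y x y) x) (cong (X ⊕_) (⊕-comm X Y x y))

      go : Dec (Q ≡ neg P) → Dec (R ≡ neg Q) → Dec (R ≡ neg P) → Dec (R ≡ neg (P ⊕ Q)) → Dec (P ≡ neg (Q ⊕ R)) →
           Dec (R ≡ P) → Dec (R ≡ Q) → (P ⊕ Q) ⊕ R ≡ P ⊕ (Q ⊕ R)
      go (yes e) _ _ _ _ _ _ = first-opposite P Q R a b c e
      go (no _) (yes e) _ _ _ _ _ =
        reverse P Q R a b c (first-opposite R Q P c b a (neg-swap R Q b e))
      go (no _) (no _) (yes e) _ _ _ _ = outer-opposite e
      go (no _) (no _) (no _) (yes e) _ _ _ = sum-opposite P Q R a b c e
      go (no _) (no _) (no _) (no _) (yes e) _ _ =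
        reverse P Q R a b c (sum-opposite R Q P c b a (trans e (cong neg (⊕-comm Q R b c))))
      go (no _) (no _) (no _) (no _) (no _) (yes e) _ =
        trans (cong ((P ⊕ Q) ⊕_) e) (trans (palindrome P Q a b) (cong (λ X → P ⊕ (Q ⊕ X)) (sym e)))
      go (no n₁) (no n₂) (no n₃) (no n₄) (no n₅) (no n₆) (no n₇) =
        ⊕-assoc-generic A B C n₁ n₂ n₃ n₄ n₅ n₆ n₇
      -- For `R = Q` the reversed triple `R`, `Q`, `P` has its repeated point in the first two
      -- places, where the generic case allows it.
      go (no n₁) (no n₂) (no n₃) (no n₄) (no n₅) (no n₆) (yes e) =
        reverse P Q R a b c (⊕-assoc-generic C B A
          (λ h → n₂ (neg-swap Q R c h)) (λ h → n₁ (neg-swap P Q b h)) (λ h → n₃ (neg-swap P R c h))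
          (λ h → n₅ (trans h (cong neg (⊕-comm R Q c b))))
          (λ h → n₄ (trans h (cong neg (⊕-comm Q P b a))))
          (λ h → n₆ (sym h)) (λ h → n₆ (trans e (sym h))))

-- Finite modules over the Gaussian integers in which `1 + ι` has a kernel of order two.

module FiniteGroups where

  open FiniteSums
  open import Algebra.Bundles using (CommutativeMonoid; AbelianGroup)
  open import Algebra.Core using (Op₁; Op₂)
  open import Algebra.Structures using (IsAbelianGroup)
  open import Defs using (G; addG)
  open import Data.Nat as ℕ using (ℕ; zero; suc; _≤_; _<_; _∸_; s≤s; NonZero) renaming (_+_ to _+ℕ_; _*_ to _*ℕ_; _^_ to _^ℕ_)
  import Data.Nat.Properties as ℕₚ
  import Data.Nat.DivMod as ℕ
  open import Data.Nat.Divisibility as ∣ using (_∣_; divides)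
  open import Data.Nat.Tactic.RingSolver using (solve-∀)
  open import Data.Integer as ℤ using (+_)
  import Data.Integer.Properties as ℤₚ
  open import Data.Fin using (toℕ)
  import Data.Fin.Properties as Finₚ
  open import Data.List using (List; []; _∷_; map; length; foldr; deduplicate; allFin; cartesianProduct)
  import Data.List.Properties as Listₚ
  open import Data.List.Membership.Propositional using (_∈_)
  open import Data.List.Membership.Propositional.Properties
    using (∈-map⁺; ∈-map⁻; ∈-deduplicate⁺; ∈-deduplicate⁻)
  open import Data.List.Relation.Binary.Permutation.Propositional using (_↭_; ↭⇒↭ₛ)
  import Data.List.Relation.Binary.Permutation.Setoid.Properties as Permutation
  open import Data.List.Relation.Unary.All as All using (All)
  import Data.List.Relation.Unary.AllPairs as AllPairs
  open import Data.List.Relation.Unary.Any using (here; there)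
  open import Data.List.Relation.Unary.Unique.Propositional using (Unique)
  import Data.List.Relation.Unary.Unique.Propositional.Properties as Unique
  import Data.List.Relation.Unary.Unique.DecPropositional.Properties as DecUnique
  open import Data.Product using (_×_; _,_; proj₁; proj₂; ∃; Σ)
  open import Data.Sum using (_⊎_; inj₁; inj₂; [_,_]′)
  open import Data.Empty using (⊥-elim)
  open import Function.Definitions using (Injective)
  open import Level using (0ℓ)
  open import Relation.Nullary using (¬_; Dec; yes; no)
  open import Relation.Binary.Definitions using (DecidableEquality)
  open import Relation.Binary.PropositionalEquality as ≡ using (_≡_; refl; cong; cong₂; sym; trans; subst)

  length-cartesianProduct : ∀ {A B : Set} (xs : List A) (ys : List B) →
                            length (cartesianProduct xs ys) ≡ length xs *ℕ length ys
  length-cartesianProduct []       ys = refl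
  length-cartesianProduct (x ∷ xs) ys = trans (Listₚ.length-++ (map (x ,_) ys))
    (cong₂ _+ℕ_ (Listₚ.length-map (x ,_) ys) (length-cartesianProduct xs ys))

  length-allFin : ∀ n → length (allFin n) ≡ n
  length-allFin n = Listₚ.length-tabulate {n = n} (λ z → z)

  toℕ-mod : ∀ m n .{{_ : NonZero n}} → toℕ (m ℕ.mod n) ≡ m ℕ.% n
  toℕ-mod m n = Finₚ.toℕ-fromℕ< (ℕ.m%n<n m n)

  -- `ι` acts as the imaginary unit, and `T` spans the kernel of multiplication by `1 + ι`. The
  -- curve enters the structural argument only through these axioms.
  module GaussianModule
    {A : Set} {_⊞_ : Op₂ A} {𝟘 : A} {neg : Op₁ A} (isAbelianGroup : IsAbelianGroup _≡_ _⊞_ 𝟘 neg)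
    (_≟_ : DecidableEquality A) (elements : List A) (unique : Unique elements) (complete : ∀ x → x ∈ elements)
    (ι : A → A) (ι-⊞ : ∀ x y → ι (x ⊞ y) ≡ ι x ⊞ ι y) (ι-ι : ∀ x → ι (ι x) ≡ neg x)
    (T : A) (T≢𝟘 : ¬ (T ≡ 𝟘)) (ι-T : ι T ≡ T) (T⊞T : T ⊞ T ≡ 𝟘)
    (kernel : ∀ x → x ⊞ ι x ≡ 𝟘 → x ≡ 𝟘 ⊎ x ≡ T) where

    open ≡.≡-Reasoning

    abelianGroup : AbelianGroup 0ℓ 0ℓ
    abelianGroup = record { isAbelianGroup = isAbelianGroup }

    open AbelianGroup abelianGroup using (assoc; comm; identityˡ; identityʳ; inverseˡ; inverseʳ; commutativeMonoid; monoid; commutativeSemigroup)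
    open import Algebra.Properties.AbelianGroup abelianGroup using (∙-cancelˡ; ∙-cancelʳ; inverseˡ-unique; inverseʳ-unique; identityʳ-unique)
    open import Algebra.Properties.CommutativeSemigroup commutativeSemigroup using (interchange)
    open import Algebra.Properties.Monoid.Mult monoid using (×-homo-+; ×-assocˡ) renaming (_×_ to _·_)
    open import Algebra.Properties.CommutativeMonoid.Mult commutativeMonoid using (×-distrib-+)

    Hom : (A → A) → Set
    Hom f = ∀ x y → f (x ⊞ y) ≡ f x ⊞ f y

    hom-𝟘 : ∀ {f} → Hom f → f 𝟘 ≡ 𝟘
    hom-𝟘 {f} h = identityʳ-unique (f 𝟘) (f 𝟘) (trans (sym (h 𝟘 𝟘)) (cong f (identityˡ 𝟘)))

    hom-· : ∀ {f} → Hom f → ∀ n x → f (n · x) ≡ n · f x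
    hom-· h zero    x = hom-𝟘 h
    hom-· h (suc n) x = trans (h x (n · x)) (cong (_ ⊞_) (hom-· h n x))

    ·-𝟘 : ∀ n → n · 𝟘 ≡ 𝟘
    ·-𝟘 zero    = refl
    ·-𝟘 (suc n) = trans (identityˡ (n · 𝟘)) (·-𝟘 n)

    2· : ∀ x → 2 · x ≡ x ⊞ x
    2· x = cong (x ⊞_) (identityʳ x)

    α : A → A
    α x = x ⊞ ι x

    α-⊞ : Hom α
    α-⊞ x y = trans (cong ((x ⊞ y) ⊞_) (ι-⊞ x y)) (interchange x y (ι x) (ι y))

    α-T : α T ≡ 𝟘
    α-T = trans (cong (T ⊞_) ι-T) T⊞T

    -- The identity `(1 + i)² = 2 i`, which links `α` to multiplication by 2.
    α-α : ∀ x → α (α x) ≡ 2 · ι x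
    α-α x = begin
      (x ⊞ ι x) ⊞ ι (x ⊞ ι x)        ≡⟨ cong ((x ⊞ ι x) ⊞_) (trans (ι-⊞ x (ι x)) (trans (cong (ι x ⊞_) (ι-ι x)) (comm (ι x) (neg x)))) ⟩
      (x ⊞ ι x) ⊞ (neg x ⊞ ι x)        ≡⟨ interchange x (ι x) (neg x) (ι x) ⟩
      (x ⊞ neg x) ⊞ (ι x ⊞ ι x)        ≡⟨ cong (_⊞ (ι x ⊞ ι x)) (inverseʳ x) ⟩
      𝟘 ⊞ (ι x ⊞ ι x)                ≡⟨ identityˡ (ι x ⊞ ι x) ⟩
      ι x ⊞ ι x                      ≡⟨ 2· (ι x) ⟨
      2 · ι x                        ∎

    α-injective : ∀ {x y} → α x ≡ α y → x ≡ y ⊎ x ≡ y ⊞ T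
    α-injective {x} {y} e = [ (λ h → inj₁ (trans recover (trans (cong (y ⊞_) h) (identityʳ y))))
                            , (λ h → inj₂ (trans recover (cong (y ⊞_) h))) ]′ (kernel (neg y ⊞ x) d≡𝟘)
      where
      recover : x ≡ y ⊞ (neg y ⊞ x)
      recover = sym (trans (sym (assoc y (neg y) x)) (trans (cong (_⊞ x) (inverseʳ y)) (identityˡ x)))
      d≡𝟘 : α (neg y ⊞ x) ≡ 𝟘
      d≡𝟘 = begin
        α (neg y ⊞ x)        ≡⟨ α-⊞ (neg y) x ⟩
        α (neg y) ⊞ α x      ≡⟨ cong (α (neg y) ⊞_) e ⟩
        α (neg y) ⊞ α y      ≡⟨ α-⊞ (neg y) y ⟨
        α (neg y ⊞ y)        ≡⟨ cong α (inverseˡ y) ⟩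
        α 𝟘                ≡⟨ hom-𝟘 α-⊞ ⟩
        𝟘                  ∎

    ⊞T≢ : ∀ y → ¬ (y ≡ y ⊞ T)
    ⊞T≢ y e = T≢𝟘 (sym (∙-cancelˡ y 𝟘 T (trans (identityʳ y) e)))

    total : List A → A
    total = foldr _⊞_ 𝟘

    total-↭ : ∀ {xs ys} → xs ↭ ys → total xs ≡ total ys
    total-↭ q = Permutation.foldr-commMonoid (≡.setoid A)
      (record { isMonoid = AbelianGroup.isMonoid abelianGroup ; comm = comm }) (↭⇒↭ₛ q)

    total-translate : ∀ x xs → total (map (x ⊞_) xs) ≡ (length xs · x) ⊞ total xs
    total-translate x []       = sym (identityˡ 𝟘)
    total-translate x (y ∷ ys) = trans (cong ((x ⊞ y) ⊞_) (total-translate x ys))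
                                       (interchange x y (length ys · x) (total ys))

    -- Translation by x permutes the group, so it does not change the sum of all elements.
    lagrange : ∀ x → length elements · x ≡ 𝟘
    lagrange x = ∙-cancelʳ (total elements) (length elements · x) 𝟘
      (trans (sym (total-translate x elements)) (trans (total-↭ perm) (sym (identityˡ (total elements)))))
      where
      undo : ∀ x y z → x ⊞ y ≡ 𝟘 → x ⊞ (y ⊞ z) ≡ z
      undo x y z e = trans (sym (assoc x y z)) (trans (cong (_⊞ z) e) (identityˡ z))
      perm : map (x ⊞_) elements ↭ elements
      perm = map-↭ unique (x ⊞_) ((neg x) ⊞_) (λ _ → complete _) (λ _ → complete _)
        (λ {y} _ → undo x (neg x) y (inverseʳ x)) (λ {y} _ → undo (neg x) x y (inverseˡ x))

    image : List A → List A
    image xs = deduplicate _≟_ (map α xs)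

    -- The fibres of `α` are the pairs `y`, `y ⊞ T`. Closure under translation by `T` keeps each
    -- pair inside `xs`, and the incidences of `xs` with its image are counted in both orders.
    image-halves : ∀ {xs} → Unique xs → (∀ {x} → x ∈ xs → x ⊞ T ∈ xs) → length xs ≡ 2 *ℕ length (image xs)
    image-halves {xs} u closed = ℤₚ.+-injective (begin
      + length xs                                           ≡⟨ ℤₚ.*-identityʳ (+ length xs) ⟨
      + length xs ℤ.* + 1                                   ≡⟨ ∑-const xs (+ 1) ⟨
      ∑ xs (λ _ → + 1)                                      ≡⟨ ∑-cong xs (λ x m → sym (∑-count unique-image (α x ≟_) (∈-image m) refl (λ _ _ e → sym e))) ⟩
      ∑ xs (λ x → ∑ (image xs) (λ y → ⟦ α x ≟ y ⟧))         ≡⟨ ∑-swap xs (image xs) (λ x y → ⟦ α x ≟ y ⟧) ⟩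
      ∑ (image xs) (λ y → ∑ xs (λ x → ⟦ α x ≟ y ⟧))         ≡⟨ ∑-cong (image xs) fibre ⟩
      ∑ (image xs) (λ _ → + 2)                              ≡⟨ ∑-const (image xs) (+ 2) ⟩
      + length (image xs) ℤ.* + 2                           ≡⟨ ℤₚ.*-comm (+ length (image xs)) (+ 2) ⟩
      + 2 ℤ.* + length (image xs)                           ≡⟨ ℤₚ.pos-* 2 (length (image xs)) ⟨
      + (2 *ℕ length (image xs))                            ∎)
      where
      unique-image : Unique (image xs)
      unique-image = DecUnique.deduplicate-! _≟_ (map α xs)

      ∈-image : ∀ {x} → x ∈ xs → α x ∈ image xs
      ∈-image m = ∈-deduplicate⁺ _≟_ (∈-map⁺ α m)

      α-shift : ∀ y → α (y ⊞ T) ≡ α y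
      α-shift y = trans (α-⊞ y T) (trans (cong (α y ⊞_) α-T) (identityʳ (α y)))

      split : ∀ x y → ⟦ α x ≟ α y ⟧ ≡ ⟦ x ≟ y ⟧ ℤ.+ ⟦ x ≟ (y ⊞ T) ⟧
      split x y = go (x ≟ y) (x ≟ (y ⊞ T))
        where
        go : (d : Dec (x ≡ y)) (d′ : Dec (x ≡ y ⊞ T)) → ⟦ α x ≟ α y ⟧ ≡ ⟦ d ⟧ ℤ.+ ⟦ d′ ⟧
        go (yes e) (yes e′) = ⊥-elim (⊞T≢ y (trans (sym e) e′))
        go (yes e) (no _)   = ⟦⟧-yes (α x ≟ α y) (cong α e)
        go (no _)  (yes e′) = ⟦⟧-yes (α x ≟ α y) (trans (cong α e′) (α-shift y))
        go (no n)  (no n′)  = ⟦⟧-no (α x ≟ α y) (λ e → [ n , n′ ]′ (α-injective e))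

      fibre : ∀ y → y ∈ image xs → ∑ xs (λ x → ⟦ α x ≟ y ⟧) ≡ + 2
      fibre y m with y₀ , m₀ , refl ← ∈-map⁻ α (∈-deduplicate⁻ _≟_ (map α xs) m) = begin
        ∑ xs (λ x → ⟦ α x ≟ α y₀ ⟧)                                       ≡⟨ ∑-ext xs (λ x → split x y₀) ⟩
        ∑ xs (λ x → ⟦ x ≟ y₀ ⟧ ℤ.+ ⟦ x ≟ (y₀ ⊞ T) ⟧)                      ≡⟨ ∑-+ xs (λ x → ⟦ x ≟ y₀ ⟧) (λ x → ⟦ x ≟ (y₀ ⊞ T) ⟧) ⟩
        ∑ xs (λ x → ⟦ x ≟ y₀ ⟧) ℤ.+ ∑ xs (λ x → ⟦ x ≟ (y₀ ⊞ T) ⟧)         ≡⟨ cong₂ ℤ._+_ (∑-count u (_≟ y₀) m₀ refl (λ _ _ e → e))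
                                                                                         (∑-count u (_≟ (y₀ ⊞ T)) (closed m₀) refl (λ _ _ e → e)) ⟩
        + 2                                                               ∎

    α^ : ℕ → A → A
    α^ zero    x = x
    α^ (suc j) x = α (α^ j x)

    α^-⊞ : ∀ j → Hom (α^ j)
    α^-⊞ zero    x y = refl
    α^-⊞ (suc j) x y = trans (cong α (α^-⊞ j x y)) (α-⊞ (α^ j x) (α^ j y))

    α^-α : ∀ j x → α^ j (α x) ≡ α (α^ j x)
    α^-α zero    x = refl
    α^-α (suc j) x = cong α (α^-α j x)

    InImage : ℕ → A → Set
    InImage j y = ∃ λ x → α^ j x ≡ y

    record ImageList (j : ℕ) : Set where
      field
        list     : List A
        distinct : Unique list
        sound    : ∀ {y} → y ∈ list → InImage j y
        covers   : ∀ {y} → InImage j y → y ∈ list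
        size     : length elements ≡ (2 ^ℕ j) *ℕ length list
    open ImageList

    -- The preimage `t` of `T` at level `j` makes the image of `α^ j` closed under translation by
    -- `T`, so passing to level `j + 1` halves it exactly.
    images : ∀ j → (∀ i → i < j → InImage i T) → ImageList j
    images zero T∈ = record
      { list = elements ; distinct = unique ; sound = λ {y} _ → y , refl ; covers = λ {y} _ → complete y
      ; size = sym (ℕₚ.*-identityˡ (length elements)) }
    images (suc j) T∈ = record
      { list     = image (list I)
      ; distinct = DecUnique.deduplicate-! _≟_ (map α (list I))
      ; sound    = λ m → let x , x∈ , e = ∈-map⁻ α (∈-deduplicate⁻ _≟_ (map α (list I)) m)
                             w , f      = sound I x∈
                         in w , trans (cong α f) (sym e)
      ; covers   = λ { (w , e) → subst (_∈ image (list I)) e (∈-deduplicate⁺ _≟_ (∈-map⁺ α (covers I (w , refl)))) }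
      ; size     = begin
          length elements                                ≡⟨ size I ⟩
          (2 ^ℕ j) *ℕ length (list I)                    ≡⟨ cong ((2 ^ℕ j) *ℕ_) (image-halves (distinct I) closed) ⟩
          (2 ^ℕ j) *ℕ (2 *ℕ length (image (list I)))     ≡⟨ regroup (2 ^ℕ j) (length (image (list I))) ⟩
          (2 *ℕ 2 ^ℕ j) *ℕ length (image (list I))       ∎
      }
      where
      I : ImageList j
      I = images j (λ i i<j → T∈ i (ℕₚ.m<n⇒m<1+n i<j))
      closed : ∀ {x} → x ∈ list I → x ⊞ T ∈ list I
      closed m with w , e ← sound I m | t , f ← T∈ j ℕₚ.≤-refl = covers I (w ⊞ t , trans (α^-⊞ j w t) (cong₂ _⊞_ e f))
      regroup : ∀ a b → a *ℕ (2 *ℕ b) ≡ (2 *ℕ a) *ℕ b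
      regroup = solve-∀

    -- An element killed by a power of 2 has a multiple z ≢ 𝟘 with 2 · z ≡ 𝟘; then α (α z) ≡ 𝟘,
    -- hence z or α z is T.
    reach-T : ∀ n y → ¬ (y ≡ 𝟘) → (2 ^ℕ n) · y ≡ 𝟘 → ∃ λ c → T ≡ c · y ⊎ T ≡ α (c · y)
    reach-T zero    y y≢𝟘 e = ⊥-elim (y≢𝟘 (trans (sym (identityʳ y)) e))
    reach-T (suc n) y y≢𝟘 e = go ((2 · y) ≟ 𝟘)
      where
      go : Dec (2 · y ≡ 𝟘) → ∃ λ c → T ≡ c · y ⊎ T ≡ α (c · y)
      go (yes e₂) = 1 , [ (λ h → inj₁ (sym (trans (identityʳ y) (first h)))) , (λ h → inj₂ (sym (trans (cong α (identityʳ y)) h))) ]′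
                          (kernel (α y) ααy≡𝟘)
        where
        ααy≡𝟘 : α (α y) ≡ 𝟘
        ααy≡𝟘 = trans (α-α y) (trans (sym (hom-· ι-⊞ 2 y)) (trans (cong ι e₂) (hom-𝟘 ι-⊞)))
        first : α y ≡ 𝟘 → y ≡ T
        first h = [ (λ z → ⊥-elim (y≢𝟘 z)) , (λ z → z) ]′ (kernel y h)
      go (no n₂) = let c , h = reach-T n (2 · y) n₂ (trans (×-assocˡ y (2 ^ℕ n) 2) (trans (cong (_· y) (ℕₚ.*-comm (2 ^ℕ n) 2)) e))
                   in c *ℕ 2 , [ (λ f → inj₁ (trans f (×-assocˡ y c 2))) , (λ f → inj₂ (trans f (cong α (×-assocˡ y c 2)))) ]′ h

    nonzero-member : ∀ {xs} → Unique xs → 2 ≤ length xs → ∃ λ x → x ∈ xs × ¬ (x ≡ 𝟘)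
    nonzero-member {x ∷ y ∷ xs} (x∉ AllPairs.∷ _) _ = go (x ≟ 𝟘)
      where
      go : Dec (x ≡ 𝟘) → ∃ λ z → z ∈ x ∷ y ∷ xs × ¬ (z ≡ 𝟘)
      go (yes e) = y , there (here refl) , λ f → All.lookup x∉ (here refl) (trans e (sym f))
      go (no n)  = x , here refl , n
    nonzero-member {x ∷ []} _ (s≤s ())

    module Order2^ (r : ℕ) (order : length elements ≡ 2 ^ℕ r) where

      -- The image of `α^ j` has `2 ^ (r ∸ j) ≥ 2` elements, hence a nonzero one; by `reach-T` some
      -- Gaussian multiple of it is `T`, and the image is stable under such multiples.
      T-in-image : ∀ j → j < r → InImage j T
      T-in-image j j<r = below r j j<r j<r
        where
        -- The bound `b` carries a strong induction: the size of the image at level `j` depends on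
        -- `T` lying in all earlier images.
        below : ∀ b j → j < b → j < r → InImage j T
        below (suc b) j (s≤s j≤b) j<r =
          let y , y∈ , y≢𝟘 = nonzero-member (distinct I) 2≤size
              w , e        = sound I y∈
              c , h        = reach-T r y y≢𝟘 (trans (cong (_· y) (sym order)) (lagrange y))
              cw : α^ j (c · w) ≡ c · y
              cw = trans (hom-· (α^-⊞ j) c w) (cong (c ·_) e)
          in [ (λ f → c · w , trans cw (sym f))
             , (λ f → α (c · w) , trans (α^-α j (c · w)) (trans (cong α cw) (sym f))) ]′ h
          where
          I : ImageList j
          I = images j (λ i i<j → below b i (ℕₚ.<-≤-trans i<j j≤b) (ℕₚ.<-trans i<j j<r))
          size≡ : length (list I) ≡ 2 ^ℕ (r ∸ j)
          size≡ = ℕₚ.*-cancelˡ-≡ (length (list I)) (2 ^ℕ (r ∸ j)) (2 ^ℕ j) {{ℕₚ.m^n≢0 2 j}} (begin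
            (2 ^ℕ j) *ℕ length (list I)      ≡⟨ trans (sym (size I)) order ⟩
            2 ^ℕ r                           ≡⟨ cong (2 ^ℕ_) (ℕₚ.m+[n∸m]≡n (ℕₚ.<⇒≤ j<r)) ⟨
            2 ^ℕ (j +ℕ (r ∸ j))              ≡⟨ ℕₚ.^-distribˡ-+-* 2 j (r ∸ j) ⟩
            (2 ^ℕ j) *ℕ 2 ^ℕ (r ∸ j)         ∎)
          2≤size : 2 ≤ length (list I)
          2≤size = subst (2 ≤_) (sym size≡) (ℕₚ.^-monoʳ-≤ 2 (ℕₚ.m<n⇒0<n∸m j<r))

    -- Each pair of applications of `α` contributes `2 ι`; the accumulated power of `ι` is absorbed
    -- into the witness.
    α^-double : ∀ k x → ∃ λ y → α^ (2 *ℕ k) x ≡ (2 ^ℕ k) · y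
    α^-double zero    x = x , sym (identityʳ x)
    α^-double (suc k) x = let y , e = α^-double k x in ι y , (begin
      α^ (2 *ℕ suc k) x            ≡⟨ cong (λ n → α^ n x) (ℕₚ.*-suc 2 k) ⟩
      α (α (α^ (2 *ℕ k) x))        ≡⟨ α-α (α^ (2 *ℕ k) x) ⟩
      2 · ι (α^ (2 *ℕ k) x)        ≡⟨ cong (λ z → 2 · ι z) e ⟩
      2 · ι ((2 ^ℕ k) · y)         ≡⟨ cong (2 ·_) (hom-· ι-⊞ (2 ^ℕ k) y) ⟩
      2 · ((2 ^ℕ k) · ι y)         ≡⟨ ×-assocˡ (ι y) 2 (2 ^ℕ k) ⟩
      (2 ^ℕ suc k) · ι y           ∎)

    parity : ∀ n → (∃ λ c → n ≡ 2 *ℕ c) ⊎ (∃ λ c → n ≡ 1 +ℕ 2 *ℕ c)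
    parity zero    = inj₁ (0 , refl)
    parity (suc n) = [ (λ { (c , e) → inj₂ (c , cong suc e) })
                     , (λ { (c , e) → inj₁ (suc c , trans (cong suc e) (sym (ℕₚ.*-suc 2 c))) }) ]′ (parity n)

    2T : 2 · T ≡ 𝟘
    2T = trans (2· T) T⊞T

    T-even : ∀ n → n · T ≡ 𝟘 → ∃ λ c → n ≡ 2 *ℕ c
    T-even n e = [ (λ h → h) , (λ { (c , f) → ⊥-elim (T≢𝟘 (trans (sym (odd c)) (trans (cong (_· T) (sym f)) e))) }) ]′ (parity n)
      where
      odd : ∀ c → (1 +ℕ 2 *ℕ c) · T ≡ T
      odd c = begin
        T ⊞ ((2 *ℕ c) · T)       ≡⟨ cong (λ n → T ⊞ (n · T)) (ℕₚ.*-comm 2 c) ⟩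
        T ⊞ ((c *ℕ 2) · T)       ≡⟨ cong (T ⊞_) (×-assocˡ T c 2) ⟨
        T ⊞ (c · (2 · T))        ≡⟨ cong (λ z → T ⊞ (c · z)) 2T ⟩
        T ⊞ (c · 𝟘)              ≡⟨ cong (T ⊞_) (·-𝟘 c) ⟩
        T ⊞ 𝟘                  ≡⟨ identityʳ T ⟩
        T                      ∎

    InImage-pred : ∀ {j y} → InImage (suc j) y → InImage j y
    InImage-pred {j} (x , e) = α x , trans (α^-α j x) e

    -- Here `T` is in the images of `α^ 0`, `α^ 1` and `α^ 2`, which permits three halvings.
    8∣order : ∀ {x y} → α x ≡ y → α y ≡ T → 8 ∣ length elements
    8∣order {x} e f = divides (length (list I)) (trans (size I) (ℕₚ.*-comm 8 (length (list I))))
      where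
      t : InImage 2 T
      t = x , trans (cong α e) f
      below-3 : ∀ i → i < 3 → InImage i T
      below-3 0 _ = InImage-pred {0} (InImage-pred {1} t)
      below-3 1 _ = InImage-pred {1} t
      below-3 2 _ = t
      below-3 (suc (suc (suc i))) (s≤s (s≤s (s≤s ())))
      I : ImageList 3
      I = images 3 below-3

    module Generator (k : ℕ) (P : A) (2^kP : (2 ^ℕ k) · P ≡ T) where

      -- Unlike `ι P`, which still satisfies `2ᵏ · ι P = T`, this second generator is killed by
      -- `2ᵏ`.
      X : A
      X = α P

      Z : ℕ → ℕ → A
      Z a b = (a · X) ⊞ (b · P)

      ·-comm : ∀ c d x → c · (d · x) ≡ d · (c · x)
      ·-comm c d x = trans (×-assocˡ x c d) (trans (cong (_· x) (ℕₚ.*-comm c d)) (sym (×-assocˡ x d c)))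

      2^kX : (2 ^ℕ k) · X ≡ 𝟘
      2^kX = trans (sym (hom-· α-⊞ (2 ^ℕ k) P)) (trans (cong α 2^kP) α-T)

      2^[k+1]P : (2 ^ℕ (k +ℕ 1)) · P ≡ 𝟘
      2^[k+1]P = begin
        (2 ^ℕ (k +ℕ 1)) · P       ≡⟨ cong (λ n → (2 ^ℕ n) · P) (ℕₚ.+-comm k 1) ⟩
        (2 *ℕ 2 ^ℕ k) · P         ≡⟨ ×-assocˡ P 2 (2 ^ℕ k) ⟨
        2 · ((2 ^ℕ k) · P)        ≡⟨ cong (2 ·_) 2^kP ⟩
        2 · T                     ≡⟨ 2T ⟩
        𝟘                         ∎

      Z-· : ∀ c a b → c · Z a b ≡ Z (c *ℕ a) (c *ℕ b)
      Z-· c a b = trans (×-distrib-+ (a · X) (b · P) c) (cong₂ _⊞_ (×-assocˡ X c a) (×-assocˡ P c b))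

      Z-+ : ∀ a b c d → Z (a +ℕ c) (b +ℕ d) ≡ Z a b ⊞ Z c d
      Z-+ a b c d = trans (cong₂ _⊞_ (×-homo-+ X a c) (×-homo-+ P b d)) (interchange (a · X) (c · X) (b · P) (d · P))

      -- Multiplication by `2ᵏ` erases `X` and so detects the parity of `b`.
      2^k·Z : ∀ a b → (2 ^ℕ k) · Z a b ≡ b · T
      2^k·Z a b = begin
        (2 ^ℕ k) · Z a b                                    ≡⟨ ×-distrib-+ (a · X) (b · P) (2 ^ℕ k) ⟩
        ((2 ^ℕ k) · (a · X)) ⊞ ((2 ^ℕ k) · (b · P))         ≡⟨ cong₂ _⊞_ (·-comm (2 ^ℕ k) a X) (·-comm (2 ^ℕ k) b P) ⟩
        (a · ((2 ^ℕ k) · X)) ⊞ (b · ((2 ^ℕ k) · P))         ≡⟨ cong₂ (λ u v → (a · u) ⊞ (b · v)) 2^kX 2^kP ⟩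
        (a · 𝟘) ⊞ (b · T)                                   ≡⟨ cong (_⊞ (b · T)) (·-𝟘 a) ⟩
        𝟘 ⊞ (b · T)                                         ≡⟨ identityˡ (b · T) ⟩
        b · T                                               ∎

      -- Once `b` is even, the parity of `a` is detected in the same way after applying `α`, which
      -- exchanges the roles: `α X = 2 ι P` and `α P = X`.
      2^d·α-Z : ∀ d a c → 2 *ℕ 2 ^ℕ d ≡ 2 ^ℕ k → (2 ^ℕ d) · α (Z a (2 *ℕ c)) ≡ a · T
      2^d·α-Z d a c e = begin
        (2 ^ℕ d) · α (Z a (2 *ℕ c))                              ≡⟨ cong ((2 ^ℕ d) ·_) αZ ⟩
        (2 ^ℕ d) · ((a · (2 · ι P)) ⊞ (c · (2 · X)))             ≡⟨ ×-distrib-+ (a · (2 · ι P)) (c · (2 · X)) (2 ^ℕ d) ⟩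
        ((2 ^ℕ d) · (a · (2 · ι P))) ⊞ ((2 ^ℕ d) · (c · (2 · X))) ≡⟨ cong₂ _⊞_ (double a (ι P)) (double c X) ⟩
        (a · ((2 ^ℕ k) · ι P)) ⊞ (c · ((2 ^ℕ k) · X))            ≡⟨ cong₂ (λ u v → (a · u) ⊞ (c · v))
                                                                      (trans (sym (hom-· ι-⊞ (2 ^ℕ k) P)) (trans (cong ι 2^kP) ι-T)) 2^kX ⟩
        (a · T) ⊞ (c · 𝟘)                                        ≡⟨ cong ((a · T) ⊞_) (·-𝟘 c) ⟩
        (a · T) ⊞ 𝟘                                              ≡⟨ identityʳ (a · T) ⟩
        a · T                                                    ∎
        where
        double : ∀ n x → (2 ^ℕ d) · (n · (2 · x)) ≡ n · ((2 ^ℕ k) · x)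
        double n x = trans (·-comm (2 ^ℕ d) n (2 · x)) (cong (n ·_)
          (trans (×-assocˡ x (2 ^ℕ d) 2) (cong (_· x) (trans (ℕₚ.*-comm (2 ^ℕ d) 2) e))))
        αZ : α (Z a (2 *ℕ c)) ≡ (a · (2 · ι P)) ⊞ (c · (2 · X))
        αZ = begin
          α (Z a (2 *ℕ c))                          ≡⟨ α-⊞ (a · X) ((2 *ℕ c) · P) ⟩
          α (a · X) ⊞ α ((2 *ℕ c) · P)              ≡⟨ cong₂ _⊞_ (hom-· α-⊞ a X) (hom-· α-⊞ (2 *ℕ c) P) ⟩
          (a · α X) ⊞ ((2 *ℕ c) · X)                ≡⟨ cong₂ (λ u n → (a · u) ⊞ (n · X)) (α-α P) (ℕₚ.*-comm 2 c) ⟩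
          (a · (2 · ι P)) ⊞ ((c *ℕ 2) · X)          ≡⟨ cong ((a · (2 · ι P)) ⊞_) (×-assocˡ X c 2) ⟨
          (a · (2 · ι P)) ⊞ (c · (2 · X))           ∎

      -- Multiplying a relation 2ᵈ (aX + bP) = 0 up to T shows that b is even, and then, after
      -- applying α, that a is even.
      annihilator : ∀ n d → n +ℕ d ≡ k → ∀ a b → (2 ^ℕ d) · Z a b ≡ 𝟘 → 2 ^ℕ n ∣ a × 2 ^ℕ (n +ℕ 1) ∣ b
      annihilator zero d refl a b e =
        let c , f = T-even b (trans (sym (2^k·Z a b)) e)
        in divides a (sym (ℕₚ.*-identityʳ a)) , divides c (trans f (ℕₚ.*-comm 2 c))
      annihilator (suc n) d refl a b e =
        let b₁ , eb = T-even b (trans (sym (2^k·Z a b)) (trans (cong (_· Z a b) split) (trans (sym (×-assocˡ (Z a b) (2 ^ℕ suc n) (2 ^ℕ d))) (trans (cong ((2 ^ℕ suc n) ·_) e) (·-𝟘 (2 ^ℕ suc n))))))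
            a₁ , ea = T-even a (a-relation b₁ eb)
            u , v   = annihilator n (suc d) (ℕₚ.+-suc n d) a₁ b₁ (halved a₁ b₁ ea eb)
        in subst (2 ^ℕ suc n ∣_) (sym ea) (∣.*-monoʳ-∣ 2 u) , subst (2 ^ℕ (suc n +ℕ 1) ∣_) (sym eb) (∣.*-monoʳ-∣ 2 v)
        where
        split : 2 ^ℕ k ≡ (2 ^ℕ suc n) *ℕ (2 ^ℕ d)
        split = ℕₚ.^-distribˡ-+-* 2 (suc n) d

        a-relation : ∀ b₁ → b ≡ 2 *ℕ b₁ → a · T ≡ 𝟘
        a-relation b₁ eb = begin
          a · T                                            ≡⟨ 2^d·α-Z (n +ℕ d) a b₁ refl ⟨
          (2 ^ℕ (n +ℕ d)) · α (Z a (2 *ℕ b₁))              ≡⟨ cong (λ c → (2 ^ℕ (n +ℕ d)) · α (Z a c)) eb ⟨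
          (2 ^ℕ (n +ℕ d)) · α (Z a b)                      ≡⟨ cong (_· α (Z a b)) (ℕₚ.^-distribˡ-+-* 2 n d) ⟩
          ((2 ^ℕ n) *ℕ (2 ^ℕ d)) · α (Z a b)               ≡⟨ ×-assocˡ (α (Z a b)) (2 ^ℕ n) (2 ^ℕ d) ⟨
          (2 ^ℕ n) · ((2 ^ℕ d) · α (Z a b))                ≡⟨ cong ((2 ^ℕ n) ·_) (hom-· α-⊞ (2 ^ℕ d) (Z a b)) ⟨
          (2 ^ℕ n) · α ((2 ^ℕ d) · Z a b)                  ≡⟨ cong (λ z → (2 ^ℕ n) · α z) e ⟩
          (2 ^ℕ n) · α 𝟘                                   ≡⟨ cong ((2 ^ℕ n) ·_) (hom-𝟘 α-⊞) ⟩
          (2 ^ℕ n) · 𝟘                                     ≡⟨ ·-𝟘 (2 ^ℕ n) ⟩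
          𝟘                                                ∎

        halved : ∀ a₁ b₁ → a ≡ 2 *ℕ a₁ → b ≡ 2 *ℕ b₁ → (2 ^ℕ suc d) · Z a₁ b₁ ≡ 𝟘
        halved a₁ b₁ ea eb = begin
          (2 *ℕ 2 ^ℕ d) · Z a₁ b₁              ≡⟨ cong (_· Z a₁ b₁) (ℕₚ.*-comm 2 (2 ^ℕ d)) ⟩
          ((2 ^ℕ d) *ℕ 2) · Z a₁ b₁            ≡⟨ ×-assocˡ (Z a₁ b₁) (2 ^ℕ d) 2 ⟨
          (2 ^ℕ d) · (2 · Z a₁ b₁)             ≡⟨ cong ((2 ^ℕ d) ·_) (Z-· 2 a₁ b₁) ⟩
          (2 ^ℕ d) · Z (2 *ℕ a₁) (2 *ℕ b₁)     ≡⟨ cong₂ (λ u v → (2 ^ℕ d) · Z u v) ea eb ⟨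
          (2 ^ℕ d) · Z a b                     ≡⟨ e ⟩
          𝟘                                    ∎

      kernel-Z : ∀ a b → Z a b ≡ 𝟘 → 2 ^ℕ k ∣ a × 2 ^ℕ (k +ℕ 1) ∣ b
      kernel-Z a b e = annihilator k 0 (ℕₚ.+-identityʳ k) a b (trans (identityʳ (Z a b)) e)

      instance
        2^k≢0 : NonZero (2 ^ℕ k)
        2^k≢0 = ℕₚ.m^n≢0 2 k
        2^[k+1]≢0 : NonZero (2 ^ℕ (k +ℕ 1))
        2^[k+1]≢0 = ℕₚ.m^n≢0 2 (k +ℕ 1)

      φ : G k → A
      φ (a , b) = Z (toℕ a) (toℕ b)

      ·-mod : ∀ n .{{_ : NonZero n}} x → n · x ≡ 𝟘 → ∀ a → (a ℕ.% n) · x ≡ a · x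
      ·-mod n x e a = begin
        (a ℕ.% n) · x                                    ≡⟨ identityʳ ((a ℕ.% n) · x) ⟨
        ((a ℕ.% n) · x) ⊞ 𝟘                              ≡⟨ cong (((a ℕ.% n) · x) ⊞_) (trans (cong ((a ℕ./ n) ·_) e) (·-𝟘 (a ℕ./ n))) ⟨
        ((a ℕ.% n) · x) ⊞ ((a ℕ./ n) · (n · x))          ≡⟨ cong (((a ℕ.% n) · x) ⊞_) (×-assocˡ x (a ℕ./ n) n) ⟩
        ((a ℕ.% n) · x) ⊞ (((a ℕ./ n) *ℕ n) · x)         ≡⟨ ×-homo-+ x (a ℕ.% n) ((a ℕ./ n) *ℕ n) ⟨
        (a ℕ.% n +ℕ (a ℕ./ n) *ℕ n) · x                  ≡⟨ cong (_· x) (ℕ.m≡m%n+[m/n]*n a n) ⟨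
        a · x                                            ∎

      φ-hom : ∀ g h → φ (addG k g h) ≡ φ g ⊞ φ h
      φ-hom (a , b) (c , d) = begin
        Z (toℕ ((toℕ a +ℕ toℕ c) ℕ.mod (2 ^ℕ k))) (toℕ ((toℕ b +ℕ toℕ d) ℕ.mod (2 ^ℕ (k +ℕ 1))))
          ≡⟨ cong₂ Z (toℕ-mod (toℕ a +ℕ toℕ c) (2 ^ℕ k)) (toℕ-mod (toℕ b +ℕ toℕ d) (2 ^ℕ (k +ℕ 1))) ⟩
        Z ((toℕ a +ℕ toℕ c) ℕ.% (2 ^ℕ k)) ((toℕ b +ℕ toℕ d) ℕ.% (2 ^ℕ (k +ℕ 1)))
          ≡⟨ cong₂ _⊞_ (·-mod (2 ^ℕ k) X 2^kX (toℕ a +ℕ toℕ c)) (·-mod (2 ^ℕ (k +ℕ 1)) P 2^[k+1]P (toℕ b +ℕ toℕ d)) ⟩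
        Z (toℕ a +ℕ toℕ c) (toℕ b +ℕ toℕ d)
          ≡⟨ Z-+ (toℕ a) (toℕ b) (toℕ c) (toℕ d) ⟩
        Z (toℕ a) (toℕ b) ⊞ Z (toℕ c) (toℕ d) ∎

      -- The number `a + (n ∸ c)` lies strictly between 0 and `2 n`, so as a multiple of `n` it can
      -- only be `n`.
      divides-shift : ∀ n a c → a < n → c < n → n ∣ a +ℕ (n ∸ c) → a ≡ c
      divides-shift n a c a<n c<n (divides zero e) = ⊥-elim (ℕₚ.<⇒≢ (ℕₚ.m<n⇒0<n∸m c<n) (sym (ℕₚ.m+n≡0⇒n≡0 a e)))
      divides-shift n a c a<n c<n (divides (suc zero) e) = ℕₚ.+-cancelʳ-≡ (n ∸ c) a c
        (trans e (trans (ℕₚ.*-identityˡ n) (sym (ℕₚ.m+[n∸m]≡n (ℕₚ.<⇒≤ c<n)))))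
      divides-shift n a c a<n c<n (divides (suc (suc q)) e) = ⊥-elim (ℕₚ.<⇒≱ below above)
        where
        below : a +ℕ (n ∸ c) < n +ℕ n
        below = ℕₚ.+-mono-<-≤ a<n (ℕₚ.m∸n≤m n c)
        above : n +ℕ n ≤ a +ℕ (n ∸ c)
        above = ℕₚ.≤-trans (ℕₚ.+-monoʳ-≤ n (ℕₚ.m≤m+n n (q *ℕ n))) (ℕₚ.≤-reflexive (sym e))

      -- Coefficients are natural numbers, so `2ᵏ ∸ c` and `2ᵏ⁺¹ ∸ d` stand for `− c` and `− d`, and
      -- `kernel-Z` applies to the difference.
      φ-injective : Injective _≡_ _≡_ φ
      φ-injective {a , b} {c , d} e = cong₂ _,_ (Finₚ.toℕ-injective (divides-shift (2 ^ℕ k) (toℕ a) (toℕ c) (Finₚ.toℕ<n a) (Finₚ.toℕ<n c) (proj₁ K)))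
                                                (Finₚ.toℕ-injective (divides-shift (2 ^ℕ (k +ℕ 1)) (toℕ b) (toℕ d) (Finₚ.toℕ<n b) (Finₚ.toℕ<n d) (proj₂ K)))
        where
        a′ = 2 ^ℕ k ∸ toℕ c
        b′ = 2 ^ℕ (k +ℕ 1) ∸ toℕ d
        K : 2 ^ℕ k ∣ toℕ a +ℕ a′ × 2 ^ℕ (k +ℕ 1) ∣ toℕ b +ℕ b′
        K = kernel-Z (toℕ a +ℕ a′) (toℕ b +ℕ b′) (begin
          Z (toℕ a +ℕ a′) (toℕ b +ℕ b′)            ≡⟨ Z-+ (toℕ a) (toℕ b) a′ b′ ⟩
          φ (a , b) ⊞ Z a′ b′                      ≡⟨ cong (_⊞ Z a′ b′) e ⟩
          φ (c , d) ⊞ Z a′ b′                      ≡⟨ Z-+ (toℕ c) (toℕ d) a′ b′ ⟨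
          Z (toℕ c +ℕ a′) (toℕ d +ℕ b′)            ≡⟨ cong₂ Z (ℕₚ.m+[n∸m]≡n (ℕₚ.<⇒≤ (Finₚ.toℕ<n c))) (ℕₚ.m+[n∸m]≡n (ℕₚ.<⇒≤ (Finₚ.toℕ<n d))) ⟩
          Z (2 ^ℕ k) (2 ^ℕ (k +ℕ 1))               ≡⟨ cong₂ _⊞_ 2^kX 2^[k+1]P ⟩
          𝟘 ⊞ 𝟘                                    ≡⟨ identityˡ 𝟘 ⟩
          𝟘                                        ∎)

      -- An injective map between sets of the same size `2ᵏ · 2ᵏ⁺¹`.
      φ-surjective : length elements ≡ 2 ^ℕ (2 *ℕ k +ℕ 1) → ∀ x → ∃ λ g → φ g ≡ x
      φ-surjective order x = let g , _ , e = ∈-map⁻ φ (unique-full _≟_ unique-φ unique (λ _ → complete _) size-φ (complete x))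
                             in g , sym e
        where
        Gs : List (G k)
        Gs = cartesianProduct (allFin (2 ^ℕ k)) (allFin (2 ^ℕ (k +ℕ 1)))
        unique-φ : Unique (map φ Gs)
        unique-φ = Unique.map⁺ φ-injective (Unique.cartesianProduct⁺ (Unique.allFin⁺ (2 ^ℕ k)) (Unique.allFin⁺ (2 ^ℕ (k +ℕ 1))))
        size-φ : length (map φ Gs) ≡ length elements
        size-φ = begin
          length (map φ Gs)                                              ≡⟨ Listₚ.length-map φ Gs ⟩
          length Gs                                                      ≡⟨ length-cartesianProduct (allFin (2 ^ℕ k)) (allFin (2 ^ℕ (k +ℕ 1))) ⟩
          length (allFin (2 ^ℕ k)) *ℕ length (allFin (2 ^ℕ (k +ℕ 1)))    ≡⟨ cong₂ _*ℕ_ (length-allFin (2 ^ℕ k)) (length-allFin (2 ^ℕ (k +ℕ 1))) ⟩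
          2 ^ℕ k *ℕ 2 ^ℕ (k +ℕ 1)                                        ≡⟨ ℕₚ.^-distribˡ-+-* 2 k (k +ℕ 1) ⟨
          2 ^ℕ (k +ℕ (k +ℕ 1))                                           ≡⟨ cong (2 ^ℕ_) (regroup k) ⟩
          2 ^ℕ (2 *ℕ k +ℕ 1)                                             ≡⟨ order ⟨
          length elements                                                ∎
          where
          regroup : ∀ k → k +ℕ (k +ℕ 1) ≡ 2 *ℕ k +ℕ 1
          regroup = solve-∀

    structure : ∀ k → length elements ≡ 2 ^ℕ (2 *ℕ k +ℕ 1) →
                Σ (G k → A) λ φ → Injective _≡_ _≡_ φ × (∀ x → ∃ λ g → φ g ≡ x) × (∀ g h → φ (addG k g h) ≡ φ g ⊞ φ h)
    structure k order =
      let x , e = T-in-image (2 *ℕ k) (ℕₚ.≤-reflexive (sym (ℕₚ.+-comm (2 *ℕ k) 1)))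
          P , f = α^-double k x
          open Generator k P (trans (sym f) e)
      in φ , φ-injective , φ-surjective order , φ-hom
      where
      open Order2^ (2 *ℕ k +ℕ 1) order

-- Uniqueness of sums of two squares, and the sign of the character sum.

module TwoSquareSums where

  open FiniteSums
  open import Data.Nat as ℕ using (ℕ; zero; suc; NonZero)
  open import Data.Nat.Primality using (Prime; prime[2])
  import Data.Nat.Properties as ℕₚ
  open import Data.Integer using (ℤ; +_; -[1+_]; _+_; _-_; -_; _*_; ∣_∣)
  import Data.Integer.Properties as ℤₚ
  open import Data.Integer.Divisibility.Signed using (divides) renaming (_∣_ to _∣ℤ_)
  open import Data.Integer.Tactic.RingSolver using (solve-∀)
  open import Data.Product using (_,_; proj₁; proj₂; ∃)
  open import Data.Sum using (_⊎_; inj₁; inj₂; [_,_]′)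
  open import Data.Empty using (⊥-elim)
  open import Relation.Nullary using (¬_)
  open import Relation.Binary.PropositionalEquality as ≡ using (_≡_; refl; cong; cong₂; sym; trans; subst)

  module Mod2 = PrimeField 2 prime[2]

  odd≢0 : ∀ w → ¬ (+ 2 * w + + 1 ≡ + 0)
  odd≢0 w e = Mod2.1≉0 (Mod2.≈-trans (Mod2.≈-sym odd≈1) (Mod2.≈-reflexive e))
    where
    odd≈1 : (+ 2 * w + + 1) Mod2.≈ + 1
    odd≈1 = Mod2.mk≈ (divides w (drop w))
      where
      drop : ∀ w → + 2 * w + + 1 - + 1 ≡ w * + 2
      drop = solve-∀

  even-square : ∀ s e → s * s ≡ + 2 * e → ∃ λ d → s ≡ + 2 * d
  even-square s e h with Mod2.≈0⇒∣ (Mod2.square≈0 {s} (Mod2.∣⇒≈0 (divides e (trans h (ℤₚ.*-comm (+ 2) e)))))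
  ... | divides d f = d , trans f (ℤₚ.*-comm d (+ 2))

  square-abs : ∀ i → i * i ≡ + (∣ i ∣ ℕ.* ∣ i ∣)
  square-abs (+ n)    = sym (ℤₚ.pos-* n n)
  square-abs -[1+ n ] = refl

  -- A nonzero integer `q` already makes `(q f)²` at least `f²`.
  sum-of-squares-tight : ∀ e f q → ¬ (q ≡ + 0) → e * e + (q * f) * (q * f) ≡ f * f → e ≡ + 0
  sum-of-squares-tight e f q q≢0 h = ℤₚ.∣i∣≡0⇒i≡0 (zero-square ∣ e ∣ (ℕₚ.n≤0⇒n≡0 (ℕₚ.+-cancelʳ-≤ (F ℕ.* F) (∣ e ∣ ℕ.* ∣ e ∣) 0 bound)))
    where
    F = ∣ f ∣
    Q = ∣ q ∣
    Q≥1 : 1 ℕ.≤ Q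
    Q≥1 = ℕₚ.n≢0⇒n>0 (λ z → q≢0 (ℤₚ.∣i∣≡0⇒i≡0 z))
    F≤QF : F ℕ.≤ Q ℕ.* F
    F≤QF = ℕₚ.≤-trans (ℕₚ.≤-reflexive (sym (ℕₚ.*-identityˡ F))) (ℕₚ.*-monoˡ-≤ F Q≥1)
    naturals : ∣ e ∣ ℕ.* ∣ e ∣ ℕ.+ (Q ℕ.* F) ℕ.* (Q ℕ.* F) ≡ F ℕ.* F
    naturals = ℤₚ.+-injective (trans (ℤₚ.pos-+ (∣ e ∣ ℕ.* ∣ e ∣) _)
      (trans (cong₂ _+_ (sym (square-abs e))
        (trans (cong (λ n → + (n ℕ.* n)) (sym (ℤₚ.abs-* q f))) (sym (square-abs (q * f)))))
      (trans h (square-abs f))))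
    bound : ∣ e ∣ ℕ.* ∣ e ∣ ℕ.+ F ℕ.* F ℕ.≤ F ℕ.* F
    bound = ℕₚ.≤-trans (ℕₚ.+-monoʳ-≤ (∣ e ∣ ℕ.* ∣ e ∣) (ℕₚ.*-mono-≤ F≤QF F≤QF)) (ℕₚ.≤-reflexive naturals)
    zero-square : ∀ n → n ℕ.* n ≡ 0 → n ≡ 0
    zero-square zero    _ = refl
    zero-square (suc n) ()

  module TwoSquares (p : ℕ) .{{_ : NonZero p}} (pr : Prime p) where

    open PrimeField p pr

    p≢0 : ¬ (+ p ≡ + 0)
    p≢0 e = ℕₚ.<⇒≢ 0<p (sym (ℤₚ.+-injective e))

    -- Gaussian integers c + di and u + vi of norm p: here p divides the real part of their
    -- product, which leaves no room for the imaginary part.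
    proportional : ∀ c d u v q → c * c + d * d ≡ + p → u * u + v * v ≡ + p →
                   c * u - d * v ≡ q * + p → ¬ (q ≡ + 0) → c ≡ u ⊎ c ≡ - u
    proportional c d u v q h k e q≢0 =
      [ (λ z → ⊥-elim (p≢0 z))
      , (λ z → [ (λ y → inj₁ (ℤₚ.i-j≡0⇒i≡j c u y)) , (λ y → inj₂ (ℤₚ.i-j≡0⇒i≡j c (- u) (trans (minus c u) y))) ]′
                 (ℤₚ.i*j≡0⇒i≡0∨j≡0 (c - u) z)) ]′
      (ℤₚ.i*j≡0⇒i≡0∨j≡0 (+ p) difference)
      where
      minus : ∀ c u → c - - u ≡ c + u
      minus = solve-∀

      brahmagupta : ∀ c d u v → (c * v + d * u) * (c * v + d * u) + (c * u - d * v) * (c * u - d * v)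
                              ≡ (c * c + d * d) * (u * u + v * v)
      brahmagupta = solve-∀

      imaginary : c * v + d * u ≡ + 0
      imaginary = sum-of-squares-tight (c * v + d * u) (+ p) q q≢0
        (trans (cong (λ z → (c * v + d * u) * (c * v + d * u) + z * z) (sym e))
               (trans (brahmagupta c d u v) (cong₂ _*_ h k)))

      expand : ∀ c d u v → (c * c + d * d) * ((c - u) * (c + u))
                         ≡ c * c * ((c * c + d * d) - (u * u + v * v)) + (c * v + d * u) * (c * v - d * u)
      expand = solve-∀

      collapse : ∀ c q f → c * c * (q - q) + + 0 * f ≡ + 0
      collapse = solve-∀

      difference : + p * ((c - u) * (c + u)) ≡ + 0
      difference = trans (cong (_* ((c - u) * (c + u))) (sym h))
        (trans (expand c d u v)
        (trans (cong₂ (λ a b → c * c * a + b * (c * v - d * u)) (cong₂ _-_ h k) imaginary)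
               (collapse c (+ p) (c * v - d * u))))

    -- The product of `c u − 2 d v` and `c u + 2 d v` is divisible by `p`, hence one factor is, and
    -- changing the sign of `d` makes it the first. Because `c u` is odd this factor is nonzero, as
    -- `proportional` requires.
    two-squares : ∀ c d u v z → c * c + d * d ≡ + p → u * u + + 2 * v * (+ 2 * v) ≡ + p →
                  c * u ≡ + 2 * z + + 1 → c ≡ u ⊎ c ≡ - u
    two-squares c d u v z h k odd =
      [ (λ r → from d h r) , (λ r → from (- d) (trans (negate c d) h) (subst (_≈ + 0) (plus c d u v) r)) ]′
      (domain (c * u - d * (+ 2 * v)) (c * u + d * (+ 2 * v)) product)
      where
      negate : ∀ c d → c * c + - d * - d ≡ c * c + d * d
      negate = solve-∀
      plus : ∀ c d u v → c * u + d * (+ 2 * v) ≡ c * u - - d * (+ 2 * v)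
      plus = solve-∀

      norm : ∀ c d u v → (c * u - d * (+ 2 * v)) * (c * u + d * (+ 2 * v)) - + 0
                       ≡ (c * c) * (u * u + + 2 * v * (+ 2 * v)) - (+ 2 * v) * (+ 2 * v) * (c * c + d * d)
      norm = solve-∀
      factor : ∀ c v q → (c * c) * q - (+ 2 * v) * (+ 2 * v) * q ≡ (c * c - (+ 2 * v) * (+ 2 * v)) * q
      factor = solve-∀
      product : (c * u - d * (+ 2 * v)) * (c * u + d * (+ 2 * v)) ≈ + 0
      product = mk≈ (divides (c * c - (+ 2 * v) * (+ 2 * v))
        (trans (norm c d u v) (trans (cong₂ (λ a b → (c * c) * a - (+ 2 * v) * (+ 2 * v) * b) k h) (factor c v (+ p)))))

      from : ∀ d → c * c + d * d ≡ + p → c * u - d * (+ 2 * v) ≈ + 0 → c ≡ u ⊎ c ≡ - u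
      from d h r = go (≈0⇒∣ r)
        where
        regroup : ∀ z d v → + 2 * z + + 1 - d * (+ 2 * v) ≡ + 2 * (z - d * v) + + 1
        regroup = solve-∀
        go : (+ p) ∣ℤ (c * u - d * (+ 2 * v)) → c ≡ u ⊎ c ≡ - u
        go (divides q e) = proportional c d u (+ 2 * v) q h k e (λ q≡0 →
          odd≢0 (z - d * v) (trans (sym (regroup z d v)) (trans (cong (λ w → w - d * (+ 2 * v)) (sym odd))
            (trans e (trans (cong (_* + p) q≡0) (ℤₚ.*-zeroˡ (+ p)))))))

    -- The congruence N ≡ 0 (mod 8) fixes the sign of S = ±2 (2b − 1).
    order-from-squares : ∀ b n N S S′ → + p ≡ + 8 * (b * b) - + 4 * b + + 1 → N ≡ + 8 * n → N ≡ + p + + 1 + S →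
                         S * S + S′ * S′ ≡ + 4 * + p → N ≡ + 8 * (b * b)
    order-from-squares b n N S S′ hp h₈ hN hS =
      [ (λ e → trans h₈ (same-sign e)) , (λ e → ⊥-elim (odd≢0 (n - b * b + b - + 1) (opposite-sign e))) ]′
        (two-squares c d (+ 2 * b - + 1) b z norm-c norm-u c*u)
      where
      open ≡.≡-Reasoning

      -- `c` is `S / 2`, solved from `8 n = p + 1 + S`; `z` exhibits `c (2 b − 1)` as odd.
      c z : ℤ
      c = + 4 * n - + 4 * (b * b) + + 2 * b - + 1
      z = + 4 * n * b - + 4 * b * b * b + + 4 * b * b - + 2 * b - + 2 * n

      c*u : c * (+ 2 * b - + 1) ≡ + 2 * z + + 1
      c*u = identity n b
        where
        identity : ∀ n b → (+ 4 * n - + 4 * (b * b) + + 2 * b - + 1) * (+ 2 * b - + 1)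
                 ≡ + 2 * (+ 4 * n * b - + 4 * b * b * b + + 4 * b * b - + 2 * b - + 2 * n) + + 1
        identity = solve-∀

      S≡2c : S ≡ + 2 * c
      S≡2c = begin
        S                                                    ≡⟨ isolate (+ p) S ⟩
        (+ p + + 1 + S) - (+ p + + 1)                        ≡⟨ cong₂ (λ x q → x - (q + + 1)) (trans (sym hN) h₈) hp ⟩
        + 8 * n - (+ 8 * (b * b) - + 4 * b + + 1 + + 1)      ≡⟨ identity n b ⟩
        + 2 * c                                              ∎
        where
        isolate : ∀ q s → s ≡ (q + + 1 + s) - (q + + 1)
        isolate = solve-∀
        identity : ∀ n b → + 8 * n - (+ 8 * (b * b) - + 4 * b + + 1 + + 1)
                 ≡ + 2 * (+ 4 * n - + 4 * (b * b) + + 2 * b - + 1)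
        identity = solve-∀

      S′-even : ∃ λ d → S′ ≡ + 2 * d
      S′-even = even-square S′ (+ 2 * (+ p - c * c)) (begin
        S′ * S′                                       ≡⟨ isolate (S * S) (S′ * S′) ⟩
        (S * S + S′ * S′) - S * S                     ≡⟨ cong₂ (λ x s → x - s * s) hS S≡2c ⟩
        + 4 * + p - (+ 2 * c) * (+ 2 * c)             ≡⟨ identity (+ p) c ⟩
        + 2 * (+ 2 * (+ p - c * c))                   ∎)
        where
        isolate : ∀ s s′ → s′ ≡ (s + s′) - s
        isolate = solve-∀
        identity : ∀ q c → + 4 * q - (+ 2 * c) * (+ 2 * c) ≡ + 2 * (+ 2 * (q - c * c))
        identity = solve-∀

      d : ℤ
      d = proj₁ S′-even

      norm-c : c * c + d * d ≡ + p
      norm-c = ℤₚ.*-cancelˡ-≡ (+ 4) (c * c + d * d) (+ p) (begin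
        + 4 * (c * c + d * d)                               ≡⟨ identity c d ⟩
        (+ 2 * c) * (+ 2 * c) + (+ 2 * d) * (+ 2 * d)       ≡⟨ cong₂ (λ s s′ → s * s + s′ * s′) S≡2c (proj₂ S′-even) ⟨
        S * S + S′ * S′                                     ≡⟨ hS ⟩
        + 4 * + p                                           ∎)
        where
        identity : ∀ c d → + 4 * (c * c + d * d) ≡ (+ 2 * c) * (+ 2 * c) + (+ 2 * d) * (+ 2 * d)
        identity = solve-∀

      norm-u : (+ 2 * b - + 1) * (+ 2 * b - + 1) + + 2 * b * (+ 2 * b) ≡ + p
      norm-u = trans (identity b) (sym hp)
        where
        identity : ∀ b → (+ 2 * b - + 1) * (+ 2 * b - + 1) + + 2 * b * (+ 2 * b) ≡ + 8 * (b * b) - + 4 * b + + 1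
        identity = solve-∀

      same-sign : c ≡ + 2 * b - + 1 → + 8 * n ≡ + 8 * (b * b)
      same-sign e = trans (forth n b) (trans (cong (λ x → + 2 * x + + 8 * (b * b) - + 4 * b + + 2) e) (back b))
        where
        forth : ∀ n b → + 8 * n ≡ + 2 * (+ 4 * n - + 4 * (b * b) + + 2 * b - + 1) + + 8 * (b * b) - + 4 * b + + 2
        forth = solve-∀
        back : ∀ b → + 2 * (+ 2 * b - + 1) + + 8 * (b * b) - + 4 * b + + 2 ≡ + 8 * (b * b)
        back = solve-∀

      -- This sign would mean `8 n = 8 b² − 8 b + 4`, which fails modulo 8.
      opposite-sign : c ≡ - (+ 2 * b - + 1) → + 2 * (n - b * b + b - + 1) + + 1 ≡ + 0
      opposite-sign e = ℤₚ.*-cancelˡ-≡ (+ 2) (+ 2 * (n - b * b + b - + 1) + + 1) (+ 0)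
        (trans (forth n b) (trans (cong (_+ (+ 2 * b - + 1)) e) (ℤₚ.+-inverseˡ (+ 2 * b - + 1))))
        where
        forth : ∀ n b → + 2 * (+ 2 * (n - b * b + b - + 1) + + 1)
              ≡ (+ 4 * n - + 4 * (b * b) + + 2 * b - + 1) + (+ 2 * b - + 1)
        forth = solve-∀

-- The list of rational points, its length, and the points above `T`.

module RationalPoints (p : ℕ) .{{_ : NonZero p}} (pr : Prime p) (m : ℤ) where

  open import Defs
  open FiniteSums
  open PrimeField p pr
  open FieldSums p pr
  open QuadraticCharacter p pr
  open JacobsthalSums p pr
  open Lines p pr m
  open Addition p pr m
  open GroupLaws p pr m
  open FiniteGroups
  open Curve p m hiding (red)
  open import Data.Nat using (_<_)
  import Data.Nat.Properties as ℕₚ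
  import Data.Nat.Divisibility as ∣
  open import Data.Integer using (+_; _+_; _-_; -_; _*_)
  import Data.Integer.Properties as ℤₚ
  open import Data.Integer.Tactic.RingSolver using (solve; solve-∀)
  open import Data.List using (List; []; _∷_; _++_; map; length; upTo; cartesianProduct)
  open import Data.List.Membership.Propositional using (_∈_)
  open import Data.List.Membership.Propositional.Properties using (∈-map⁺; ∈-map⁻; ∈-upTo⁺; ∈-upTo⁻; ∈-cartesianProduct⁺)
  open import Data.List.Relation.Unary.All as All using (All)
  import Data.List.Relation.Unary.AllPairs as AllPairs
  open import Data.List.Relation.Unary.Any using (here; there)
  open import Data.List.Relation.Unary.Unique.Propositional using (Unique)
  import Data.List.Relation.Unary.Unique.Propositional.Properties as Unique
  open import Data.Product using (_×_; _,_; proj₁; proj₂; Σ; uncurry)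
  open import Data.Sum using (_⊎_; inj₁; inj₂; [_,_]′)
  open import Data.Unit using (tt)
  open import Data.Empty using (⊥-elim)
  open import Algebra.Structures using (IsAbelianGroup)
  open import Relation.Nullary using (¬_; Dec; yes; no)
  open import Relation.Nullary.Decidable using (_×-dec_; map′)
  open import Relation.Binary.Definitions using (DecidableEquality)
  open import Relation.Binary.PropositionalEquality as ≡ using (_≡_; refl; cong; cong₂; sym; trans)

  ∑-++ : ∀ {B : Set} (xs ys : List B) f → ∑ (xs ++ ys) f ≡ ∑ xs f + ∑ ys f
  ∑-++ []       ys f = sym (ℤₚ.+-identityˡ (∑ ys f))
  ∑-++ (x ∷ xs) ys f = trans (cong (_+_ (f x)) (∑-++ xs ys f)) (sym (ℤₚ.+-assoc (f x) (∑ xs f) (∑ ys f)))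

  ∑-cartesianProduct : ∀ {B C : Set} (xs : List B) (ys : List C) f →
                       ∑ (cartesianProduct xs ys) f ≡ ∑ xs (λ x → ∑ ys (λ y → f (x , y)))
  ∑-cartesianProduct []       ys f = refl
  ∑-cartesianProduct (x ∷ xs) ys f =
    trans (∑-++ (map (x ,_) ys) (cartesianProduct xs ys) f) (cong₂ _+_ (∑-map (x ,_) ys f) (∑-cartesianProduct xs ys f))

  module _ {B : Set} {Q : B → Set} (Q? : ∀ x → Dec (Q x)) (irrelevant : ∀ {x} (q q′ : Q x) → q ≡ q′) where

    private
      cons : ∀ {x} → Dec (Q x) → List (Σ B Q) → List (Σ B Q)
      cons {x} (yes q) ys = (x , q) ∷ ys
      cons     (no _)  ys = ys

      ∈-cons⁻ : ∀ {x y} (d : Dec (Q x)) ys → y ∈ cons d ys → proj₁ y ≡ x ⊎ y ∈ ys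
      ∈-cons⁻ (yes q) ys (here refl) = inj₁ refl
      ∈-cons⁻ (yes q) ys (there m)   = inj₂ m
      ∈-cons⁻ (no _)  ys m           = inj₂ m

      ∈-cons⁺ : ∀ {x y} (d : Dec (Q x)) ys → y ∈ ys → y ∈ cons d ys
      ∈-cons⁺ (yes q) ys m = there m
      ∈-cons⁺ (no _)  ys m = m

      ∈-cons-here : ∀ {x} (d : Dec (Q x)) ys q → (x , q) ∈ cons d ys
      ∈-cons-here (yes q′) ys q = here (cong (_ ,_) (irrelevant q q′))
      ∈-cons-here (no n)   ys q = ⊥-elim (n q)

      length-cons : ∀ {x} (d : Dec (Q x)) ys → + length (cons d ys) ≡ ⟦ d ⟧ + + length ys
      length-cons (yes q) ys = refl
      length-cons (no _)  ys = sym (ℤₚ.+-identityˡ (+ length ys))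

    -- A filter that keeps the proofs. Their irrelevance ensures that the recorded pair over `x` is
    -- the one being looked for.
    collect : List B → List (Σ B Q)
    collect []       = []
    collect (x ∷ xs) = cons (Q? x) (collect xs)

    length-collect : ∀ xs → + length (collect xs) ≡ ∑ xs (λ x → ⟦ Q? x ⟧)
    length-collect []       = refl
    length-collect (x ∷ xs) = trans (length-cons (Q? x) (collect xs)) (cong (_+_ ⟦ Q? x ⟧) (length-collect xs))

    ∈-collect⁻ : ∀ xs {y} → y ∈ collect xs → proj₁ y ∈ xs
    ∈-collect⁻ (x ∷ xs) m = [ here , (λ k → there (∈-collect⁻ xs k)) ]′ (∈-cons⁻ (Q? x) (collect xs) m)

    ∈-collect⁺ : ∀ xs {x} → x ∈ xs → (q : Q x) → (x , q) ∈ collect xs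
    ∈-collect⁺ (x ∷ xs) (here refl) q = ∈-cons-here (Q? x) (collect xs) q
    ∈-collect⁺ (x ∷ xs) (there m)   q = ∈-cons⁺ (Q? x) (collect xs) (∈-collect⁺ xs m q)

    collect-unique : ∀ {xs} → Unique xs → Unique (collect xs)
    collect-unique AllPairs.[] = AllPairs.[]
    collect-unique {x ∷ xs} (x∉ AllPairs.∷ u) = go (Q? x)
      where
      go : (d : Dec (Q x)) → Unique (cons d (collect xs))
      go (yes q) = All.tabulate (λ m e → All.lookup x∉ (∈-collect⁻ xs m) (cong proj₁ e)) AllPairs.∷ collect-unique u
      go (no _)  = collect-unique u

  OnCurve-irrelevant : ∀ {P} (c c′ : OnCurve P) → c ≡ c′
  OnCurve-irrelevant {O}       c c′ = refl
  OnCurve-irrelevant {aff x y} (a , b , e) (a′ , b′ , e′) =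
    cong₂ _,_ (ℕₚ.<-irrelevant a a′) (cong₂ _,_ (ℕₚ.<-irrelevant b b′) (ℕₚ.≡-irrelevant e e′))

  abstract
    OnCurve? : ∀ P → Dec (OnCurve P)
    OnCurve? O         = yes tt
    OnCurve? (aff x y) = (x ℕₚ.<? p) ×-dec (y ℕₚ.<? p) ×-dec (red (+ y * + y - (+ x * + x * + x - m * + x)) ℕₚ.≟ 0)

  Point : Set
  Point = Σ Pt OnCurve

  point-≡ : {x y : Point} → proj₁ x ≡ proj₁ y → x ≡ y
  point-≡ {P , a} {_ , b} refl = cong (P ,_) (OnCurve-irrelevant {P} a b)

  _≟ᴱ_ : DecidableEquality Point
  x ≟ᴱ y = map′ point-≡ (cong proj₁) (proj₁ x ≟ᴾ proj₁ y)

  grid : List (ℕ × ℕ)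
  grid = cartesianProduct (upTo p) (upTo p)

  candidates : List Pt
  candidates = O ∷ map (uncurry aff) grid

  points : List Point
  points = collect OnCurve? (λ {P} → OnCurve-irrelevant {P}) candidates

  points-unique : Unique points
  points-unique = collect-unique OnCurve? (λ {P} → OnCurve-irrelevant {P})
    (All.tabulate (λ m → let _ , _ , e = ∈-map⁻ (uncurry aff) m in λ f → O≢aff (trans f e))
     AllPairs.∷ Unique.map⁺ (λ e → cong₂ _,_ (proj₁ (aff-injective e)) (proj₂ (aff-injective e)))
         (Unique.cartesianProduct⁺ (Unique.upTo⁺ p) (Unique.upTo⁺ p)))

  points-complete : ∀ x → x ∈ points
  points-complete (O       , c) = ∈-collect⁺ OnCurve? (λ {P} → OnCurve-irrelevant {P}) candidates (here refl) c
  points-complete (aff x y , c) = ∈-collect⁺ OnCurve? (λ {P} → OnCurve-irrelevant {P}) candidates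
    (there (∈-map⁺ (uncurry aff) (∈-cartesianProduct⁺ (∈-upTo⁺ (proj₁ c)) (∈-upTo⁺ (proj₁ (proj₂ c)))))) c

  module Count (2≉0 : + 2 ≉ + 0) (i : ℤ) (i² : i * i ≈ - + 1) where

    open Character 2≉0
    open Jacobsthal 2≉0 i i²
    open ≡.≡-Reasoning

    f : ℤ → ℤ
    f x = x * (x * x - m)

    affine-count : ℕ → ℤ
    affine-count x = ∑ (upTo p) (λ y → ⟦ OnCurve? (aff x y) ⟧)

    on-grid : ∀ x y → x < p → y < p → ⟦ OnCurve? (aff x y) ⟧ ≡ ⟦ + y * + y ≈? f (+ x) ⟧
    on-grid x y x<p y<p = ⟦⟧-cong (OnCurve? (aff x y)) (+ y * + y ≈? f (+ x)) forth back
      where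
      to : ∀ x y → On x y → y * y ≈ x * (x * x - m)
      to x y h = by (+ 1 · h) (solve (x ∷ y ∷ m ∷ []))
      from : ∀ x y → y * y ≈ x * (x * x - m) → On x y
      from x y h = by (+ 1 · h) (solve (x ∷ y ∷ m ∷ []))
      forth : OnCurve (aff x y) → + y * + y ≈ f (+ x)
      forth c = to (+ x) (+ y) (on (OnCurve⇒Affine c))
      back : + y * + y ≈ f (+ x) → OnCurve (aff x y)
      back h = Affine⇒OnCurve (affine x<p y<p (from (+ x) (+ y) h))

    -- The ordinates over `x` are the square roots of `f x`, and `χ` is `r − 1` by definition.
    affine-count≡ : ∀ x → x < p → affine-count x ≡ + 1 + χ (f (+ x))
    affine-count≡ x x<p = begin
      affine-count x                     ≡⟨ ∑-cong (upTo p) (λ y y∈ → on-grid x y x<p (∈-upTo⁻ y∈)) ⟩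
      r (f (+ x))                        ≡⟨ add-back (r (f (+ x))) ⟩
      + 1 + (r (f (+ x)) - + 1)          ≡⟨ cong (_+_ (+ 1)) (χ-def (f (+ x))) ⟨
      + 1 + χ (f (+ x))                  ∎
      where
      add-back : ∀ r → r ≡ + 1 + (r - + 1)
      add-back = solve-∀

    grid-count : ∑ grid (λ q → ⟦ OnCurve? (uncurry aff q) ⟧) ≡ + p * + 1 + S m
    grid-count = begin
      ∑ grid (λ q → ⟦ OnCurve? (uncurry aff q) ⟧)      ≡⟨ ∑-cartesianProduct (upTo p) (upTo p) (λ q → ⟦ OnCurve? (uncurry aff q) ⟧) ⟩
      ∑ (upTo p) affine-count                          ≡⟨ ∑-cong (upTo p) (λ x x∈ → affine-count≡ x (∈-upTo⁻ x∈)) ⟩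
      ∑ₚ (λ x → + 1 + χ (f x))                         ≡⟨ ∑ₚ-+ (λ _ → + 1) (λ x → χ (f x)) ⟩
      ∑ₚ (λ _ → + 1) + S m                             ≡⟨ cong (_+ S m) (∑ₚ-const (+ 1)) ⟩
      + p * + 1 + S m                                  ∎

    points-count : + length points ≡ + p + + 1 + S m
    points-count = begin
      + length points                                                               ≡⟨ length-collect OnCurve? (λ {P} → OnCurve-irrelevant {P}) candidates ⟩
      ⟦ OnCurve? O ⟧ + ∑ (map (uncurry aff) grid) (λ P → ⟦ OnCurve? P ⟧)            ≡⟨ cong₂ _+_ (⟦⟧-yes (OnCurve? O) tt) (∑-map (uncurry aff) grid (λ P → ⟦ OnCurve? P ⟧)) ⟩
      + 1 + ∑ grid (λ q → ⟦ OnCurve? (uncurry aff q) ⟧)                             ≡⟨ cong (_+_ (+ 1)) grid-count ⟩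
      + 1 + (+ p * + 1 + S m)                                                       ≡⟨ tidy (+ p) (S m) ⟩
      + p + + 1 + S m                                                               ∎
      where
      tidy : ∀ q s → + 1 + (q * + 1 + s) ≡ q + + 1 + s
      tidy = solve-∀

  module EllipticCurve (2≉0 : + 2 ≉ + 0) (m≉0 : m ≉ + 0) (i : ℤ) (i² : i * i ≈ - + 1) (t : ℤ) (t⁴ : t * t * (t * t) ≈ m) where

    open GroupLaw 2≉0 m≉0 i i²
    open Count 2≉0 i i²

    _⊞_ : Point → Point → Point
    (P , a) ⊞ (Q , b) = P ⊕ Q , ⊕-on P Q a b

    𝟘 : Point
    𝟘 = O , tt

    -ᴱ_ : Point → Point
    -ᴱ (P , a) = neg P , neg-on P a

    ιᴱ : Point → Point
    ιᴱ (P , a) = ι P , ι-on P a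

    isAbelianGroup : IsAbelianGroup _≡_ _⊞_ 𝟘 -ᴱ_
    isAbelianGroup = record
      { isGroup = record
        { isMonoid = record
          { isSemigroup = record
            { isMagma = record { isEquivalence = ≡.isEquivalence ; ∙-cong = cong₂ _⊞_ }
            ; assoc   = λ { (P , a) (Q , b) (R , c) → point-≡ (⊕-assoc P Q R a b c) } }
          ; identity = (λ _ → point-≡ refl) , (λ { (P , a) → point-≡ (⊕-identityʳ P) }) }
        ; inverse = (λ { (P , a) → point-≡ (⊕-inverseˡ P a) }) , (λ { (P , a) → point-≡ (⊕-inverseʳ P a) })
        ; ⁻¹-cong = cong -ᴱ_ }
      ; comm = λ { (P , a) (Q , b) → point-≡ (⊕-comm P Q a b) } }

    red-point : ∀ x y → On x y → Affine (red x) (red y)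
    red-point x y o = affine (red<p x) (red<p y) (on-cong x y (red≈ x) (red≈ y) o)

    ⊕-red : ∀ x₁ y₁ x₂ y₂ {l x₃ y₃} → On x₁ y₁ → On x₂ y₂ → ¬ Opposite x₁ y₁ x₂ y₂ → Line x₁ y₁ x₂ y₂ l x₃ y₃ →
            aff (red x₁) (red y₁) ⊕ aff (red x₂) (red y₂) ≡ aff (red x₃) (red y₃)
    ⊕-red x₁ y₁ x₂ y₂ {l} {x₃} {y₃} o₁ o₂ n L = Sum-unique (sum (red-point x₁ y₁ o₁) (red-point x₂ y₂ o₂))
      (line (λ { (h , k) → n (≈-trans (≈-sym (red≈ x₁)) (≈-trans h (red≈ x₂)) , ≈-trans (≈-sym (+-cong (red≈ y₁) (red≈ y₂))) k) })
        (line-cong (≈-sym (red≈ x₁)) (≈-sym (red≈ y₁)) (≈-sym (red≈ x₂)) (≈-sym (red≈ y₂)) (≈-refl {l}) (≈-sym (red≈ x₃)) (≈-sym (red≈ y₃)) L)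
        (red<p x₃) (red<p y₃))

    t≉0 : t ≉ + 0
    t≉0 z = m≉0 (by (- + 1 · t⁴ ⊹ t * t * t · z) (solve (t ∷ m ∷ [])))

    i≉0 : i ≉ + 0
    i≉0 = √-1≉0 i i²

    t²≉0 : t * t ≉ + 0
    t²≉0 = *-≉0 t≉0 t≉0

    T : Point
    T = aff 0 0 , Affine⇒OnCurve (affine 0<p 0<p (origin (+ 0) refl))
      where
      origin : ∀ z → z ≡ + 0 → On z z
      origin z refl = ≈-reflexive (zero-on m)
        where
        zero-on : ∀ m → + 0 * + 0 ≡ + 0 * + 0 * + 0 - m * + 0
        zero-on = solve-∀

    on₂ : On (t * t) (+ 0)
    on₂ = by (- (t * t) · t⁴) (solve (t ∷ m ∷ []))

    on₂′ : On (- (t * t)) (+ 0)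
    on₂′ = by (t * t · t⁴) (solve (t ∷ m ∷ []))

    on₃ : On (i * (t * t)) ((+ 1 - i) * (t * t * t))
    on₃ = by (- (i * (t * t)) · t⁴ ⊹ (t * t * t) * (t * t * t) * (+ 1 - i) · i²) (solve (t ∷ m ∷ i ∷ []))

    on₃′ : On (- (i * (t * t))) ((+ 1 + i) * (t * t * t))
    on₃′ = by (i * (t * t) · t⁴ ⊹ (t * t * t) * (t * t * t) * (+ 1 + i) · i²) (solve (t ∷ m ∷ i ∷ []))

    -- The x-axis, which meets the curve at `t²`, `− t²` and `0` because `m = t⁴`.
    line₂ : Line (t * t) (+ 0) (- (t * t)) (+ 0) (+ 0) (+ 0) (+ 0)
    line₂ = mkLine (mkSlope (≈-reflexive (c t)) (by (- + 1 · t⁴) (solve (t ∷ m ∷ []))))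
                   (≈-reflexive (x t)) (≈-reflexive (y t))
      where
      c : ∀ t → (- (t * t) - t * t) * + 0 ≡ + 0 - + 0
      c = solve-∀
      x : ∀ t → + 0 ≡ + 0 * + 0 - t * t - - (t * t)
      x = solve-∀
      y : ∀ t → + 0 ≡ + 0 * (t * t - + 0) - + 0
      y = solve-∀

    -- The chord from `Q₃` to `ι Q₃` has slope `2 i t³ / (−2 i t²) = − t`.
    line₃ : Line (i * (t * t)) ((+ 1 - i) * (t * t * t)) (- (i * (t * t))) ((+ 1 + i) * (t * t * t)) (- t) (t * t) (+ 0)
    line₃ = mkLine
      (mkSlope (≈-reflexive (c i t)) (by (- + 1 · t⁴ ⊹ - (t * t * (t * t)) · i²) (solve (t ∷ m ∷ i ∷ []))))
      (≈-reflexive (x i t)) (≈-reflexive (y i t))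
      where
      c : ∀ i t → (- (i * (t * t)) - i * (t * t)) * - t ≡ (+ 1 + i) * (t * t * t) - (+ 1 - i) * (t * t * t)
      c = solve-∀
      x : ∀ i t → t * t ≡ - t * - t - i * (t * t) - - (i * (t * t))
      x = solve-∀
      y : ∀ i t → + 0 ≡ - t * (i * (t * t) - t * t) - (+ 1 - i) * (t * t * t)
      y = solve-∀

    not-negative : ∀ x → x ≉ + 0 → ¬ (x ≈ - x)
    not-negative x nx h = *-≉0 2≉0 nx (by (+ 1 · h) (solve (x ∷ [])))

    α : Point → Point
    α x = x ⊞ ιᴱ x

    ι-red : ∀ x y → ι (aff (red x) (red y)) ≡ aff (red (- x)) (red (i * y))
    ι-red x y = cong₂ aff (red-cong (neg-cong (red≈ x))) (red-cong (*-cong (≈-refl {i}) (red≈ y)))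

    abstract
      -- The chain `Q₃ ↦ Q₂ ↦ T` under `α`. It is kept opaque, as only these two relations are used
      -- afterwards.
      Q₂ Q₃ : Point
      Q₂ = aff (red (t * t)) (red (+ 0)) , Affine⇒OnCurve (red-point (t * t) (+ 0) on₂)
      Q₃ = aff (red (i * (t * t))) (red ((+ 1 - i) * (t * t * t))) , Affine⇒OnCurve (red-point (i * (t * t)) ((+ 1 - i) * (t * t * t)) on₃)

      αQ₂ : α Q₂ ≡ T
      αQ₂ = point-≡ (begin
        aff (red (t * t)) (red (+ 0)) ⊕ ι (aff (red (t * t)) (red (+ 0)))
          ≡⟨ cong (aff (red (t * t)) (red (+ 0)) ⊕_) (trans (ι-red (t * t) (+ 0)) (cong (λ z → aff (red (- (t * t))) (red z)) (ℤₚ.*-zeroʳ i))) ⟩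
        aff (red (t * t)) (red (+ 0)) ⊕ aff (red (- (t * t))) (red (+ 0))
          ≡⟨ ⊕-red (t * t) (+ 0) (- (t * t)) (+ 0) on₂ on₂′ (λ o → not-negative (t * t) t²≉0 (proj₁ o)) line₂ ⟩
        aff (red (+ 0)) (red (+ 0))
          ≡⟨ cong₂ aff (≈⇒red≡ 0<p ≈-refl) (≈⇒red≡ 0<p ≈-refl) ⟩
        aff 0 0 ∎)
        where open ≡.≡-Reasoning

      αQ₃ : α Q₃ ≡ Q₂
      αQ₃ = point-≡ (begin
        aff (red x) (red y) ⊕ ι (aff (red x) (red y))
          ≡⟨ cong (aff (red x) (red y) ⊕_) (trans (ι-red x y) (cong (aff (red (- x))) (red-cong rotate))) ⟩
        aff (red x) (red y) ⊕ aff (red (- x)) (red ((+ 1 + i) * (t * t * t)))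
          ≡⟨ ⊕-red x y (- x) ((+ 1 + i) * (t * t * t)) on₃ on₃′ (λ o → not-negative x (*-≉0 i≉0 t²≉0) (proj₁ o)) line₃ ⟩
        aff (red (t * t)) (red (+ 0)) ∎)
        where
        open ≡.≡-Reasoning
        x y : ℤ
        x = i * (t * t)
        y = (+ 1 - i) * (t * t * t)
        rotate : i * ((+ 1 - i) * (t * t * t)) ≈ (+ 1 + i) * (t * t * t)
        rotate = by (- (t * t * t) · i²) (solve (t ∷ i ∷ []))

    T≢𝟘 : ¬ (T ≡ 𝟘)
    T≢𝟘 e = O≢aff (sym (cong proj₁ e))

    ι-T : ιᴱ T ≡ T
    ι-T = point-≡ (cong₂ aff (≈⇒red≡ 0<p ≈-refl) (≈⇒red≡ 0<p (≈-reflexive (ℤₚ.*-zeroʳ i))))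

    T⊞T : T ⊞ T ≡ 𝟘
    T⊞T = point-≡ (Sum-unique (sum A A) (opposite (≈-refl , ≈-refl)))
      where
      A = OnCurve⇒Affine (proj₂ T)

    -- `P` and `ι P` are opposite only if `x = − x` and `(1 + i) y = 0`.
    kernel : ∀ x → α x ≡ 𝟘 → x ≡ 𝟘 ⊎ x ≡ T
    kernel (O       , c) e = inj₁ (point-≡ refl)
    kernel (aff x y , c) e = inj₂ (point-≡ (go (sum A (affine-ι A)) (cong proj₁ e)))
      where
      A = OnCurve⇒Affine c
      halve : ∀ z → + 2 * z ≈ + 0 → z ≈ + 0
      halve z h = [ (λ k → ⊥-elim (2≉0 k)) , (λ k → k) ]′ (domain (+ 2) z h)
      2x≈0 : ∀ x x′ → x ≈ x′ → x′ ≈ - x → + 2 * x ≈ + 0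
      2x≈0 x x′ h k = by (+ 1 · h ⊹ + 1 · k) (solve (x ∷ x′ ∷ []))
      2y≈0 : ∀ y y′ → y + y′ ≈ + 0 → y′ ≈ i * y → + 2 * y ≈ + 0
      -- Multiplication by `1 − i` turns the factor `1 + i` into 2.
      2y≈0 y y′ h k = by (+ 1 - i · h ⊹ - (+ 1 - i) · k ⊹ y · i²) (solve (y ∷ y′ ∷ i ∷ []))
      go : ∀ {R} → Sum x y (red (- + x)) (red (i * + y)) R → R ≡ O → aff x y ≡ aff 0 0
      go (line _ _ _ _)     ()
      go (opposite (h , k)) _ = cong₂ aff
        (abs<p (x<p A) 0<p (halve (+ x) (2x≈0 (+ x) (+ red (- + x)) h (red≈ (- + x)))))
        (abs<p (y<p A) 0<p (halve (+ y) (2y≈0 (+ y) (+ red (i * + y)) k (red≈ (i * + y)))))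

    ιᴱ-⊞ : ∀ x y → ιᴱ (x ⊞ y) ≡ ιᴱ x ⊞ ιᴱ y
    ιᴱ-⊞ (P , a) (Q , b) = point-≡ (ι-⊕ P Q a b)

    ιᴱ-ιᴱ : ∀ x → ιᴱ (ιᴱ x) ≡ -ᴱ x
    ιᴱ-ιᴱ (P , a) = point-≡ (ι-ι P a)

    open GaussianModule isAbelianGroup _≟ᴱ_ points points-unique points-complete ιᴱ
      ιᴱ-⊞ ιᴱ-ιᴱ
      T T≢𝟘 ι-T T⊞T kernel public using (structure; 8∣order)

    8∣points : 8 ∣.∣ length points
    8∣points = 8∣order {Q₃} {Q₂} αQ₃ αQ₂

-- Specialisation to `H (suc k)`.

open import Defs
open FiniteSums
open import Data.Nat as ℕ using (ℕ; suc; _≤_)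
import Data.Nat.Properties as ℕₚ
import Data.Nat.Tactic.RingSolver as ℕSolver
open import Data.Nat.Primality using (Prime)
open import Data.Nat.Divisibility as ∣ using (divides)
open import Data.Integer using (ℤ; +_; _-_; _^_; _+_; -_; _*_)
import Data.Integer.Properties as ℤₚ
open import Data.Integer.Divisibility using (_∣_)
import Data.Integer.Divisibility.Signed as Signed
open import Data.Integer.Tactic.RingSolver using (solve-∀; solve)
open import Data.List using ([]; _∷_; length)
open import Data.Product using (_×_; _,_; Σ; ∃; ∃-syntax; proj₁; proj₂)
open import Relation.Binary.PropositionalEquality using (_≡_; sym; trans; cong; cong₂; subst; module ≡-Reasoning)
open import Relation.Nullary using (¬_)
open import Function.Definitions using (Injective)

2^[2k+3] : ∀ k → 2 ℕ.^ (2 ℕ.* suc k ℕ.+ 1) ≡ 8 ℕ.* (2 ℕ.^ k ℕ.* 2 ℕ.^ k)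
2^[2k+3] k = trans (cong (2 ℕ.^_) (exponent k)) (trans (cong (λ z → 2 ℕ.* (2 ℕ.* (2 ℕ.* z))) (ℕₚ.^-distribˡ-+-* 2 k k)) (assemble (2 ℕ.^ k)))
  where
  exponent : ∀ k → 2 ℕ.* suc k ℕ.+ 1 ≡ 3 ℕ.+ (k ℕ.+ k)
  exponent = ℕSolver.solve-∀
  assemble : ∀ b → 2 ℕ.* (2 ℕ.* (2 ℕ.* (b ℕ.* b))) ≡ 8 ℕ.* (b ℕ.* b)
  assemble = ℕSolver.solve-∀

2^[k+2] : ∀ k → 2 ℕ.^ (suc k ℕ.+ 1) ≡ 4 ℕ.* 2 ℕ.^ k
2^[k+2] k = trans (cong (2 ℕ.^_) (ℕₚ.+-comm (suc k) 1)) (assemble (2 ℕ.^ k))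
  where
  assemble : ∀ b → 2 ℕ.* (2 ℕ.* b) ≡ 4 ℕ.* b
  assemble = ℕSolver.solve-∀

-- With the index shifted by one, `b = 2ᵏ` is half of `a`, so the representation becomes
-- `(2 b)² + (2 b − 1)²` and the order `8 b²`, with the factor 8 in plain sight.
H-formula : ∀ k → let b = + (2 ℕ.^ k) in + H (suc k) ≡ + 8 * (b * b) - + 4 * b + + 1
H-formula k = begin
  + 1 + + (2 ℕ.^ (2 ℕ.* suc k ℕ.+ 1) ℕ.∸ 2 ℕ.^ (suc k ℕ.+ 1))   ≡⟨ cong₂ (λ u v → + 1 + + (u ℕ.∸ v)) (2^[2k+3] k) (2^[k+2] k) ⟩
  + 1 + + (8 ℕ.* (B ℕ.* B) ℕ.∸ 4 ℕ.* B)                         ≡⟨ cong (_+_ (+ 1)) difference ⟩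
  + 1 + (+ (8 ℕ.* (B ℕ.* B)) - + (4 ℕ.* B))                     ≡⟨ cong₂ (λ u v → + 1 + (u - v)) (trans (ℤₚ.pos-* 8 (B ℕ.* B)) (cong (_*_ (+ 8)) (ℤₚ.pos-* B B))) (ℤₚ.pos-* 4 B) ⟩
  + 1 + (+ 8 * (+ B * + B) - + 4 * + B)                         ≡⟨ ℤₚ.+-comm (+ 1) (+ 8 * (+ B * + B) - + 4 * + B) ⟩
  + 8 * (+ B * + B) - + 4 * + B + + 1                           ∎
  where
  open ≡-Reasoning
  B = 2 ℕ.^ k
  -- The truncated subtraction in `H` is therefore a true one.
  4B≤8BB : 4 ℕ.* B ≤ 8 ℕ.* (B ℕ.* B)
  4B≤8BB = ℕₚ.*-mono-≤ {4} {8} (ℕₚ.m≤m+n 4 4) (ℕₚ.m≤m*n B B {{ℕₚ.m^n≢0 2 k}})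
  difference : + (8 ℕ.* (B ℕ.* B) ℕ.∸ 4 ℕ.* B) ≡ + (8 ℕ.* (B ℕ.* B)) - + (4 ℕ.* B)
  difference = sym (trans (ℤₚ.m-n≡m⊖n (8 ℕ.* (B ℕ.* B)) (4 ℕ.* B)) (ℤₚ.⊖-≥ 4B≤8BB))

module Main (k : ℕ) (pr : Prime (H (suc k))) (m : ℤ) (m∤ : ¬ ((+ H (suc k)) ∣ m)) (t : ℤ)
            (t⁴-m : (+ H (suc k)) ∣ (t ^ 4 - m)) where

  p : ℕ
  p = H (suc k)

  b : ℤ
  b = + (2 ℕ.^ k)

  open PrimeField p pr

  H≈0 : + 8 * (b * b) - + 4 * b + + 1 ≈ + 0
  H≈0 = ∣⇒≈0 (subst (+ p Signed.∣_) (H-formula k) Signed.∣-refl)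

  -- Modulo `p`, `1 = 2 (2 b − 4 b²)`, so 2 is a unit; and `(4 b − 1)² + 1` is twice
  -- `8 b² − 4 b + 1`. Stated for a variable `b` so that the ring solver does not meet a power of 2.
  b-identities : ∀ b → + 8 * (b * b) - + 4 * b + + 1 ≈ + 0 → (+ 2 ≉ + 0) × (+ 4 * b - + 1) * (+ 4 * b - + 1) ≈ - + 1
  b-identities b h = (λ z → 1≉0 (by (+ 1 · h ⊹ (+ 2 * b - + 4 * (b * b)) · z) (solve (b ∷ [])))) ,
                     by (+ 2 · h) (solve (b ∷ []))

  i : ℤ
  i = + 4 * b - + 1

  2≉0 : + 2 ≉ + 0
  2≉0 = proj₁ (b-identities b H≈0)

  i² : i * i ≈ - + 1
  i² = proj₂ (b-identities b H≈0)

  m≉0 : m ≉ + 0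
  m≉0 z = m∤ (Signed.∣⇒∣ᵤ (≈0⇒∣ z))

  t⁴ : t * t * (t * t) ≈ m
  t⁴ = ≈-trans (≈-reflexive (regroup t)) (mk≈ (Signed.∣ᵤ⇒∣ t⁴-m))
    where
    regroup : ∀ t → t * t * (t * t) ≡ t * (t * (t * (t * + 1)))
    regroup = solve-∀

  open RationalPoints p pr m
  open EllipticCurve 2≉0 m≉0 i i² t t⁴
  open QuadraticCharacter.Character p pr 2≉0 using (nonresidue-exists)
  open JacobsthalSums.Jacobsthal p pr 2≉0 i i² using (S; jacobsthal)
  open Count 2≉0 i i² using (points-count)

  order : length points ≡ 2 ℕ.^ (2 ℕ.* suc k ℕ.+ 1)
  order = ℤₚ.+-injective (trans by-squares (sym power))
    where
    n : ℤ
    n = proj₁ nonresidue-exists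
    power : + (2 ℕ.^ (2 ℕ.* suc k ℕ.+ 1)) ≡ + 8 * (b * b)
    power = trans (cong +_ (2^[2k+3] k))
      (trans (ℤₚ.pos-* 8 (2 ℕ.^ k ℕ.* 2 ℕ.^ k)) (cong (_*_ (+ 8)) (ℤₚ.pos-* (2 ℕ.^ k) (2 ℕ.^ k))))
    eighth : 8 ∣.∣ length points → ∃ λ q → + length points ≡ + 8 * q
    eighth (divides q e) = + q , trans (cong +_ e) (trans (ℤₚ.pos-* q 8) (ℤₚ.*-comm (+ q) (+ 8)))
    by-squares : + length points ≡ + 8 * (b * b)
    by-squares = TwoSquareSums.TwoSquares.order-from-squares p pr b (proj₁ (eighth 8∣points)) (+ length points) (S m) (S (n * m))
      (H-formula k) (proj₂ (eighth 8∣points)) points-count (jacobsthal m≉0 (proj₂ nonresidue-exists))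

  open Curve p m using (OnCurve; _⊕_)

  Isomorphism : Set
  Isomorphism = Σ (G (suc k) → Pt) λ φ → (Injective _≡_ _≡_ φ
    × (∀ (g : G (suc k)) → OnCurve (φ g))
    × (∀ P → OnCurve P → ∃[ g ] (φ g ≡ P))
    × (∀ (g h : G (suc k)) → φ (addG (suc k) g h) ≡ (φ g ⊕ φ h)))

  isomorphism : Isomorphism
  isomorphism = from (structure (suc k) order)
    where
    from : (Σ (G (suc k) → Point) λ φ → Injective _≡_ _≡_ φ × (∀ x → ∃ λ g → φ g ≡ x) ×
              (∀ g h → φ (addG (suc k) g h) ≡ φ g ⊞ φ h)) → Isomorphism
    from (φ , injective , surjective , hom) =
      (λ g → proj₁ (φ g)) , (λ {g} {h} e → injective (point-≡ {φ g} {φ h} e)) , (λ g → proj₂ (φ g)) ,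
      (λ P c → let g , e = surjective (P , c) in g , cong proj₁ e) , (λ g h → cong proj₁ (hom g h))

theorem2p8 : (k : ℕ) → 1 ≤ k → Prime (H k) → (m : ℤ) →
    ¬ ((+ H k) ∣ m) → (∃[ t ] ((+ H k) ∣ (t ^ 4 - m))) →
    let open Curve (H k) m in
    Σ (G k → Pt) λ φ → (Injective _≡_ _≡_ φ
    × (∀ (g : G k) → OnCurve (φ g))
    × (∀ P → OnCurve P → ∃[ g ] (φ g ≡ P))
    × (∀ (g h : G k) → φ (addG k g h) ≡ (φ g ⊕ φ h)))
theorem2p8 (suc k) _ pr m m∤ (t , t⁴-m) = Main.isomorphism k pr m m∤ t t⁴-m
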